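{- Let $L$ be a cycle in a $2$-connected graph $G$ and let $T_1, T_2, \ldots, T_s$ be all the $L$-bridges of $G$, where these are pairwise vertex-disjoint, induce a tree in the overlap graph $O_G(L)$, and each $T_i$ is a tree. Then there exists a subfamily $\mathcal{C}\subseteq\mathcal{C}(G)$ such that: (C1) $|\mathcal{C}_e|=2$ for every $e\in E(L)$ and $|\mathcal{C}_e|\ge 4$ for every $e\in E(G)\setminus E(L)$; (C2) for each dicycle in $\mathcal{C}$ with underlying graph $C$, $L\triangle C$ is a cycle; (C3) every dicycle in $\mathcal{C}$ contains either no or exactly two attachments of each $L$-bridge; (C4) for any $ij\in\mathbb{Z}_2^2$ and any vertex $x$ which is an attachment of some $L$-bridge, there is exactly one dicycle in $\mathcal{C}$ which is of type $ij$ with respect to $x$.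
   Context: For a subgraph $H$ of a graph $G$, an $H$-bridge of $G$ is either (i) an edge in $E(G)\setminus E(H)$ with both endpoints in $V(H)$, or (ii) a subgraph consisting of a component $D$ of $G-V(H)$ together with all edges between $V(D)$ and $V(H)$. The attachments of an $H$-bridge $B$ are the vertices in $V(H)\cap V(B)$. For a cycle $L$, two $L$-bridges $B_1,B_2$ overlap if $L$ cannot be partitioned into two subpaths $L_1,L_2$ such that the attachments of $B_i$ lie entirely on $L_i$ for $i=1,2$. The overlap graph $O_G(L)$ has the $L$-bridges as vertices, two being adjacent iff they overlap; "induce a tree" means the induced subgraph of $O_G(L)$ on these vertices is a tree. For subgraphs $H_1,H_2$, $H_1\triangle H_2$ is the subgraph induced by $E(H_1)\triangle E(H_2)$. A dicycle is a directed cycle; $\mathcal{C}(G)$ denotes the family of all dicycles of $G$ (orientations of cycles of $G$), and for $\mathcal{C}\subseteq\mathcal{C}(G)$ and $e\in E(G)$, $\mathcal{C}_e$ is the set of dicycles in $\mathcal{C}$ whose underlying cycle contains $e$. Fix a cyclic order of the vertices of $L$; for $v\in V(L)$, $v^+$ and $v^-$ denote the next and previous vertex of $v$ on $L$. Let $C$ be a cycle of $G$ containing an edge $ab$ with $a\in V(L)$ and $b\notin V(L)$. An orientation $\vec C$ of $C$ is of type $00$ with respect to $a$ if it contains arcs $(b,a)$ and $(a,a^+)$; of type $01$ if it contains $(a,b)$ and $(a^+,a)$; of type $10$ if it contains $(b,a)$ and $(a,a^-)$; of type $11$ if it contains $(a,b)$ and $(a^-,a)$.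
   Formalization: In (C4), the types ij at a use an edge ab of C not in E(L), instead of requiring b ∉ V(L); read literally, (C4) fails when an L-bridge is a single chord (e.g. a 4-cycle plus a chord), and for all other bridges the two definitions agree. -}

module Defs where

open import Level using (Level; _⊔_) renaming (suc to lsuc; zero to lzero)
open import Data.Nat using (ℕ; zero; suc; _+_; _∸_; _≤_)
open import Data.Nat.DivMod using (_%_; m%n<n)
open import Data.Fin using (Fin; toℕ; fromℕ<)
open import Data.Product using (Σ; ∃; ∃-syntax; _×_; _,_)
open import Data.Sum using (_⊎_)
open import Data.Unit using (⊤)
open import Relation.Nullary using (¬_; Dec)
open import Relation.Binary.PropositionalEquality using (_≡_; _≢_)
open import Relation.Binary.Construct.Closure.ReflexiveTransitive using (Star)
open import Function.Bundles using (_⇔_)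

record Graph (n : ℕ) : Set₁ where
  field
    Adj     : Fin n → Fin n → Set
    Adj-dec : ∀ u v → Dec (Adj u v)
    sym     : ∀ {u v} → Adj u v → Adj v u
    irrefl  : ∀ {u} → ¬ Adj u u

next : ∀ {k} → Fin (suc k) → Fin (suc k)
next {k} i = fromℕ< (m%n<n (suc (toℕ i)) (suc k))

prev : ∀ {k} → Fin (suc k) → Fin (suc k)
prev {k} i = fromℕ< (m%n<n (toℕ i + k) (suc k))

dist : ∀ {k} → Fin (suc k) → Fin (suc k) → ℕ
dist {k} a p = (toℕ p + (suc k ∸ toℕ a)) % suc k

OnArc : ∀ {k} → Fin (suc k) → Fin (suc k) → Fin (suc k) → Set
OnArc a b p = dist a p ≤ dist a b

-- A cycle in R: an injective cyclic sequence of at least 3 vertices,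
-- consecutive ones related by R.  Read with its index order it is a
-- directed cycle (dicycle).
record CycleIn {A : Set} (R : A → A → Set) : Set where
  field
    m      : ℕ
    vtx    : Fin (suc (suc (suc m))) → A
    inj    : ∀ i j → vtx i ≡ vtx j → i ≡ j
    step   : ∀ i → R (vtx i) (vtx (next i))

module _ {A : Set} {R : A → A → Set} where
  open CycleIn

  OnC : CycleIn R → A → Set
  OnC c x = ∃[ i ] vtx c i ≡ x

  Arc : CycleIn R → A → A → Set
  Arc c u v = ∃[ i ] (vtx c i ≡ u × vtx c (next i) ≡ v)

  UEdge : CycleIn R → A → A → Set
  UEdge c u v = Arc c u v ⊎ Arc c v u

  SameDi : CycleIn R → CycleIn R → Set
  SameDi c d = ∀ u v → Arc c u v ⇔ Arc d u v

ConnectedOn : {A : Set} → (A → Set) → (A → A → Set) → Set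
ConnectedOn S R = ∀ x y → S x → S y → Star (λ a b → S a × S b × R a b) x y

IsTree : {A : Set} → (A → Set) → (A → A → Set) → Set
IsTree {A} S R = (∃[ x ] S x) × ConnectedOn S R
                 × ¬ CycleIn (λ a b → S a × S b × R a b)

module _ {n : ℕ} (G : Graph n) where
  open Graph G

  TwoConnected : Set
  TwoConnected = (3 ≤ n) × ConnectedOn (λ _ → ⊤) Adj
               × (∀ v → ConnectedOn (λ x → x ≢ v) Adj)

data Type : Set where
  t00 t01 t10 t11 : Type

record Subgraph (n : ℕ) : Set₁ where
  field
    V : Fin n → Set
    E : Fin n → Fin n → Set

SameSub : ∀ {n} → Subgraph n → Subgraph n → Set
SameSub B B' = (∀ x → Subgraph.V B x ⇔ Subgraph.V B' x)
             × (∀ x y → Subgraph.E B x y ⇔ Subgraph.E B' x y)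

module _ {n : ℕ} (G : Graph n) (L : CycleIn (Graph.Adj G)) where
  open Graph G

  InL : Fin n → Set
  InL = OnC L

  LEdge : Fin n → Fin n → Set
  LEdge = UEdge L

  chordSub : Fin n → Fin n → Subgraph n
  chordSub u v = record
    { V = λ x → x ≡ u ⊎ x ≡ v
    ; E = λ x y → (x ≡ u × y ≡ v) ⊎ (x ≡ v × y ≡ u) }

  IsComponentOutside : (Fin n → Set) → Set
  IsComponentOutside D =
      (∃[ x ] D x)
    × (∀ x → D x → ¬ InL x)
    × ConnectedOn D Adj
    × (∀ x y → D x → Adj x y → ¬ InL y → D y)

  compSub : (Fin n → Set) → Subgraph n
  compSub D = record
    { V = λ x → D x ⊎ (InL x × ∃[ y ] (D y × Adj y x))
    ; E = λ x y → Adj x y × (D x ⊎ D y) }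

  IsBridge : Subgraph n → Set₁
  IsBridge B =
      (∃[ u ] ∃[ v ] (Adj u v × ¬ LEdge u v × InL u × InL v
                       × SameSub B (chordSub u v)))
    ⊎ (∃[ D ] (IsComponentOutside D × SameSub B (compSub D)))

  Attachment : Subgraph n → Fin n → Set
  Attachment B x = InL x × Subgraph.V B x

  -- B₁ and B₂ do not overlap: L splits at two distinct positions a, b into
  -- the subpaths a→b and b→a with attachments of B₁ on the first and of
  -- B₂ on the second.
  NonOverlap : Subgraph n → Subgraph n → Set
  NonOverlap B₁ B₂ = ∃[ a ] ∃[ b ] (a ≢ b
    × (∀ p → Attachment B₁ (CycleIn.vtx L p) → OnArc a b p)
    × (∀ p → Attachment B₂ (CycleIn.vtx L p) → OnArc b a p))

  Overlap : Subgraph n → Subgraph n → Set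
  Overlap B₁ B₂ = ¬ NonOverlap B₁ B₂

  IsSucc : Fin n → Fin n → Set
  IsSucc a a⁺ = ∃[ i ] (CycleIn.vtx L i ≡ a × CycleIn.vtx L (next i) ≡ a⁺)

  IsPred : Fin n → Fin n → Set
  IsPred a a⁻ = ∃[ i ] (CycleIn.vtx L i ≡ a × CycleIn.vtx L (prev i) ≡ a⁻)

  OfType : Type → CycleIn Adj → Fin n → Set
  OfType t00 C a = ∃[ b ] (¬ LEdge a b × Arc C b a) × ∃[ c ] (IsSucc a c × Arc C a c)
  OfType t01 C a = ∃[ b ] (¬ LEdge a b × Arc C a b) × ∃[ c ] (IsSucc a c × Arc C c a)
  OfType t10 C a = ∃[ b ] (¬ LEdge a b × Arc C b a) × ∃[ c ] (IsPred a c × Arc C a c)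
  OfType t11 C a = ∃[ b ] (¬ LEdge a b × Arc C a b) × ∃[ c ] (IsPred a c × Arc C c a)

ExactlyCount : ∀ {m} (k : ℕ) → (Fin m → Set) → Set
ExactlyCount {m} k P = Σ (Fin k → Fin m) λ f → (∀ i j → f i ≡ f j → i ≡ j)
  × (∀ i → P (f i)) × (∀ j → P j → ∃[ i ] f i ≡ j)

AtLeastCount : ∀ {m} (k : ℕ) → (Fin m → Set) → Set
AtLeastCount {m} k P = Σ (Fin k → Fin m) λ f →
  (∀ i j → f i ≡ f j → i ≡ j) × (∀ i → P (f i))

{-# OPTIONS --safe #-}

-- Read L as a cyclic word whose letters are the bridges, one at each attachment. A dicycle of the family alternates
-- between segments of L and jumps through bridges, visits every bridge at most once, and carries with it its complement,
-- the cycle L △ C, which makes the same jumps and uses the other segments. Exactly one dicycle traverses each segment in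
-- each direction.
--
-- Such families can be glued. If words x u and z g have one, where x and z are attachments of the same bridge and u, g
-- share no other bridge, then so has g u: one dicycle of each of the four types passes through x, likewise through z, and
-- cutting these open at x and z and joining matching types gives four dicycles of g u; the complements are joined in the
-- same way. A leaf of the overlap tree, with neighbour p, splits the word into blocks of leaf letters alternating with
-- gaps, and each gap together with one further attachment of p is a smaller word with an overlap tree. Contracting blocks
-- and gaps leaves a word y₁ x₁ … yᵣ xᵣ in two letters, for which the dicycles xᵢ yᵢ ⇒ yᵢ₊₁ xᵢ₊₁ ⇒ xᵢ and their analogues
-- for the rotated word form a family; gluing restores the blocks and gaps, and inserts the vertices of L that are no
-- attachments.
--
-- Every partition of the attachments of one bridge into two nonempty parts is crossed by at least two jumps in each
-- direction; this survives gluing. An edge e of a bridge partitions the attachments, both parts being nonempty by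
-- 2-connectedness, and every jump from one part to the other runs through e. So e lies on at least four dicycles.
module Submission where

open import Defs
open import Data.Bool using (Bool; true; false; not)
open import Data.Empty using (⊥; ⊥-elim)
open import Data.Fin using (Fin; zero; suc; toℕ; fromℕ; inject₁)
open import Data.Fin.Patterns using (0F; 1F; 2F; 3F)
open import Data.Fin.Properties using (toℕ-injective; toℕ-fromℕ<; toℕ-inject₁; toℕ-fromℕ; toℕ<n; any?; suc-injective) renaming (_≟_ to _≟ᶠ_)
open import Data.Fin.Relation.Unary.Top using (view; ‵fromℕ; ‵inject₁)
open import Data.List using (List; []; _∷_; _++_; map; length; lookup; reverse; concatMap; mapMaybe; deduplicate; filter; allFin; tabulate)
open import Data.List.Membership.Propositional using (_∈_; _∉_)
open import Data.List.Membership.Propositional.Properties using (∈-++⁺ˡ; ∈-++⁺ʳ; ∈-++⁻; ∈-map⁺; ∈-map⁻; ∈-∃++; ∈-lookup; ∈-deduplicate⁺; ∈-deduplicate⁻; ∈-length; ∈-allFin; ∈-filter⁺; ∈-filter⁻)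
open import Data.List.Properties using (++-assoc; ++-identityʳ; unfold-reverse; map-++; length-++; filter-accept; filter-reject; reverse-involutive)
open import Data.List.Relation.Binary.Permutation.Propositional using (_↭_; ↭-sym; ↭-reflexive; prep; swap) renaming (refl to ↭refl; trans to ↭trans)
open import Data.List.Relation.Binary.Permutation.Propositional.Properties using (∈-resp-↭; All-resp-↭; ++-comm; shift; drop-∷; map⁺; ++⁺ʳ; ++⁺ˡ; ↭-reverse; ↭-length)
open import Data.List.Relation.Binary.Pointwise using (Pointwise; []; _∷_)
open import Data.List.Relation.Binary.Sublist.Propositional using (_⊆_; []; _∷_; _∷ʳ_; ⊆-trans; ⊆-refl; minimum; from∈)
open import Data.List.Relation.Unary.All as All using (All; []; _∷_)
open import Data.List.Relation.Unary.All.Properties using (¬All⇒Any¬)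
open import Data.List.Relation.Unary.AllPairs using ([]; _∷_; AllPairs)
open import Data.List.Relation.Unary.Any as Any using (Any; here; there)
open import Data.List.Relation.Unary.Any.Properties using (lookup-index)
open import Data.List.Relation.Unary.Unique.Propositional using (Unique)
open import Data.List.Relation.Unary.Unique.Propositional.Properties using (allFin⁺)
open import Data.Maybe using (Maybe; just; nothing)
open import Data.Maybe.Properties using (just-injective; ≡-dec)
open import Data.Nat using (ℕ; zero; suc; _+_; _≤_; z≤n; s≤s; _<_; s≤s⁻¹; _∸_)
open import Data.Nat.DivMod using (m<n⇒m%n≡m; n%n≡0; _%_; [m+n]%n≡m%n)
open import Data.Nat.Properties using (+-assoc; +-comm; +-identityʳ; ≤-trans; ≤-refl; ≤-reflexive; m≤m+n; m≤n+m; +-mono-≤; +-monoʳ-≤; +-monoˡ-≤; <⇒≤; ≤-<-trans; <-≤-trans; <-irrefl; <-asym; ≮⇒≥; _<?_; <-cmp; +-cancelʳ-≤; ∸-monoˡ-≤; +-∸-comm; +-∸-assoc; m+[n∸m]≡n; ∸-monoˡ-<; n≤1+n; <-trans; m≤n⇒m<n∨m≡n)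
open import Data.Nat.Tactic.RingSolver using (solve-∀)
open import Data.Product using (Σ; ∃; ∃-syntax; _×_; _,_; proj₁; proj₂)
open import Data.Product.Properties using () renaming (≡-dec to ×-≡-dec)
open import Data.Sum using (_⊎_; inj₁; inj₂) renaming (swap to ⊎-swap)
open import Data.Unit using (⊤; tt)
open import Function using (_∘_; id)
open import Function.Bundles using (_⇔_; mk⇔; Equivalence)
open import Relation.Binary using (DecidableEquality; tri<; tri≈; tri>)
open import Relation.Binary.PropositionalEquality using (_≡_; _≢_; refl; sym; trans; cong; cong₂; subst)
open import Relation.Nullary using (¬_; Dec; yes; no)
open import Relation.Nullary.Decidable using (_×-dec_; _⊎-dec_; map′; ¬?)
open import Relation.Binary.Construct.Closure.ReflexiveTransitive using (Star; ε; _◅_; _◅◅_)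
import Data.List.Membership.Propositional as Membership
import Data.List.Relation.Binary.Sublist.Propositional as Sub
import Data.List.Relation.Binary.Sublist.Propositional.Properties as SubP
import Data.List.Relation.Unary.AllPairs.Properties as AllPairsP
import Data.List.Relation.Unary.Unique.Propositional.Properties as UniqueP
import Relation.Binary.Construct.Closure.ReflexiveTransitive as StarP

private variable
  𝒜 ℬ : Set

links : 𝒜 → List 𝒜 → 𝒜 → List (𝒜 × 𝒜)
links a [] b = (a , b) ∷ []
links a (c ∷ cs) b = (a , c) ∷ links c cs b

cpairs : List 𝒜 → List (𝒜 × 𝒜)
cpairs [] = []
cpairs (x ∷ xs) = links x xs x

links-++ : ∀ (a : 𝒜) xs c ys b → links a (xs ++ c ∷ ys) b ≡ links a xs c ++ links c ys b
links-++ a [] c ys b = refl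
links-++ a (x ∷ xs) c ys b = cong ((a , x) ∷_) (links-++ x xs c ys b)

∈-swap : ∀ (xs : List 𝒜) {ys q} → q ∈ xs ++ ys → q ∈ ys ++ xs
∈-swap xs {ys} q∈ with ∈-++⁻ xs q∈
... | inj₁ h = ∈-++⁺ʳ ys h
... | inj₂ h = ∈-++⁺ˡ h

cpairs-rot : ∀ (xs ys : List 𝒜) {q} → q ∈ cpairs (xs ++ ys) → q ∈ cpairs (ys ++ xs)
cpairs-rot [] ys {q} h = subst (λ l → q ∈ cpairs l) (sym (++-identityʳ ys)) h
cpairs-rot (x ∷ xs) [] {q} h = subst (λ l → q ∈ cpairs l) (++-identityʳ (x ∷ xs)) h
cpairs-rot (x ∷ xs) (y ∷ ys) {q} h =
  subst (q ∈_) (sym (links-++ y ys x xs y))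
    (∈-swap (links x xs y) (subst (q ∈_) (links-++ x xs y ys x) h))

links-src : ∀ (a : 𝒜) xs b → map proj₁ (links a xs b) ≡ a ∷ xs
links-src a [] b = refl
links-src a (x ∷ xs) b = cong (a ∷_) (links-src x xs b)

links-tgt : ∀ (a : 𝒜) xs b → map proj₂ (links a xs b) ≡ xs ++ b ∷ []
links-tgt a [] b = refl
links-tgt a (x ∷ xs) b = cong (x ∷_) (links-tgt x xs b)

cpairs-src : ∀ (w : List 𝒜) → map proj₁ (cpairs w) ≡ w
cpairs-src [] = refl
cpairs-src (x ∷ xs) = links-src x xs x

cpairs-tgt : ∀ (w : List 𝒜) → map proj₂ (cpairs w) ↭ w
cpairs-tgt [] = ↭refl
cpairs-tgt (x ∷ xs) = subst (_↭ x ∷ xs) (sym (links-tgt x xs x)) (++-comm xs (x ∷ []))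

links-mem : ∀ {a : 𝒜} {xs b c d} → (c , d) ∈ links a xs b → c ∈ a ∷ xs × d ∈ xs ++ b ∷ []
links-mem {a = a} {xs} {b} h =
  subst (_ ∈_) (links-src a xs b) (∈-map⁺ proj₁ h) ,
  subst (_ ∈_) (links-tgt a xs b) (∈-map⁺ proj₂ h)

cpairs-mem : ∀ {w : List 𝒜} {a b} → (a , b) ∈ cpairs w → a ∈ w × b ∈ w
cpairs-mem {w = w} h =
  subst (_ ∈_) (cpairs-src w) (∈-map⁺ proj₁ h) , ∈-resp-↭ (cpairs-tgt w) (∈-map⁺ proj₂ h)

links-end : ∀ {a : 𝒜} {xs z c d} → (c , d) ∈ links a xs z →
  (d ∈ xs × ∀ n → (c , d) ∈ links a xs n) ⊎ (d ≡ z × ∀ n → (c , n) ∈ links a xs n)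
links-end {xs = []} (here refl) = inj₂ (refl , λ n → here refl)
links-end {xs = x ∷ xs} (here refl) = inj₁ (here refl , λ n → here refl)
links-end {xs = x ∷ xs} (there h) with links-end h
... | inj₁ (p , q) = inj₁ (there p , there ∘ q)
... | inj₂ (p , q) = inj₂ (p , there ∘ q)

links-reverse : ∀ (a : 𝒜) xs b {u v} → (u , v) ∈ links a xs b → (v , u) ∈ links b (reverse xs) a
links-reverse a [] b (here refl) = here refl
links-reverse a (x ∷ xs) b {u} {v} h =
  subst ((v , u) ∈_)
    (sym (trans (cong (λ l → links b l a) (unfold-reverse x xs)) (links-++ b (reverse xs) x [] a)))
    (case h)
  where
  case : (u , v) ∈ links a (x ∷ xs) b → (v , u) ∈ links b (reverse xs) x ++ (x , a) ∷ []
  case (here refl) = ∈-++⁺ʳ (links b (reverse xs) x) (here refl)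
  case (there k) = ∈-++⁺ˡ (links-reverse x xs b k)

unique-↭ : {xs ys : List 𝒜} → xs ↭ ys → Unique xs → Unique ys
unique-↭ {𝒜 = 𝒜} = PS.Unique-resp-↭ ∘ ↭⇒↭ₛ
  where
  open import Data.List.Relation.Binary.Permutation.Propositional using (↭⇒↭ₛ)
  import Data.List.Relation.Binary.Permutation.Setoid.Properties as P
  open import Relation.Binary.PropositionalEquality using (setoid)
  module PS = P (setoid 𝒜)

unique-by : ∀ (f : 𝒜 → ℬ) {xs x y} → Unique (map f xs) → x ∈ xs → y ∈ xs → f x ≡ f y → x ≡ y
unique-by f (a ∷ u) (here refl) (here refl) e = refl
unique-by f (a ∷ u) (here refl) (there k) e = ⊥-elim (All.lookup a (∈-map⁺ f k) e)
unique-by f (a ∷ u) (there h) (here refl) e = ⊥-elim (All.lookup a (∈-map⁺ f h) (sym e))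
unique-by f (a ∷ u) (there h) (there k) e = unique-by f u h k e

unique-∉ : ∀ {x : 𝒜} {xs} → Unique (x ∷ xs) → x ∉ xs
unique-∉ (a ∷ _) h = All.lookup a h refl

unique-tail : ∀ {x : 𝒜} {xs} → Unique (x ∷ xs) → Unique xs
unique-tail (_ ∷ u) = u

unique-++ : ∀ {xs ys : List 𝒜} → Unique xs → Unique ys → (∀ {v} → v ∈ xs → v ∈ ys → ⊥) → Unique (xs ++ ys)
unique-++ u v d = ++⁺ u v λ (p , q) → d p q
  where open import Data.List.Relation.Unary.Unique.Propositional.Properties using (++⁺)

unique-++⁻ : ∀ (xs : List 𝒜) {ys} → Unique (xs ++ ys) → Unique xs × Unique ys × (∀ {v} → v ∈ xs → v ∈ ys → ⊥)
unique-++⁻ [] u = [] , u , λ ()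
unique-++⁻ (x ∷ xs) {ys} (a ∷ u) with unique-++⁻ xs u
... | ux , uy , d = All.tabulate (λ h → All.lookup a (∈-++⁺ˡ h)) ∷ ux , uy , dd
  where
  dd : ∀ {v} → v ∈ x ∷ xs → v ∈ ys → ⊥
  dd (here refl) k = All.lookup a (∈-++⁺ʳ xs k) refl
  dd (there h) k = d h k

cpairs-func : ∀ {w : List 𝒜} {a b b'} → Unique w → (a , b) ∈ cpairs w → (a , b') ∈ cpairs w → b ≡ b'
cpairs-func {w = w} u h k =
  cong proj₂ (unique-by proj₁ (subst Unique (sym (cpairs-src w)) u) h k refl)

cpairs-inj : ∀ {w : List 𝒜} {a a' b} → Unique w → (a , b) ∈ cpairs w → (a' , b) ∈ cpairs w → a ≡ a'
cpairs-inj {w = w} u h k =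
  cong proj₁ (unique-by proj₂ (unique-↭ (↭-sym (cpairs-tgt w)) u) h k refl)

cpairs-next : ∀ {w : List 𝒜} {a} → a ∈ w → ∃[ b ] (a , b) ∈ cpairs w
cpairs-next {w = w} h with ∈-map⁻ proj₁ (subst (_ ∈_) (sym (cpairs-src w)) h)
... | (a , b) , k , refl = b , k

cpairs-prev : ∀ {w : List 𝒜} {b} → b ∈ w → ∃[ a ] (a , b) ∈ cpairs w
cpairs-prev {w = w} h with ∈-map⁻ proj₂ (∈-resp-↭ (↭-sym (cpairs-tgt w)) h)
... | (a , b) , k , refl = a , k

cpairs-irr : ∀ {w : List 𝒜} {a b c} → Unique w → b ∈ w → a ≢ b → (a , c) ∈ cpairs w → a ≢ c
cpairs-irr {𝒜 = 𝒜} {w} {a} u b∈ a≢b h refl with ∈-∃++ (proj₁ (cpairs-mem {w = w} h))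
... | xs , ys , eq with subst Unique eq u | subst (_ ∈_) eq b∈ | subst (λ l → _ ∈ cpairs l) eq h
... | u' | b∈' | h' = go (ys ++ xs) (unique-↭ (++-comm xs (a ∷ ys)) u') (∈-swap xs b∈') (cpairs-rot xs (a ∷ ys) h')
  where
  go : ∀ zs → Unique (a ∷ zs) → _ ∈ a ∷ zs → (a , a) ∈ cpairs (a ∷ zs) → ⊥
  go zs u (here e) h = a≢b (sym e)
  go (z ∷ zs) u (there _) h =
    unique-∉ u (here (cpairs-func {w = a ∷ z ∷ zs} u h (here refl)))

cpairs-front : ∀ {w : List 𝒜} {a b} → Unique w → a ≢ b → (a , b) ∈ cpairs w →
  ∃[ ρ ] ∃[ xs ] ∃[ ys ] (w ≡ xs ++ ys × ys ++ xs ≡ a ∷ b ∷ ρ)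
cpairs-front {w = w} {a} {b} u a≢b h with ∈-∃++ (proj₁ (cpairs-mem {w = w} h))
... | xs , ys , eq with subst Unique eq u | subst (λ l → _ ∈ cpairs l) eq h
... | u' | h' = go (ys ++ xs) refl (unique-↭ (++-comm xs (a ∷ ys)) u') (cpairs-rot xs (a ∷ ys) h')
  where
  go : ∀ zs → ys ++ xs ≡ zs → Unique (a ∷ zs) → (a , b) ∈ cpairs (a ∷ zs) →
       ∃[ ρ ] ∃[ xs ] ∃[ ys ] (w ≡ xs ++ ys × ys ++ xs ≡ a ∷ b ∷ ρ)
  go [] e u (here e') = ⊥-elim (a≢b (sym (cong proj₂ e')))
  go (z ∷ zs) e u h with cpairs-func {w = a ∷ z ∷ zs} u h (here refl)
  ... | refl = zs , xs , a ∷ ys , eq , cong (a ∷_) e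

data ExOne {D : Set} (P : D → Set) : List D → Set where
  here  : ∀ {d F} → P d → All (¬_ ∘ P) F → ExOne P (d ∷ F)
  there : ∀ {d F} → ¬ P d → ExOne P F → ExOne P (d ∷ F)

module _ {D : Set} {P : D → Set} where

  ExOne-↭ : ∀ {F G} → F ↭ G → ExOne P F → ExOne P G
  ExOne-↭ ↭refl e = e
  ExOne-↭ (prep x p) (here q n) = here q (All-resp-↭ p n)
  ExOne-↭ (prep x p) (there n e) = there n (ExOne-↭ p e)
  ExOne-↭ (swap x y p) (here q (n ∷ ns)) = there n (here q (All-resp-↭ p ns))
  ExOne-↭ (swap x y p) (there n (here q ns)) = here q (n ∷ All-resp-↭ p ns)
  ExOne-↭ (swap x y p) (there n (there m e)) = there m (there n (ExOne-↭ p e))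
  ExOne-↭ (↭trans p q) e = ExOne-↭ q (ExOne-↭ p e)

  ExOne-tail : ∀ {d F} → ExOne P (d ∷ F) → ¬ P d → ExOne P F
  ExOne-tail (here p _) n = ⊥-elim (n p)
  ExOne-tail (there _ e) _ = e

  ExOne-split : ∀ {F} → ExOne P F → ∃[ d ] ∃[ R ] (F ↭ d ∷ R × P d × All (¬_ ∘ P) R)
  ExOne-split (here {d} {F} p n) = d , F , ↭refl , p , n
  ExOne-split (there {d} n e) with ExOne-split e
  ... | d' , R , q , p , m = d' , d ∷ R , ↭trans (prep d q) (swap d d' ↭refl) , p , n ∷ m

  ExOne-++ˡ : ∀ {F G} → ExOne P F → All (¬_ ∘ P) G → ExOne P (F ++ G)
  ExOne-++ˡ (here p n) m = here p (AllP.++⁺ n m)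
    where import Data.List.Relation.Unary.All.Properties as AllP
  ExOne-++ˡ (there n e) m = there n (ExOne-++ˡ e m)

  ExOne-++ʳ : ∀ {F G} → All (¬_ ∘ P) F → ExOne P G → ExOne P (F ++ G)
  ExOne-++ʳ [] e = e
  ExOne-++ʳ (n ∷ ns) e = there n (ExOne-++ʳ ns e)

  ExOne-reduce : ∀ {C : Set} {Q R : C → Set} (f : ∀ {x} → R x → D) {xs} (ps : All R xs) →
    (∀ {x} (r : R x) → Q x → P (f r)) → (∀ {x} (r : R x) → P (f r) → Q x) →
    ExOne Q xs → ExOne P (All.reduce f ps)
  none-reduce : ∀ {C : Set} {Q R : C → Set} (f : ∀ {x} → R x → D) {xs} (ps : All R xs) →
    (∀ {x} (r : R x) → P (f r) → Q x) → All (¬_ ∘ Q) xs → All (¬_ ∘ P) (All.reduce f ps)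
  ExOne-reduce f (r ∷ ps) t s (here q n) = here (t r q) (none-reduce f ps s n)
  ExOne-reduce f (r ∷ ps) t s (there n e) = there (n ∘ s r) (ExOne-reduce f ps t s e)
  none-reduce f [] s [] = []
  none-reduce f (r ∷ ps) s (n ∷ ns) = (n ∘ s r) ∷ none-reduce f ps s ns

all-reduce : ∀ {C D : Set} {R : C → Set} {P : D → Set} (f : ∀ {x} → R x → D) {xs} (ps : All R xs) →
  (∀ {x} (r : R x) → P (f r)) → All P (All.reduce f ps)
all-reduce f [] t = []
all-reduce f (r ∷ ps) t = t r ∷ all-reduce f ps t

ExOne-unique : ∀ {D X : Set} (f : D → X) {xs y} → Unique (map f xs) → y ∈ map f xs → ExOne (λ d → f d ≡ y) xs
ExOne-unique f {x ∷ xs} (a ∷ u) (here e) =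
  here (sym e) (All.tabulate λ d∈ e' → All.lookup a (∈-map⁺ f d∈) (trans (sym e) (sym e')))
ExOne-unique f {x ∷ xs} (a ∷ u) (there h) = there (All.lookup a h) (ExOne-unique f u h)

ExOne-cong : ∀ {C D : Set} {P : C → Set} {Q : D → Set} {F G} →
  Pointwise (λ c d → (P c → Q d) × (Q d → P c)) F G → ExOne P F → ExOne Q G
none-cong : ∀ {C D : Set} {P : C → Set} {Q : D → Set} {F G} →
  Pointwise (λ c d → (P c → Q d) × (Q d → P c)) F G → All (¬_ ∘ P) F → All (¬_ ∘ Q) G
ExOne-cong ((f , g) ∷ r) (here p n) = here (f p) (none-cong r n)
ExOne-cong ((f , g) ∷ r) (there n e) = there (n ∘ g) (ExOne-cong r e)
none-cong [] [] = []
none-cong ((f , g) ∷ r) (n ∷ ns) = (n ∘ g) ∷ none-cong r ns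

reduce-pw : ∀ {D D' : Set} {R : D → Set} {S : D → D' → Set} (f : ∀ {x} → R x → D') →
  (∀ {x} (r : R x) → S x (f r)) → ∀ {xs} (ps : All R xs) → Pointwise S xs (All.reduce f ps)
reduce-pw f h [] = []
reduce-pw f h (r ∷ ps) = h r ∷ reduce-pw f h ps

ExOne-map : ∀ {C D : Set} {P : C → Set} {Q : D → Set} (f : C → D) → (∀ c → P c → Q (f c)) → (∀ c → Q (f c) → P c) →
  ∀ {F} → ExOne P F → ExOne Q (map f F)
ExOne-map {P = P} {Q} f g h e = ExOne-cong (pw _) e
  where
  pw : ∀ F → Pointwise (λ c d → (P c → Q d) × (Q d → P c)) F (map f F)
  pw [] = []
  pw (c ∷ F) = (g c , h c) ∷ pw F

crossing : ∀ (f : 𝒜 → Bool) {w : List 𝒜} {a b} → a ∈ w → b ∈ w → f a ≡ true → f b ≡ false →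
  ∃[ c ] ∃[ d ] ((c , d) ∈ cpairs w × f c ≡ true × f d ≡ false)
crossing {𝒜 = 𝒜} f {w} {a} {b} a∈ b∈ fa fb with ∈-∃++ a∈
... | xs , ys , refl with ∈-swap xs b∈
... | here refl = ⊥-elim (t≢f (trans (sym fa) fb))
  where
  t≢f : true ≢ false
  t≢f ()
... | there h = let c , d , k , p , q = go a (ys ++ xs) a fa h in c , d , cpairs-rot (a ∷ ys) xs k , p , q
  where
  go : ∀ u zs e → f u ≡ true → b ∈ zs → ∃[ c ] ∃[ d ] ((c , d) ∈ links u zs e × f c ≡ true × f d ≡ false)
  go u (z ∷ zs) e fu (here refl) = u , z , here refl , fu , fb
  go u (z ∷ zs) e fu (there h) with f z in fz
  ... | false = u , z , here refl , fu , fz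
  ... | true = let c , d , k , p , q = go z zs e fz h in c , d , there k , p , q

-- Words, dicycles and their complements

data Dir : Set where
  fwd bwd : Dir

opp : Dir → Dir
opp fwd = bwd
opp bwd = fwd

data Kind : Set where
  seg : Dir → Kind
  jmp : Kind

rv : Kind → Kind
rv (seg d) = seg (opp d)
rv jmp = jmp

rv-rv : ∀ k → rv (rv k) ≡ k
rv-rv (seg fwd) = refl
rv-rv (seg bwd) = refl
rv-rv jmp = refl

Alt : Kind → Kind → Set
Alt (seg _) (seg _) = ⊥
Alt (seg _) jmp = ⊤
Alt jmp (seg _) = ⊤
Alt jmp jmp = ⊥

Alt-rv : ∀ k k' → Alt k k' → Alt (rv k') (rv k)
Alt-rv (seg _) jmp _ = tt
Alt-rv jmp (seg _) _ = tt

-- How a dicycle passes an attachment: it arrives by a jump and leaves along L in direction d, or conversely.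
-- The types 00, 10, 11, 01 are out fwd, out bwd, inn fwd, inn bwd.
data Turn : Set where
  out inn : Dir → Turn

tOut tIn wOut wIn : Turn → Kind
tOut (out d) = seg d
tOut (inn d) = jmp
tIn (out d) = jmp
tIn (inn d) = seg d
wOut (out d) = seg (opp d)
wOut (inn d) = jmp
wIn (out d) = jmp
wIn (inn d) = seg (opp d)

opp-≢ : ∀ {d} → seg (opp d) ≢ seg d
opp-≢ {fwd} ()
opp-≢ {bwd} ()

b2n : Bool → ℕ
b2n true = 1
b2n false = 0

_⊸_ : Bool → Bool → ℕ
true ⊸ false = 1
true ⊸ true = 0
false ⊸ _ = 0

⊸-false : ∀ a → a ⊸ false ≡ b2n a
⊸-false true = refl
⊸-false false = refl

⊸-true : ∀ a → a ⊸ true ≡ 0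
⊸-true true = refl
⊸-true false = refl

true-⊸ : ∀ b → true ⊸ b ≡ b2n (not b)
true-⊸ true = refl
true-⊸ false = refl

data Mix (UT UF : Set) (a b c d : Bool) : Set where
  mixed : UT → UF → Mix UT UF a b c d
  allT  : a ≡ true → b ≡ true → c ≡ true → d ≡ true → Mix UT UF a b c d
  allF  : a ≡ false → b ≡ false → c ≡ false → d ≡ false → Mix UT UF a b c d

mix : ∀ {UT UF} a b c d → ((a ≡ true → UT) × (a ≡ false → UF)) → ((b ≡ true → UT) × (b ≡ false → UF)) →
      ((c ≡ true → UT) × (c ≡ false → UF)) → ((d ≡ true → UT) × (d ≡ false → UF)) → Mix UT UF a b c d
mix true true true true _ _ _ _ = allT refl refl refl refl
mix false false false false _ _ _ _ = allF refl refl refl refl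
mix true false _ _ u v _ _ = mixed (proj₁ u refl) (proj₂ v refl)
mix true true false _ u _ v _ = mixed (proj₁ u refl) (proj₂ v refl)
mix true true true false u _ _ v = mixed (proj₁ u refl) (proj₂ v refl)
mix false true _ _ u v _ _ = mixed (proj₁ v refl) (proj₂ u refl)
mix false false true _ u _ v _ = mixed (proj₁ v refl) (proj₂ u refl)
mix false false false true u _ _ v = mixed (proj₁ v refl) (proj₂ u refl)

-- m and n count the jumps of the two families away from x and z; the Booleans are the values of A at the
-- other ends of the jumps into (p, a) and out of (o, b) these two vertices.
module CutCount (m n : ℕ) (p₁ p₂ o₁ o₂ a₁ a₂ b₁ b₂ : Bool) where

  total : ℕ
  total = m + n + ((p₁ ⊸ b₁) + (p₂ ⊸ b₂) + ((a₁ ⊸ o₁) + (a₂ ⊸ o₂)))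

  private
    core : ∀ m n p₁ p₂ o₁ o₂ a₁ a₂ b₁ b₂ →
      2 ≤ m + (b2n p₁ + b2n p₂) → 2 ≤ m + (b2n (not o₁) + b2n (not o₂)) →
      2 ≤ n + (b2n a₁ + b2n a₂) → 2 ≤ n + (b2n (not b₁) + b2n (not b₂)) →
      2 ≤ m + n + ((p₁ ⊸ b₁) + (p₂ ⊸ b₂) + ((a₁ ⊸ o₁) + (a₂ ⊸ o₂)))
    core (suc (suc m)) n _ _ _ _ _ _ _ _ _ _ _ _ = s≤s (s≤s z≤n)
    core (suc zero) (suc n) _ _ _ _ _ _ _ _ _ _ _ _ = s≤s (s≤s z≤n)
    core zero (suc (suc n)) _ _ _ _ _ _ _ _ _ _ _ _ = s≤s (s≤s z≤n)
    core zero n true true true o₂ _ _ _ _ _ f _ _ = ⊥-elim (absurd o₂ f)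
      where
      absurd : ∀ o → 2 ≤ b2n (not o) → ⊥
      absurd true ()
      absurd false (s≤s ())
    core zero n true true false true a₁ a₂ b₁ b₂ _ (s≤s ()) _ h
    core zero n true true false false a₁ a₂ b₁ b₂ _ _ _ h rewrite true-⊸ b₁ | true-⊸ b₂ =
      ≤-trans h (+-monoʳ-≤ n (m≤m+n _ _))
    core zero n true false _ _ _ _ _ _ (s≤s ()) _ _ _
    core zero n false true _ _ _ _ _ _ (s≤s ()) _ _ _
    core zero n false false _ _ _ _ _ _ () _ _ _
    core (suc zero) zero p₁ p₂ o₁ o₂ true true true b₂ _ _ _ h = ⊥-elim (absurd b₂ h)
      where
      absurd : ∀ o → 2 ≤ b2n (not o) → ⊥
      absurd true ()
      absurd false (s≤s ())
    core (suc zero) zero p₁ p₂ o₁ o₂ true true false true _ _ _ (s≤s ())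
    core (suc zero) zero p₁ p₂ o₁ o₂ true true false false h _ _ _ rewrite ⊸-false p₁ | ⊸-false p₂ =
      ≤-trans h (s≤s (m≤m+n _ _))
    core (suc zero) zero _ _ _ _ true false _ _ _ _ (s≤s ()) _
    core (suc zero) zero _ _ _ _ false true _ _ _ _ (s≤s ()) _
    core (suc zero) zero _ _ _ _ false false _ _ _ _ () _

    up : ∀ {k l} → 2 ≤ k → k ≤ l → 2 ≤ l
    up = ≤-trans

  module _ {UT UF GT GF : Set}
    (T' : UT → 2 ≤ m + (b2n p₁ + b2n p₂)) (F' : UF → 2 ≤ m + (b2n (not o₁) + b2n (not o₂)))
    (T'' : GT → 2 ≤ n + (b2n a₁ + b2n a₂)) (F'' : GF → 2 ≤ n + (b2n (not b₁) + b2n (not b₂))) where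

    bound : Mix UT UF p₁ p₂ o₁ o₂ → Mix GT GF a₁ a₂ b₁ b₂ → UT ⊎ GT → UF ⊎ GF → 2 ≤ total
    bound (mixed t f) (mixed t' f') _ _ = core m n p₁ p₂ o₁ o₂ a₁ a₂ b₁ b₂ (T' t) (F' f) (T'' t') (F'' f')
    bound (mixed t f) (allT refl refl refl refl) _ _ rewrite true-⊸ o₁ | true-⊸ o₂ =
      up (F' f) (+-mono-≤ (m≤m+n m n) (m≤n+m _ ((p₁ ⊸ true) + (p₂ ⊸ true))))
    bound (mixed t f) (allF refl refl refl refl) _ _ rewrite ⊸-false p₁ | ⊸-false p₂ =
      up (T' t) (+-mono-≤ (m≤m+n m n) (m≤m+n _ _))
    bound (allT refl refl refl refl) (mixed t f) _ _ rewrite true-⊸ b₁ | true-⊸ b₂ =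
      up (F'' f) (+-mono-≤ (m≤n+m n m) (m≤m+n _ _))
    bound (allT refl refl refl refl) (allF refl refl refl refl) _ _ = m≤n+m 2 (m + n)
    bound (allT refl refl refl refl) (allT refl refl refl refl) _ (inj₁ f) =
      up (F' f) (+-monoˡ-≤ 0 (m≤m+n m n))
    bound (allT refl refl refl refl) (allT refl refl refl refl) _ (inj₂ f) =
      up (F'' f) (+-monoˡ-≤ 0 (m≤n+m n m))
    bound (allF refl refl refl refl) (mixed t f) _ _ rewrite ⊸-false a₁ | ⊸-false a₂ =
      up (T'' t) (+-mono-≤ (m≤n+m n m) ≤-refl)
    bound (allF refl refl refl refl) (allT refl refl refl refl) _ _ = m≤n+m 2 (m + n)
    bound (allF refl refl refl refl) (allF refl refl refl refl) (inj₁ t) _ =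
      up (T' t) (+-monoˡ-≤ 0 (m≤m+n m n))
    bound (allF refl refl refl refl) (allF refl refl refl refl) (inj₂ t) _ =
      up (T'' t) (+-monoˡ-≤ 0 (m≤n+m n m))

turns : List Turn
turns = out fwd ∷ out bwd ∷ inn fwd ∷ inn bwd ∷ []

turns-unique : Unique turns
turns-unique = ((λ ()) ∷ (λ ()) ∷ (λ ()) ∷ []) ∷ ((λ ()) ∷ (λ ()) ∷ []) ∷ ((λ ()) ∷ []) ∷ [] ∷ []

turn-inj : ∀ t t' → tOut t ≡ tOut t' → tIn t ≡ tIn t' → t ≡ t'
turn-inj (out d) (out .d) refl _ = refl
turn-inj (inn d) (inn .d) _ refl = refl

flat : ∀ {A : Set} → List (A × A) → List A
flat [] = []
flat ((y , x) ∷ ps) = y ∷ x ∷ flat ps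

flat-++ : ∀ {A : Set} (ps qs : List (A × A)) → flat (ps ++ qs) ≡ flat ps ++ flat qs
flat-++ [] qs = refl
flat-++ ((y , x) ∷ ps) qs = cong (λ l → y ∷ x ∷ l) (flat-++ ps qs)

flat-∈ : ∀ {A : Set} {ps : List (A × A)} {y x} → (y , x) ∈ ps → y ∈ flat ps × x ∈ flat ps
flat-∈ (here refl) = here refl , there (here refl)
flat-∈ {ps = _ ∷ ps} (there h) = let p , q = flat-∈ h in there (there p) , there (there q)

flat-∈⁻ : ∀ {A : Set} {ps : List (A × A)} {a} → a ∈ flat ps → (∃[ x ] (a , x) ∈ ps) ⊎ (∃[ y ] (y , a) ∈ ps)
flat-∈⁻ {ps = (y , x) ∷ ps} (here refl) = inj₁ (x , here refl)
flat-∈⁻ {ps = (y , x) ∷ ps} (there (here refl)) = inj₂ (y , here refl)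
flat-∈⁻ {ps = (y , x) ∷ ps} (there (there h)) with flat-∈⁻ {ps = ps} h
... | inj₁ (z , k) = inj₁ (z , there k)
... | inj₂ (z , k) = inj₂ (z , there k)

flat-unique : ∀ {A : Set} {ps : List (A × A)} → Unique (flat ps) → Unique ps
flat-unique {ps = []} u = []
flat-unique {ps = (y , x) ∷ ps} (n ∷ _ ∷ u) =
  All.tabulate (λ { h refl → All.lookup n (there (proj₁ (flat-∈ h))) refl }) ∷ flat-unique u

pair-up : ∀ {A : Set} → A → List (A × A) → A → List (A × A)
pair-up x [] e = (x , e) ∷ []
pair-up x ((y , x') ∷ ps) e = (x , y) ∷ pair-up x' ps e

pair-up-flat : ∀ {A : Set} (x : A) ps e → flat (pair-up x ps e) ≡ x ∷ flat ps ++ e ∷ []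
pair-up-flat x [] e = refl
pair-up-flat x ((y , x') ∷ ps) e = cong (λ l → x ∷ y ∷ l) (pair-up-flat x' ps e)

pair-up-head : ∀ {A : Set} (x : A) ps e → ∃[ b ] (x , b) ∈ pair-up x ps e
pair-up-head x [] e = e , here refl
pair-up-head x ((y , _) ∷ ps) e = y , here refl

pair-up-links : ∀ {A : Set} (x : A) ps e {q} → q ∈ links x (flat ps) e → q ∈ ps ⊎ q ∈ pair-up x ps e
pair-up-links x [] e (here refl) = inj₂ (here refl)
pair-up-links x ((y , x') ∷ ps) e (here refl) = inj₂ (here refl)
pair-up-links x ((y , x') ∷ ps) e (there (here refl)) = inj₁ (here refl)
pair-up-links x ((y , x') ∷ ps) e (there (there h)) with pair-up-links x' ps e h
... | inj₁ k = inj₁ (there k)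
... | inj₂ k = inj₂ (there k)

pair-up-all : ∀ {A : Set} {P Q : A → Set} (x : A) ps e → P x → Q e → (∀ {y z} → (y , z) ∈ ps → Q y × P z) →
            ∀ {u v} → (u , v) ∈ pair-up x ps e → P u × Q v
pair-up-all x [] e px qe f (here refl) = px , qe
pair-up-all x ((y , x') ∷ ps) e px qe f (here refl) = px , proj₁ (f (here refl))
pair-up-all x ((y , x') ∷ ps) e px qe f (there h) = pair-up-all x' ps e (proj₂ (f (here refl))) qe (f ∘ there) h

module _ {A : Set} where

  ⊆-∈ : ∀ {xs ys : List A} {a} → xs ⊆ ys → a ∈ xs → a ∈ ys
  ⊆-∈ s = Sub.lookup s

  ⊆-dropˡ : ∀ pre {post : List A} {a xs} → a ∉ pre → a ∷ xs ⊆ pre ++ post → a ∷ xs ⊆ post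
  ⊆-dropˡ [] n s = s
  ⊆-dropˡ (p ∷ pre) n (_ ∷ʳ s) = ⊆-dropˡ pre (n ∘ there) s
  ⊆-dropˡ (p ∷ pre) n (refl ∷ s) = ⊥-elim (n (here refl))

  ⊆-dropʳ : ∀ ys {z : A} g {post} → z ∉ post → ys ++ z ∷ [] ⊆ g ++ post → ys ++ z ∷ [] ⊆ g
  ⊆-dropʳ ys [] n s = ⊥-elim (n (⊆-∈ s (∈-++⁺ʳ ys (here refl))))
  ⊆-dropʳ [] (h ∷ g) n (_ ∷ʳ s) = h ∷ʳ ⊆-dropʳ [] g n s
  ⊆-dropʳ (y ∷ ys) (h ∷ g) n (_ ∷ʳ s) = h ∷ʳ ⊆-dropʳ (y ∷ ys) g n s
  ⊆-dropʳ [] (h ∷ g) n (refl ∷ s) = refl ∷ minimum g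
  ⊆-dropʳ (y ∷ ys) (h ∷ g) n (refl ∷ s) = refl ∷ ⊆-dropʳ ys g n s

  ⊆-split : ∀ (ys : List A) {zs xs} → xs ⊆ ys ++ zs → ∃[ xs₁ ] ∃[ xs₂ ] (xs ≡ xs₁ ++ xs₂ × xs₁ ⊆ ys × xs₂ ⊆ zs)
  ⊆-split [] s = [] , _ , refl , [] , s
  ⊆-split (y ∷ ys) (_ ∷ʳ s) = let a , b , e , p , q = ⊆-split ys s in a , b , e , y ∷ʳ p , q
  ⊆-split (y ∷ ys) (refl ∷ s) = let a , b , e , p , q = ⊆-split ys s in y ∷ a , b , cong (y ∷_) e , refl ∷ p , q

-- Cycles and walks from lists

next-inject₁ : ∀ {k} (i : Fin k) → next (inject₁ i) ≡ suc i
next-inject₁ {k} i = toℕ-injective (trans (toℕ-fromℕ< _)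
  (trans (m<n⇒m%n≡m (s≤s (subst (_< k) (sym (toℕ-inject₁ i)) (toℕ<n i)))) (cong suc (toℕ-inject₁ i))))

next-fromℕ : ∀ k → next (fromℕ k) ≡ zero
next-fromℕ k = toℕ-injective (trans (toℕ-fromℕ< _)
  (subst (λ j → suc j Data.Nat.DivMod.% suc k ≡ 0) (sym (toℕ-fromℕ k)) (n%n≡0 (suc k))))
  where import Data.Nat.DivMod

module _ {A : Set} where

  links-lookup : ∀ (x : A) xs e i → (lookup (x ∷ xs) (inject₁ i) , lookup xs i) ∈ links x xs e
  links-lookup x (y ∷ xs) e zero = here refl
  links-lookup x (y ∷ xs) e (suc i) = there (links-lookup y xs e i)

  links-last : ∀ (x : A) xs e → (lookup (x ∷ xs) (fromℕ (length xs)) , e) ∈ links x xs e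
  links-last x [] e = here refl
  links-last x (y ∷ xs) e = there (links-last y xs e)

  cpairs-lookup : ∀ (x : A) xs i → (lookup (x ∷ xs) i , lookup (x ∷ xs) (next i)) ∈ cpairs (x ∷ xs)
  cpairs-lookup x xs i with view i
  ... | ‵fromℕ = subst (λ j → (lookup (x ∷ xs) (fromℕ (length xs)) , lookup (x ∷ xs) j) ∈ cpairs (x ∷ xs)) (sym (next-fromℕ (length xs))) (links-last x xs x)
  ... | ‵inject₁ j = subst (λ j' → (lookup (x ∷ xs) (inject₁ j) , lookup (x ∷ xs) j') ∈ cpairs (x ∷ xs)) (sym (next-inject₁ j)) (links-lookup x xs x j)

  lookup-injective : ∀ {xs : List A} → Unique xs → ∀ i j → lookup xs i ≡ lookup xs j → i ≡ j
  lookup-injective (a ∷ u) zero zero e = refl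
  lookup-injective (a ∷ u) zero (suc j) e = ⊥-elim (All.lookup a (∈-lookup j) e)
  lookup-injective (a ∷ u) (suc i) zero e = ⊥-elim (All.lookup a (∈-lookup i) (sym e))
  lookup-injective (a ∷ u) (suc i) (suc j) e = cong suc (lookup-injective u i j e)

  module _ {R : A → A → Set} where

    cycleOf : ∀ (vs : List A) → Unique vs → 3 ≤ length vs → (∀ {a b} → (a , b) ∈ cpairs vs → R a b) → CycleIn R
    cycleOf vs@(x ∷ y ∷ z ∷ ws) u _ f = record
      { m = length ws ; vtx = lookup vs ; inj = lookup-injective u
      ; step = λ i → f (cpairs-lookup x (y ∷ z ∷ ws) i) }
    cycleOf (_ ∷ _ ∷ []) _ (s≤s (s≤s ())) _
    cycleOf (_ ∷ []) _ (s≤s ()) _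

    arc-cycleOf : ∀ vs (u : Unique vs) (l : 3 ≤ length vs) (f : ∀ {a b} → (a , b) ∈ cpairs vs → R a b) {a b} →
      Arc (cycleOf vs u l f) a b → (a , b) ∈ cpairs vs
    arc-cycleOf (x ∷ y ∷ z ∷ ws) u l f (i , refl , refl) = cpairs-lookup x (y ∷ z ∷ ws) i
    arc-cycleOf (_ ∷ _ ∷ []) _ (s≤s (s≤s ())) _ _
    arc-cycleOf (_ ∷ []) _ (s≤s ()) _ _

    cycleOf-arc : ∀ vs (u : Unique vs) (l : 3 ≤ length vs) (f : ∀ {a b} → (a , b) ∈ cpairs vs → R a b) {a b} →
      (a , b) ∈ cpairs vs → Arc (cycleOf vs u l f) a b
    cycleOf-arc vs@(x ∷ y ∷ z ∷ ws) u l f h =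
      let i = Any.index (proj₁ (cpairs-mem {w = vs} h)) ; e = lookup-index (proj₁ (cpairs-mem {w = vs} h)) in
      i , sym e , cpairs-func {w = vs} u (cpairs-lookup x (y ∷ z ∷ ws) i) (subst (λ a → (a , _) ∈ cpairs vs) e h)
    cycleOf-arc (_ ∷ _ ∷ []) _ (s≤s (s≤s ())) _ _
    cycleOf-arc (_ ∷ []) _ (s≤s ()) _ _

    on-cycleOf : ∀ vs (u : Unique vs) (l : 3 ≤ length vs) (f : ∀ {a b} → (a , b) ∈ cpairs vs → R a b) {a} →
      OnC (cycleOf vs u l f) a → a ∈ vs
    on-cycleOf vs@(x ∷ y ∷ z ∷ ws) u l f (i , refl) = ∈-lookup {xs = vs} i
    on-cycleOf (_ ∷ _ ∷ []) _ (s≤s (s≤s ())) _ _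
    on-cycleOf (_ ∷ []) _ (s≤s ()) _ _

    cycleOf-on : ∀ vs (u : Unique vs) (l : 3 ≤ length vs) (f : ∀ {a b} → (a , b) ∈ cpairs vs → R a b) {a} →
      a ∈ vs → OnC (cycleOf vs u l f) a
    cycleOf-on vs@(x ∷ y ∷ z ∷ ws) u l f h = Any.index h , sym (lookup-index h)
    cycleOf-on (_ ∷ _ ∷ []) _ (s≤s (s≤s ())) _ _
    cycleOf-on (_ ∷ []) _ (s≤s ()) _ _

data Walk {A : Set} (Q : A → A → Set) : A → List A → A → Set where
  [_]  : ∀ x → Walk Q x (x ∷ []) x
  _∷_ : ∀ {x y vs z} → Q x y → Walk Q y vs z → Walk Q x (x ∷ vs) z

module _ {A : Set} {Q : A → A → Set} where

  walk-from : ∀ {x vs z v} → Walk Q x vs z → v ∈ vs → Unique vs → ∃[ us ] (Walk Q v us z × Unique us × (∀ {t} → t ∈ us → t ∈ vs))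
  walk-from w@([ x ]) (here refl) u = _ , w , u , id
  walk-from w@(_ ∷ _) (here refl) u = _ , w , u , id
  walk-from (_ ∷ w) (there h) (_ ∷ u) = let us , w' , u' , s = walk-from w h u in us , w' , u' , there ∘ s

  walk-links : ∀ {x vs z a b e} → Walk Q x (x ∷ vs) z → (a , b) ∈ links x vs e → Q a b ⊎ (a ≡ z × b ≡ e)
  walk-links [ x ] (here refl) = inj₂ (refl , refl)
  walk-links (q ∷ [ y ]) (here refl) = inj₁ q
  walk-links (q ∷ w@(_ ∷ _)) (here refl) = inj₁ q
  walk-links (q ∷ w@([ y ])) (there h) = walk-links w h
  walk-links (q ∷ w@(_ ∷ _)) (there h) = walk-links w h

  walk-src : ∀ {x vs z} → Walk Q x vs z → ∃[ us ] vs ≡ x ∷ us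
  walk-src [ x ] = [] , refl
  walk-src (_ ∷ w) = _ , refl

  walk-tgt : ∀ {x vs z} → Walk Q x vs z → z ∈ vs
  walk-tgt [ x ] = here refl
  walk-tgt (_ ∷ w) = there (walk-tgt w)

module _ {A : Set} (_≟_ : DecidableEquality A) {Q : A → A → Set} where
  open import Data.List.Membership.DecPropositional _≟_ using (_∈?_)

  simple : ∀ {x z} → Star Q x z → ∃[ vs ] (Walk Q x vs z × Unique vs)
  simple ε = _ , [ _ ] , [] ∷ []
  simple {x} (q ◅ s) with simple s
  ... | vs , w , u with x ∈? vs
  ... | yes h = let us , w' , u' , _ = walk-from w h u in us , w' , u'
  ... | no n = x ∷ vs , q ∷ w , All.tabulate (λ h e → n (subst (_∈ vs) (sym e) h)) ∷ u

walk-mem : ∀ {A : Set} {P : A → Set} {R : A → A → Set} {x vs z} → P x → Walk (λ a b → P a × P b × R a b) x vs z → ∀ {v} → v ∈ vs → P v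
walk-mem p [ x ] (here refl) = p
walk-mem p (_ ∷ w) (here refl) = p
walk-mem p ((_ , p' , _) ∷ w) (there h) = walk-mem p' w h

module Leaf {K : Set} (_≟_ : DecidableEquality K) {R : K → K → Set} (R-sym : ∀ {i j} → R i j → R j i)
            (acyclic : ¬ CycleIn R) where

  triangle : ∀ {P : K → Set} {p m l} → P p → (∀ {i} → P i → i ≢ l) → p ≢ m → R l p → R m l →
             Star (λ a b → P a × P b × R a b) p m → ⊥
  triangle {P} {p} {m} {l} pp P≢l p≢m lp ml st with simple _≟_ st
  ... | vs , w , u with walk-src w
  ... | [] , refl = p≢m (len w)
    where
    len : ∀ {x z} {Q : K → K → Set} → Walk Q x (x ∷ []) z → x ≡ z
    len [ x ] = refl
  ... | v ∷ us , refl = acyclic (cycleOf (l ∷ p ∷ v ∷ us)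
          (All.tabulate (λ h e → P≢l (walk-mem pp w h) (sym e)) ∷ u) (s≤s (s≤s (s≤s z≤n))) edges)
    where
    edges : ∀ {a b} → (a , b) ∈ cpairs (l ∷ p ∷ v ∷ us) → R a b
    edges (here refl) = lp
    edges (there h) with walk-links w h
    ... | inj₁ (_ , _ , r) = r
    ... | inj₂ (refl , refl) = ml

  record LeafOf (S : List K) : Set where
    field
      l p  : K
      l∈   : l ∈ S
      p∈   : p ∈ S
      l≢p  : l ≢ p
      lp   : R l p
      only : ∀ {m} → m ∈ S → m ≢ l → R m l → m ≡ p
      conn : ConnectedOn (λ m → m ∈ S × m ≢ l) R

  Conn : List K → Set
  Conn S = ConnectedOn (_∈ S) R

  private
    leave : ∀ {S A B x y} → Unique (A ++ B) → S ↭ A ++ B → x ∈ A → y ∈ B →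
            Star (λ a b → a ∈ S × b ∈ S × R a b) x y → ∃[ a ] ∃[ b ] (a ∈ A × b ∈ B × R a b)
    leave {A = A} u pm x∈ y∈ ε = ⊥-elim (proj₂ (proj₂ (unique-++⁻ A u)) x∈ y∈)
    leave {A = A} u pm x∈ y∈ ((_ , b∈ , r) ◅ s) with ∈-++⁻ A (∈-resp-↭ pm b∈)
    ... | inj₁ b∈A = leave u pm b∈A y∈ s
    ... | inj₂ b∈B = _ , _ , x∈ , b∈B , r

    extend : ∀ {A a b} → Conn A → a ∈ A → R a b → Conn (b ∷ A)
    extend {A} {a} {b} c a∈ r = conn'
      where
      up : ∀ {x y} → Star (λ a b → a ∈ A × b ∈ A × R a b) x y → Star (λ a' b' → a' ∈ b ∷ A × b' ∈ b ∷ A × R a' b') x y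
      up = StarP.map λ (p , q , r) → there p , there q , r
      conn' : Conn (b ∷ A)
      conn' x y (here refl) (here refl) = ε
      conn' x y (here refl) (there h) = (here refl , there a∈ , R-sym r) ◅ up (c a y a∈ h)
      conn' x y (there h) (here refl) = up (c x a h a∈) ◅◅ ((there a∈ , here refl , r) ◅ ε)
      conn' x y (there h) (there h') = up (c x y h h')

    grow : ∀ n {S A B a₀ b₀} → length B ≡ suc n → Unique (A ++ B) → S ↭ A ++ B → Conn S → Conn A → a₀ ∈ A → b₀ ∈ B → LeafOf S
    grow n {S} {A} {B} {a₀} {b₀} len u pm cS cA a∈ b∈
      with leave u pm a∈ b∈ (cS a₀ b₀ (∈-resp-↭ (↭-sym pm) (∈-++⁺ˡ a∈)) (∈-resp-↭ (↭-sym pm) (∈-++⁺ʳ A b∈)))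
    grow zero {S} {A} {b ∷ []} {a₀} {b₀} len u pm cS cA a∈ b∈ | a , .b , a∈' , here refl , r = record
      { l = b ; p = a ; l∈ = ∈-resp-↭ (↭-sym pm) (∈-++⁺ʳ A (here refl)) ; p∈ = ∈-resp-↭ (↭-sym pm) (∈-++⁺ˡ a∈')
      ; l≢p = λ { refl → b∉ a∈' } ; lp = R-sym r
      ; only = only'
      ; conn = λ x y (x∈ , x≢) (y∈ , y≢) → back (cA x y (toA x∈ x≢) (toA y∈ y≢)) }
      where
      b∉ : b ∉ A
      b∉ h = proj₂ (proj₂ (unique-++⁻ A u)) h (here refl)
      toA : ∀ {m} → m ∈ S → m ≢ b → m ∈ A
      toA m∈ n with ∈-++⁻ A (∈-resp-↭ pm m∈)
      ... | inj₁ h = h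
      ... | inj₂ (here e) = ⊥-elim (n e)
      fromA : ∀ {m} → m ∈ A → m ∈ S × m ≢ b
      fromA h = ∈-resp-↭ (↭-sym pm) (∈-++⁺ˡ h) , λ { refl → b∉ h }
      back : ∀ {x y} → Star (λ a b → a ∈ A × b ∈ A × R a b) x y → Star (λ a' b' → (a' ∈ S × a' ≢ b) × (b' ∈ S × b' ≢ b) × R a' b') x y
      back = StarP.map λ (p , q , r) → fromA p , fromA q , r
      only' : ∀ {m} → m ∈ S → m ≢ b → R m b → m ≡ a
      only' {m} m∈ m≢ r' with m ≟ a
      ... | yes e = e
      ... | no n = ⊥-elim (triangle {P = _∈ A} a∈' (λ h e → b∉ (subst (_∈ A) e h)) (n ∘ sym) (R-sym r) r' (cA a m a∈' (toA m∈ m≢)))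
    grow (suc n) {S} {A} {B} {a₀} {b₀} len u pm cS cA a∈ b∈ | a , b , a∈' , b∈' , r with ∈-∃++ b∈'
    ... | B₁ , B₂ , refl = rec (B₁ ++ B₂) refl
      where
      moved : A ++ B₁ ++ b ∷ B₂ ↭ b ∷ A ++ B₁ ++ B₂
      moved = ↭trans (++⁺ˡ A (shift b B₁ B₂)) (shift b A (B₁ ++ B₂))
      len' : ∀ (xs : List K) {ys m} → length (xs ++ b ∷ ys) ≡ suc m → length (xs ++ ys) ≡ m
      len' [] refl = refl
      len' (x ∷ xs) {ys} {suc m} e = cong suc (len' xs (suc-inj e))
        where
        suc-inj : ∀ {i j} → suc i ≡ suc j → i ≡ j
        suc-inj refl = refl
      len' (x ∷ xs) {ys} {zero} e = ⊥-elim (bad xs e)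
        where
        bad : ∀ xs → suc (length (xs ++ b ∷ ys)) ≡ 1 → ⊥
        bad [] ()
        bad (_ ∷ _) ()
      rec : ∀ B' → B₁ ++ B₂ ≡ B' → LeafOf S
      rec [] e = ⊥-elim (bad (trans (sym (cong length e)) (len' B₁ len)))
        where
        bad : 0 ≡ suc n → ⊥
        bad ()
      rec (b' ∷ B') e = grow n {S} {b ∷ A} {B₁ ++ B₂} {b} {b'} (len' B₁ len) (unique-↭ moved u) (↭trans pm moved) cS
        (extend cA a∈' r) (here refl) (subst (b' ∈_) (sym e) (here refl))

  leaf : ∀ {S a b} → Unique S → a ∈ S → b ∈ S → a ≢ b → Conn S → LeafOf S
  leaf {x ∷ []} u (here refl) (here refl) a≢b c = ⊥-elim (a≢b refl)
  leaf {x ∷ y ∷ S} u _ _ _ c = grow (length S) {A = x ∷ []} {B = y ∷ S} refl u ↭refl c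
    (λ { a b (here refl) (here refl) → ε }) (here refl) (here refl)

module Core {E K : Set} (lab : E → Maybe K) where

  -- A step along L to a cyclic neighbour (seg), or a path through a bridge between two of its attachments (jmp).
  Edge : Set
  Edge = E × Kind × E

  src tgt : Edge → E
  src (a , _ , _) = a
  tgt (_ , _ , b) = b

  flip : Edge → Edge
  flip (a , k , b) = b , rv k , a

  rev : List Edge → List Edge
  rev C = reverse (map flip C)

  record Ring : Set₁ where
    field
      V : E → Set
      N : E → E → Set
  open Ring public

  Valid : Ring → E → Kind → E → Set
  Valid r a (seg fwd) b = N r a b
  Valid r a (seg bwd) b = N r b a
  Valid r a jmp b = a ≢ b × V r a × V r b × ∃[ i ] (lab a ≡ just i × lab b ≡ just i)

  data Path (r : Ring) : E → List Edge → E → Set where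
    []  : ∀ {a} → Path r a [] a
    _∷_ : ∀ {a k c C b} → Valid r a k c → Path r c C b → Path r a ((a , k , c) ∷ C) b

  Valid-rv : ∀ {r} {a b} k → Valid r a k b → Valid r b (rv k) a
  Valid-rv (seg fwd) v = v
  Valid-rv (seg bwd) v = v
  Valid-rv jmp (n , va , vb , i , p , q) = (λ e → n (sym e)) , vb , va , i , q , p

  Valid-⊆ : ∀ {r r'} → (∀ {a} → V r a → V r' a) → (∀ {a b} → N r a b → N r' a b) →
    ∀ {a} k {b} → Valid r a k b → Valid r' a k b
  Valid-⊆ f g (seg fwd) v = g v
  Valid-⊆ f g (seg bwd) v = g v
  Valid-⊆ f g jmp (n , va , vb , rest) = n , f va , f vb , rest

  path-⊆ : ∀ {r r'} → (∀ {a} → V r a → V r' a) → (∀ {a b} → N r a b → N r' a b) →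
    ∀ {a C b} → Path r a C b → Path r' a C b
  path-⊆ f g [] = []
  path-⊆ f g (_∷_ {k = k} v p) = Valid-⊆ f g k v ∷ path-⊆ f g p

  module _ {r : Ring} where

    path-++ : ∀ {a C c D b} → Path r a C c → Path r c D b → Path r a (C ++ D) b
    path-++ [] q = q
    path-++ (v ∷ p) q = v ∷ path-++ p q

    path-split : ∀ {a} C {D b} → Path r a (C ++ D) b → ∃[ c ] (Path r a C c × Path r c D b)
    path-split [] p = _ , [] , p
    path-split (_ ∷ C) (v ∷ p) with path-split C p
    ... | c , p₁ , p₂ = c , v ∷ p₁ , p₂

    path-valid : ∀ {a C b} → Path r a C b → ∀ {u k v} → (u , k , v) ∈ C → Valid r u k v
    path-valid (v ∷ p) (here refl) = v
    path-valid (v ∷ p) (there h) = path-valid p h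

    path-ends : ∀ {a C b} → Path r a C b → a ∷ map tgt C ≡ map src C ++ b ∷ []
    path-ends [] = refl
    path-ends (_∷_ {a = a} v p) = cong (a ∷_) (path-ends p)

    path-snoc : ∀ {a C b} → Path r a C b → a ≢ b →
      ∃[ Q ] ∃[ e ] ∃[ l ] (C ≡ Q ++ (e , l , b) ∷ [] × Path r a Q e)
    path-snoc [] ne = ⊥-elim (ne refl)
    path-snoc (v ∷ []) ne = [] , _ , _ , refl , []
    path-snoc (v ∷ p@(_ ∷ p')) ne = go v p
      where
      go : ∀ {a k c e C b} → Valid r a k c → Path r c (e ∷ C) b →
        ∃[ Q ] ∃[ e' ] ∃[ l ] ((a , k , c) ∷ e ∷ C ≡ Q ++ (e' , l , b) ∷ [] × Path r a Q e')
      go {k = k} v (v' ∷ []) = _ ∷ [] , _ , _ , refl , _∷_ {k = k} v []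
      go {k = k} v (v' ∷ p@(_ ∷ _)) with go v' p
      ... | Q , e , l , eq , q = _ ∷ Q , e , l , cong (_ ∷_) eq , _∷_ {k = k} v q

    path-rev : ∀ {a C b} → Path r a C b → Path r b (rev C) a
    path-rev [] = []
    path-rev (_∷_ {a} {k} {c} {C} v p) =
      subst (λ D → Path r _ D a) (sym (unfold-reverse (c , rv k , a) (map flip C)))
        (path-++ (path-rev p) (Valid-rv k v ∷ []))

  rev-∈ : ∀ {a k b C} → (a , k , b) ∈ C → (b , rv k , a) ∈ rev C
  rev-∈ {C = C} h = ∈-resp-↭ (↭-sym (↭-reverse (map flip C))) (∈-map⁺ flip h)

  rev-∈⁻ : ∀ {a k b C} → (a , k , b) ∈ rev C → (b , rv k , a) ∈ C
  rev-∈⁻ {C = C} h with ∈-map⁻ flip (∈-resp-↭ (↭-reverse (map flip C)) h)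
  ... | (u , k , v) , k∈ , refl = subst (λ k' → (u , k' , v) ∈ C) (sym (rv-rv k)) k∈

  record Cyc (r : Ring) (C : List Edge) : Set where
    field
      base   : E
      path   : Path r base C base
      uniq   : Unique (map src C)
      one    : ∀ {a b a' b' i} → (a , jmp , b) ∈ C → (a' , jmp , b') ∈ C →
               lab a ≡ just i → lab a' ≡ just i → a ≡ a'
      noback : ∀ {a d b} → (a , seg d , b) ∈ C → (b , seg (opp d) , a) ∈ C → ⊥

    valid : ∀ {a k b} → (a , k , b) ∈ C → Valid r a k b
    valid = path-valid path

    tgt↭src : map tgt C ↭ map src C
    tgt↭src = drop-∷ (subst (_↭ base ∷ map src C) (sym (path-ends path)) (++-comm (map src C) (base ∷ [])))

    src-uniq : ∀ {a k b k' b'} → (a , k , b) ∈ C → (a , k' , b') ∈ C → k ≡ k' × b ≡ b'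
    src-uniq h h' with unique-by src uniq h h' refl
    ... | refl = refl , refl

    tgt-uniq : ∀ {a k b k' a'} → (a , k , b) ∈ C → (a' , k' , b) ∈ C → a ≡ a' × k ≡ k'
    tgt-uniq h h' with unique-by tgt (unique-↭ (↭-sym tgt↭src) uniq) h h' refl
    ... | refl = refl , refl

    succ : ∀ {a k b} → (a , k , b) ∈ C → ∃[ k' ] ∃[ c ] (b , k' , c) ∈ C
    succ h with ∈-map⁻ src (∈-resp-↭ tgt↭src (∈-map⁺ tgt h))
    ... | (_ , k , c) , h' , refl = k , c , h'

    pred : ∀ {a k b} → (a , k , b) ∈ C → ∃[ e ] ∃[ l ] (e , l , a) ∈ C
    pred h with ∈-map⁻ tgt (∈-resp-↭ (↭-sym tgt↭src) (∈-map⁺ src h))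
    ... | (e , l , _) , h' , refl = e , l , h'
  open Cyc public

  revCyc : ∀ {r C} → Cyc r C → Cyc r (rev C)
  revCyc {r} {C} cy = record
    { base = base cy
    ; path = path-rev (path cy)
    ; uniq = unique-↭ (↭trans (↭-sym (tgt↭src cy)) (↭-sym srcs)) (uniq cy)
    ; one = λ h h' → λ p p' → one' (rev-∈⁻ h) (rev-∈⁻ h') p p'
    ; noback = λ h h' → noback cy (rev-∈⁻ h') (subst (λ d → (_ , seg d , _) ∈ C) (sym (opp-opp _)) (rev-∈⁻ h))
    }
    where
    opp-opp : ∀ d → opp (opp (opp d)) ≡ opp d
    opp-opp fwd = refl
    opp-opp bwd = refl
    srcs : map src (rev C) ↭ map tgt C
    srcs = ↭trans (map⁺ src (↭-reverse (map flip C))) (↭-reflexive (go C))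
      where
      go : ∀ D → map src (map flip D) ≡ map tgt D
      go [] = refl
      go (e ∷ D) = cong (tgt e ∷_) (go D)
    one' : ∀ {a b a' b' i} → (a , jmp , b) ∈ C → (a' , jmp , b') ∈ C →
           lab b ≡ just i → lab b' ≡ just i → b ≡ b'
    one' h h' p p' with valid cy h | valid cy h'
    ... | _ , _ , _ , i , q , s | _ , _ , _ , i' , q' , s'
      with one cy h h' (trans q (trans (sym s) p)) (trans q' (trans (sym s') p'))
    ... | refl = proj₂ (src-uniq cy h h')

  emptyCyc : ∀ {r} → E → Cyc r []
  emptyCyc b = record { base = b ; path = [] ; uniq = [] ; one = λ () ; noback = λ () }

  Us : List Edge → E → Kind → E → Set
  Us C a k b = (a , k , b) ∈ C ⊎ (b , rv k , a) ∈ C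

  Xor : Set → Set → Set
  Xor P Q = (P × ¬ Q) ⊎ (¬ P × Q)

  -- B is a dicycle and W an orientation of its symmetric difference with L.
  record Pre (r : Ring) (B W : List Edge) : Set where
    field
      alt : ∀ {a k b k' c i} → (a , k , b) ∈ B → (b , k' , c) ∈ B → lab b ≡ just i → Alt k k'
      xor : ∀ {a b} → N r a b → Xor (Us B a (seg fwd) b) (Us W a (seg fwd) b)
      ju→ : ∀ {a b} → (a , jmp , b) ∈ B → Us W a jmp b
      ju← : ∀ {a b} → (a , jmp , b) ∈ W → Us B a jmp b
  open Pre public

  record Dicycle (r : Ring) : Set where
    field
      black white : List Edge
      cb   : Cyc r black
      cw   : Cyc r white
      pre  : Pre r black white
      jump : ∃[ a ] ∃[ b ] (a , jmp , b) ∈ black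
  open Dicycle public

  Xor-map : ∀ {P P' Q Q' : Set} → (P → P') → (P' → P) → (Q → Q') → (Q' → Q) → Xor P Q → Xor P' Q'
  Xor-map f f' g g' (inj₁ (p , q)) = inj₁ (f p , q ∘ g')
  Xor-map f f' g g' (inj₂ (p , q)) = inj₂ (p ∘ f' , g q)

  Us-rev : ∀ {C a k b} → Us C a k b → Us (rev C) a k b
  Us-rev {k = k} (inj₁ h) = inj₂ (rev-∈ h)
  Us-rev {C} {a} {k} {b} (inj₂ h) = inj₁ (subst (λ k' → (a , k' , b) ∈ rev C) (rv-rv k) (rev-∈ h))

  Us-rev⁻ : ∀ {C a k b} → Us (rev C) a k b → Us C a k b
  Us-rev⁻ (inj₁ h) = inj₂ (rev-∈⁻ h)
  Us-rev⁻ {C} {a} {k} {b} (inj₂ h) = inj₁ (subst (λ k' → (a , k' , b) ∈ C) (rv-rv k) (rev-∈⁻ h))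

  preRevW : ∀ {r B W} → Pre r B W → Pre r B (rev W)
  preRevW p = record
    { alt = alt p ; xor = λ n → Xor-map id id Us-rev Us-rev⁻ (xor p n)
    ; ju→ = λ h → Us-rev (ju→ p h) ; ju← = λ h → ⊎-swap (ju← p (rev-∈⁻ h)) }

  revD : ∀ {r} → Dicycle r → Dicycle r
  revD {r} d = record
    { black = rev (black d) ; white = white d ; cb = revCyc (cb d) ; cw = cw d
    ; pre = record
      { alt = λ {a} {k} {b} {k'} h h' p → subst₂ Alt (rv-rv k) (rv-rv k') (Alt-rv _ _ (alt (pre d) (rev-∈⁻ h') (rev-∈⁻ h) p))
      ; xor = λ n → Xor-map Us-rev Us-rev⁻ id id (xor (pre d) n)
      ; ju→ = λ h → ⊎-swap (ju→ (pre d) (rev-∈⁻ h))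
      ; ju← = λ h → Us-rev (ju← (pre d) h) }
    ; jump = let a , b , h = jump d in b , a , rev-∈ h }
    where open import Relation.Binary.PropositionalEquality using (subst₂)

  record IsRing (r : Ring) : Set where
    field
      V-src : ∀ {a b} → N r a b → V r a
      V-tgt : ∀ {a b} → N r a b → V r b
      irr   : ∀ {a b} → N r a b → a ≢ b
      func  : ∀ {a b b'} → N r a b → N r a b' → b ≡ b'
      inj   : ∀ {a a' b} → N r a b → N r a' b → a ≡ a'
      nxt   : ∀ {a} → V r a → ∃[ b ] N r a b
      prv   : ∀ {b} → V r b → ∃[ a ] N r a b
      circle : List Edge
      circ  : Cyc r circle
      circ∈ : ∀ {a b} → N r a b → (a , seg fwd , b) ∈ circle
      circ-fwd : ∀ {a k b} → (a , k , b) ∈ circle → k ≡ seg fwd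

    Valid-≢ : ∀ {a} k {b} → Valid r a k b → a ≢ b
    Valid-≢ (seg fwd) v = irr v
    Valid-≢ (seg bwd) v = irr v ∘ sym
    Valid-≢ jmp v = proj₁ v

    Valid-V : ∀ {a} k {b} → Valid r a k b → V r a × V r b
    Valid-V (seg fwd) v = V-src v , V-tgt v
    Valid-V (seg bwd) v = V-tgt v , V-src v
    Valid-V jmp (_ , va , vb , _) = va , vb

    nbr : ∀ d {a} → V r a → ∃[ b ] Valid r a (seg d) b
    nbr fwd v = nxt v
    nbr bwd v = prv v

    Valid-func : ∀ d {a b b'} → Valid r a (seg d) b → Valid r a (seg d) b' → b ≡ b'
    Valid-func fwd = func
    Valid-func bwd = inj

    Valid-inj : ∀ d {a a' b} → Valid r a (seg d) b → Valid r a' (seg d) b → a ≡ a'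
    Valid-inj fwd = inj
    Valid-inj bwd = func
  open IsRing public

  record Opening (r : Ring) (C : List Edge) (x : E) (k l : Kind) : Set where
    field
      c e  : E
      Q    : List Edge
      perm : C ↭ (x , k , c) ∷ (e , l , x) ∷ Q
      pth  : Path r c Q e

    out∈ : (x , k , c) ∈ C
    out∈ = ∈-resp-↭ (↭-sym perm) (here refl)

    in∈ : (e , l , x) ∈ C
    in∈ = ∈-resp-↭ (↭-sym perm) (there (here refl))

  open-at : ∀ {r C x k c e l} → IsRing r → Cyc r C → (x , k , c) ∈ C → (e , l , x) ∈ C → Opening r C x k l
  open-at {r} {C} {x} {k} {c} {e} {l} ir cy h h' with ∈-∃++ h
  ... | A , B , refl with path-split A (path cy)
  ... | _ , pA , (v ∷ pB) with path-snoc (path-++ pB pA) (λ q → Valid-≢ ir k v (sym q))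
  ... | Q , e' , l' , eq , pQ = finish (tgt-uniq cy h' h'')
    where
    perm' : A ++ (x , k , c) ∷ B ↭ (x , k , c) ∷ (e' , l' , x) ∷ Q
    perm' = ↭trans (shift _ A B) (prep _ (↭trans (++-comm A B) (↭trans (↭-reflexive eq) (++-comm Q _))))
    h'' : (e' , l' , x) ∈ A ++ (x , k , c) ∷ B
    h'' = ∈-resp-↭ (↭-sym perm') (there (here refl))
    finish : e ≡ e' × l ≡ l' → Opening r (A ++ (x , k , c) ∷ B) x k l
    finish (refl , refl) = record { perm = perm' ; pth = pQ }

  -- Gluing

  -- r arises from r' by putting the vertices of r'' other than z, in their order, in the place of x.
  record Splice (q : K) (r' : Ring) (x : E) (r'' : Ring) (z : E) (r : Ring) : Set where
    field
      ir'  : IsRing r'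
      ir'' : IsRing r''
      x∈   : V r' x
      z∈   : V r'' z
      labx : lab x ≡ just q
      labz : lab z ≡ just q
      V'   : ∀ {a} → V r' a → a ≢ x → V r a
      V''  : ∀ {a} → V r'' a → a ≢ z → V r a
      disj : ∀ {a} → V r' a → a ≢ x → V r'' a → a ≢ z → ⊥
      share : ∀ {a b i} → V r' a → a ≢ x → V r'' b → b ≢ z → lab a ≡ just i → lab b ≡ just i → i ≡ q
      n'   : ∀ {a b} → N r' a b → a ≢ x → b ≢ x → N r a b
      n''  : ∀ {a b} → N r'' a b → a ≢ z → b ≢ z → N r a b
      nx   : ∀ {a b} → N r' a x → N r'' z b → N r a b
      nz   : ∀ {a b} → N r'' a z → N r' x b → N r a b
      Vinv : ∀ {a} → V r a → (V r' a × a ≢ x) ⊎ (V r'' a × a ≢ z)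
      inv  : ∀ {a b} → N r a b →
             ((N r' a b × a ≢ x × b ≢ x) ⊎ (N r'' a b × a ≢ z × b ≢ z)) ⊎
             ((N r' a x × N r'' z b) ⊎ (N r'' a z × N r' x b))
  open Splice public

  swapSplice : ∀ {q r' x r'' z r} → Splice q r' x r'' z r → Splice q r'' z r' x r
  swapSplice s = record
    { ir' = ir'' s ; ir'' = ir' s ; x∈ = z∈ s ; z∈ = x∈ s ; labx = labz s ; labz = labx s
    ; V' = V'' s ; V'' = V' s ; disj = λ a b c d → disj s c d a b
    ; share = λ a b c d e f → share s c d a b f e
    ; n' = n'' s ; n'' = n' s ; nx = nz s ; nz = nx s
    ; Vinv = ⊎-swap ∘ Vinv s
    ; inv = λ n → Data.Sum.map ⊎-swap ⊎-swap (inv s n) }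
    where import Data.Sum

  record Glue {q r' x r'' z r} (s : Splice q r' x r'' z r) (C C' C'' : List Edge) : Set where
    field
      cases : ∀ {a k b} → (a , k , b) ∈ C →
        (((a , k , b) ∈ C' × a ≢ x × b ≢ x) ⊎ ((a , k , b) ∈ C'' × a ≢ z × b ≢ z)) ⊎
        (((a , k , x) ∈ C' × (z , k , b) ∈ C'') ⊎ ((a , k , z) ∈ C'' × (x , k , b) ∈ C'))
      uu : ∀ {a k b} → (a , k , b) ∈ C' → a ≢ x → b ≢ x → (a , k , b) ∈ C
      gg : ∀ {a k b} → (a , k , b) ∈ C'' → a ≢ z → b ≢ z → (a , k , b) ∈ C
      ug : ∀ {a k b} → (a , k , x) ∈ C' → (z , k , b) ∈ C'' → (a , k , b) ∈ C
      gu : ∀ {a k b} → (a , k , z) ∈ C'' → (x , k , b) ∈ C' → (a , k , b) ∈ C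
      in'out'' : ∀ {a k} → (a , k , x) ∈ C' → ∃[ b ] (z , k , b) ∈ C''
      out''in' : ∀ {b k} → (z , k , b) ∈ C'' → ∃[ a ] (a , k , x) ∈ C'
      in''out' : ∀ {a k} → (a , k , z) ∈ C'' → ∃[ b ] (x , k , b) ∈ C'
      out'in'' : ∀ {b k} → (x , k , b) ∈ C' → ∃[ a ] (a , k , z) ∈ C''
      sep : ∀ {a b a' b'} → (a , jmp , b) ∈ C' → (a' , jmp , b') ∈ C'' →
            ∃[ c ] ((x , jmp , c) ∈ C' ⊎ (c , jmp , x) ∈ C')
  open Glue public

  swapGlue : ∀ {q r' x r'' z r C C' C''} {s : Splice q r' x r'' z r} → Glue s C C' C'' → Glue (swapSplice s) C C'' C'
  swapGlue g = record
    { cases = λ h → Data.Sum.map ⊎-swap ⊎-swap (cases g h)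
    ; uu = gg g ; gg = uu g ; ug = gu g ; gu = ug g
    ; in'out'' = in''out' g ; out''in' = out'in'' g ; in''out' = in'out'' g ; out'in'' = out''in' g
    ; sep = λ h h' → case (sep g h' h) }
    where
    import Data.Sum
    case : _ → _
    case (c , inj₁ o) = let b , h = out'in'' g o in b , inj₂ h
    case (c , inj₂ o) = let b , h = in'out'' g o in b , inj₁ h

  module _ {q r' x r'' z r} {s : Splice q r' x r'' z r} {C C' C'' : List Edge}
           (g : Glue s C C' C'') (c' : Cyc r' C') (c'' : Cyc r'' C'') where

    private
      v' : ∀ {a k b} → (a , k , b) ∈ C' → V r' a × V r' b × a ≢ b
      v' {k = k} h = let p = Valid-V (ir' s) k (valid c' h) in proj₁ p , proj₂ p , Valid-≢ (ir' s) k (valid c' h)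
      v'' : ∀ {a k b} → (a , k , b) ∈ C'' → V r'' a × V r'' b × a ≢ b
      v'' {k = k} h = let p = Valid-V (ir'' s) k (valid c'' h) in proj₁ p , proj₂ p , Valid-≢ (ir'' s) k (valid c'' h)

    uu⁻ : ∀ {a k b} → V r' a → a ≢ x → V r' b → b ≢ x → (a , k , b) ∈ C → (a , k , b) ∈ C'
    uu⁻ va nax vb nbx h with cases g h
    ... | inj₁ (inj₁ (h' , _)) = h'
    ... | inj₁ (inj₂ (h' , na , _)) = ⊥-elim (disj s va nax (proj₁ (v'' h')) na)
    ... | inj₂ (inj₁ (_ , h')) = let _ , vb'' , ne = v'' h' in ⊥-elim (disj s vb nbx vb'' (ne ∘ sym))
    ... | inj₂ (inj₂ (h' , _)) = let va'' , _ , ne = v'' h' in ⊥-elim (disj s va nax va'' ne)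

    ug⁻ : ∀ {a k b} → V r' a → a ≢ x → V r'' b → b ≢ z → (a , k , b) ∈ C → (a , k , x) ∈ C' × (z , k , b) ∈ C''
    ug⁻ va nax vb nbz h with cases g h
    ... | inj₁ (inj₁ (h' , _ , nb)) = ⊥-elim (disj s (proj₁ (proj₂ (v' h'))) nb vb nbz)
    ... | inj₁ (inj₂ (h' , na , _)) = ⊥-elim (disj s va nax (proj₁ (v'' h')) na)
    ... | inj₂ (inj₁ h') = h'
    ... | inj₂ (inj₂ (h' , _)) = let va'' , _ , ne = v'' h' in ⊥-elim (disj s va nax va'' ne)

    outs : ∀ {a k b} → (a , k , b) ∈ C →
      (V r' a × a ≢ x × ∃[ β ] (a , k , β) ∈ C') ⊎ (V r'' a × a ≢ z × ∃[ β ] (a , k , β) ∈ C'')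
    outs h with cases g h
    ... | inj₁ (inj₁ (h' , na , _)) = inj₁ (proj₁ (v' h') , na , _ , h')
    ... | inj₁ (inj₂ (h' , na , _)) = inj₂ (proj₁ (v'' h') , na , _ , h')
    ... | inj₂ (inj₁ (h' , _)) = inj₁ (proj₁ (v' h') , proj₂ (proj₂ (v' h')) , _ , h')
    ... | inj₂ (inj₂ (h' , _)) = inj₂ (proj₁ (v'' h') , proj₂ (proj₂ (v'' h')) , _ , h')

    ins : ∀ {a k b} → (a , k , b) ∈ C →
      (V r' b × b ≢ x × ∃[ α ] (α , k , b) ∈ C') ⊎ (V r'' b × b ≢ z × ∃[ α ] (α , k , b) ∈ C'')
    ins h with cases g h
    ... | inj₁ (inj₁ (h' , _ , nb)) = inj₁ (proj₁ (proj₂ (v' h')) , nb , _ , h')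
    ... | inj₁ (inj₂ (h' , _ , nb)) = inj₂ (proj₁ (proj₂ (v'' h')) , nb , _ , h')
    ... | inj₂ (inj₁ (_ , h')) = inj₂ (proj₁ (proj₂ (v'' h')) , proj₂ (proj₂ (v'' h')) ∘ sym , _ , h')
    ... | inj₂ (inj₂ (_ , h')) = inj₁ (proj₁ (proj₂ (v' h')) , proj₂ (proj₂ (v' h')) ∘ sym , _ , h')

    private
      no-mixed : ∀ {a β a' β' i} → V r' a → a ≢ x → (a , jmp , β) ∈ C' →
              V r'' a' → a' ≢ z → (a' , jmp , β') ∈ C'' → lab a ≡ just i → lab a' ≡ just i → ⊥
      no-mixed va na h va' na' h' p p' with share s va na va' na' p p'
      ... | refl with sep g h h'
      ... | c , inj₁ o = na (one c' h o p (labx s))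
      ... | c , inj₂ o = let b , o' = in'out'' g o in na' (one c'' h' o' p' (labz s))

    glue-one : ∀ {a b a' b' i} → (a , jmp , b) ∈ C → (a' , jmp , b') ∈ C →
               lab a ≡ just i → lab a' ≡ just i → a ≡ a'
    glue-one h h' p p' with outs h | outs h'
    ... | inj₁ (_ , _ , _ , o) | inj₁ (_ , _ , _ , o') = one c' o o' p p'
    ... | inj₂ (_ , _ , _ , o) | inj₂ (_ , _ , _ , o') = one c'' o o' p p'
    ... | inj₁ (v , n , _ , o) | inj₂ (v₂ , n₂ , _ , o') = ⊥-elim (no-mixed v n o v₂ n₂ o' p p')
    ... | inj₂ (v , n , _ , o) | inj₁ (v₂ , n₂ , _ , o') = ⊥-elim (no-mixed v₂ n₂ o' v n o p' p)

    glue-alt : (∀ {a k b k' c i} → (a , k , b) ∈ C' → (b , k' , c) ∈ C' → lab b ≡ just i → Alt k k') →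
               (∀ {a k b k' c i} → (a , k , b) ∈ C'' → (b , k' , c) ∈ C'' → lab b ≡ just i → Alt k k') →
               ∀ {a k b k' c i} → (a , k , b) ∈ C → (b , k' , c) ∈ C → lab b ≡ just i → Alt k k'
    glue-alt a' a'' h h' p with ins h | outs h'
    ... | inj₁ (_ , _ , _ , o) | inj₁ (_ , _ , _ , o') = a' o o' p
    ... | inj₂ (_ , _ , _ , o) | inj₂ (_ , _ , _ , o') = a'' o o' p
    ... | inj₁ (v , n , _) | inj₂ (v₂ , n₂ , _) = ⊥-elim (disj s v n v₂ n₂)
    ... | inj₂ (v , n , _) | inj₁ (v₂ , n₂ , _) = ⊥-elim (disj s v₂ n₂ v n)

    us-uu : ∀ {a k b} → V r' a → a ≢ x → V r' b → b ≢ x → Us C a k b → Us C' a k b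
    us-uu va na vb nb (inj₁ h) = inj₁ (uu⁻ va na vb nb h)
    us-uu va na vb nb (inj₂ h) = inj₂ (uu⁻ vb nb va na h)

    us-uu⁺ : ∀ {a k b} → a ≢ x → b ≢ x → Us C' a k b → Us C a k b
    us-uu⁺ na nb (inj₁ h) = inj₁ (uu g h na nb)
    us-uu⁺ na nb (inj₂ h) = inj₂ (uu g h nb na)

  module _ {q r' x r'' z r} {s : Splice q r' x r'' z r} {C C' C'' : List Edge}
           (g : Glue s C C' C'') (c' : Cyc r' C') (c'' : Cyc r'' C'') where

    gu⁻ : ∀ {a k b} → V r'' a → a ≢ z → V r' b → b ≢ x → (a , k , b) ∈ C → (a , k , z) ∈ C'' × (x , k , b) ∈ C'
    gu⁻ = ug⁻ (swapGlue g) c'' c'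

    us-ug : ∀ {a b} → N r' a x → N r'' z b → Us C a (seg fwd) b → Us C' a (seg fwd) x
    us-ug n m (inj₁ h) = inj₁ (proj₁ (ug⁻ g c' c'' (V-src (ir' s) n) (irr (ir' s) n) (V-tgt (ir'' s) m) (irr (ir'' s) m ∘ sym) h))
    us-ug n m (inj₂ h) = inj₂ (proj₂ (gu⁻ (V-tgt (ir'' s) m) (irr (ir'' s) m ∘ sym) (V-src (ir' s) n) (irr (ir' s) n) h))

    us-ug⁺ : ∀ {a b} → N r' a x → N r'' z b → Us C' a (seg fwd) x → Us C a (seg fwd) b
    us-ug⁺ n m (inj₁ h) with in'out'' g h
    ... | b' , h' with func (ir'' s) (valid c'' h') m
    ... | refl = inj₁ (ug g h h')
    us-ug⁺ n m (inj₂ h) with out'in'' g h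
    ... | b' , h' with func (ir'' s) (valid c'' h') m
    ... | refl = inj₂ (gu g h' h)

    ju-ug : ∀ {a b} → Us C' a jmp x → Us C'' z jmp b → Us C a jmp b
    ju-ug (inj₁ h) (inj₁ h') = inj₁ (ug g h h')
    ju-ug (inj₂ h) (inj₂ h') = inj₂ (gu g h' h)
    ju-ug (inj₁ h) (inj₂ h') with in'out'' g h | valid c'' h'
    ... | _ , o | ne , _ , _ , i , p , p' = ⊥-elim (ne (sym (one c'' o h' p' p)))
    ju-ug (inj₂ h) (inj₁ h') with out'in'' g h
    ... | b , o with valid c'' o
    ... | ne , _ , _ , i , p , p' = ⊥-elim (ne (one c'' o h' p p'))

    glue-noback : ∀ {a d b} → (a , seg d , b) ∈ C → (b , seg (opp d) , a) ∈ C → ⊥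
    glue-noback {d = d} h k with cases g h
    ... | inj₁ (inj₁ (h' , na , nb)) =
      let va , vb = Valid-V (ir' s) (seg d) (valid c' h') in
      noback c' h' (uu⁻ g c' c'' vb nb va na k)
    ... | inj₁ (inj₂ (h' , na , nb)) =
      let va , vb = Valid-V (ir'' s) (seg d) (valid c'' h') in
      noback c'' h' (uu⁻ (swapGlue g) c'' c' vb nb va na k)
    ... | inj₂ (inj₁ (h' , h'')) =
      let va , _ = Valid-V (ir' s) (seg d) (valid c' h')
          _ , vb = Valid-V (ir'' s) (seg d) (valid c'' h'') in
      noback c' h' (proj₂ (gu⁻ vb (Valid-≢ (ir'' s) (seg d) (valid c'' h'') ∘ sym) va (Valid-≢ (ir' s) (seg d) (valid c' h')) k))
    ... | inj₂ (inj₂ (h'' , h')) =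
      let _ , vb = Valid-V (ir' s) (seg d) (valid c' h')
          va , _ = Valid-V (ir'' s) (seg d) (valid c'' h'') in
      noback c'' h'' (proj₂ (ug⁻ g c' c'' vb (Valid-≢ (ir' s) (seg d) (valid c' h') ∘ sym) va (Valid-≢ (ir'' s) (seg d) (valid c'' h'')) k))

  module _ {q r' x r'' z r} {s : Splice q r' x r'' z r} {C C' C'' D D' D'' : List Edge}
           (g : Glue s C C' C'') (c' : Cyc r' C') (c'' : Cyc r'' C'')
           (h : Glue s D D' D'') (d' : Cyc r' D') (d'' : Cyc r'' D'') where

    glue-ju : (∀ {a b} → (a , jmp , b) ∈ C' → Us D' a jmp b) → (∀ {a b} → (a , jmp , b) ∈ C'' → Us D'' a jmp b) →
              ∀ {a b} → (a , jmp , b) ∈ C → Us D a jmp b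
    glue-ju j' j'' m with cases g m
    ... | inj₁ (inj₁ (m' , na , nb)) = us-uu⁺ h d' d'' na nb (j' m')
    ... | inj₁ (inj₂ (m' , na , nb)) = us-uu⁺ (swapGlue h) d'' d' na nb (j'' m')
    ... | inj₂ (inj₁ (m' , m'')) = ju-ug h d' d'' (j' m') (j'' m'')
    ... | inj₂ (inj₂ (m'' , m')) = ju-ug (swapGlue h) d'' d' (j'' m'') (j' m')

  glue-pre : ∀ {q r' x r'' z r} {s : Splice q r' x r'' z r} {B B' B'' W W' W''} →
    Glue s B B' B'' → Cyc r' B' → Cyc r'' B'' → Glue s W W' W'' → Cyc r' W' → Cyc r'' W'' →
    Pre r' B' W' → Pre r'' B'' W'' → Pre r B W
  glue-pre {r = r} {s} {B} {B'} {B''} {W} {W'} {W''} g b' b'' h w' w'' p' p'' = record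
    { alt = glue-alt g b' b'' (alt p') (alt p'')
    ; xor = xr
    ; ju→ = glue-ju g b' b'' h w' w'' (ju→ p') (ju→ p'')
    ; ju← = glue-ju h w' w'' g b' b'' (ju← p') (ju← p'') }
    where
    xr : ∀ {a b} → N r a b → Xor (Us B a (seg fwd) b) (Us W a (seg fwd) b)
    xr n with inv s n
    ... | inj₁ (inj₁ (m , na , nb)) =
      let va = V-src (ir' s) m ; vb = V-tgt (ir' s) m in
      Xor-map (us-uu⁺ g b' b'' na nb) (us-uu g b' b'' va na vb nb) (us-uu⁺ h w' w'' na nb) (us-uu h w' w'' va na vb nb) (xor p' m)
    ... | inj₁ (inj₂ (m , na , nb)) =
      let va = V-src (ir'' s) m ; vb = V-tgt (ir'' s) m in
      Xor-map (us-uu⁺ (swapGlue g) b'' b' na nb) (us-uu (swapGlue g) b'' b' va na vb nb)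
              (us-uu⁺ (swapGlue h) w'' w' na nb) (us-uu (swapGlue h) w'' w' va na vb nb) (xor p'' m)
    ... | inj₂ (inj₁ (m , m')) =
      Xor-map (us-ug⁺ g b' b'' m m') (us-ug g b' b'' m m') (us-ug⁺ h w' w'' m m') (us-ug h w' w'' m m') (xor p' m)
    ... | inj₂ (inj₂ (m , m')) =
      Xor-map (us-ug⁺ (swapGlue g) b'' b' m m') (us-ug (swapGlue g) b'' b' m m')
              (us-ug⁺ (swapGlue h) w'' w' m m') (us-ug (swapGlue h) w'' w' m m') (xor p'' m)

  module _ {q r' x r'' z r} (s : Splice q r' x r'' z r) where

    splice-valid : ∀ {a} k {b} → Valid r' a k x → Valid r'' z k b → Valid r a k b
    splice-valid (seg fwd) v v' = nx s v v'
    splice-valid (seg bwd) v v' = nz s v' v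
    splice-valid jmp (ne , va , _ , i , p , p') (ne' , _ , vb , j , o , o') =
      (λ { refl → disj s va ne vb (ne' ∘ sym) }) , V' s va ne , V'' s vb (ne' ∘ sym) ,
      i , p , trans o' (trans (sym o) (trans (labz s) (trans (sym (labx s)) p')))

    keep-valid : ∀ {a} k {b} → Valid r' a k b → a ≢ x → b ≢ x → Valid r a k b
    keep-valid (seg fwd) v na nb = n' s v na nb
    keep-valid (seg bwd) v na nb = n' s v nb na
    keep-valid jmp (ne , va , vb , rest) na nb = ne , V' s va na , V' s vb nb , rest

    keep-path : ∀ {a C b} → Path r' a C b → (∀ {u k v} → (u , k , v) ∈ C → u ≢ x × v ≢ x) → Path r a C b
    keep-path [] f = []
    keep-path (_∷_ {k = k} v p) f =
      let na , nb = f (here refl) in keep-valid k v na nb ∷ keep-path p (f ∘ there)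

  module _ {r C x k l} (cy : Cyc r C) (o : Opening r C x k l) where
    open Opening o

    srcs-uniq : Unique (x ∷ e ∷ map src Q)
    srcs-uniq = unique-↭ (map⁺ src perm) (uniq cy)

    tgts-uniq : Unique (c ∷ x ∷ map tgt Q)
    tgts-uniq = unique-↭ (map⁺ tgt perm) (unique-↭ (↭-sym (tgt↭src cy)) (uniq cy))

    Q∌ : ∀ {u κ v} → (u , κ , v) ∈ Q → u ≢ x × v ≢ x
    Q∌ h = (λ { refl → unique-∉ srcs-uniq (there (∈-map⁺ src h)) }) ,
           (λ { refl → unique-∉ (unique-tail tgts-uniq) (∈-map⁺ tgt h) })

    Q⊆ : ∀ {t} → t ∈ Q → t ∈ C
    Q⊆ h = ∈-resp-↭ (↭-sym perm) (there (there h))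

    Q⊇ : ∀ {u κ v} → (u , κ , v) ∈ C → u ≢ x → v ≢ x → (u , κ , v) ∈ Q
    Q⊇ h nu nv with ∈-resp-↭ perm h
    ... | here refl = ⊥-elim (nu refl)
    ... | there (here refl) = ⊥-elim (nv refl)
    ... | there (there h') = h'

  module Join {q r' x r'' z r} (s : Splice q r' x r'' z r) {C' C'' k l}
              (c' : Cyc r' C') (o' : Opening r' C' x k l) (c'' : Cyc r'' C'') (o'' : Opening r'' C'' z l k) where
    private
      module O' = Opening o'
      module O'' = Opening o''

    joined : List Edge
    joined = ((O'.e , l , O''.c) ∷ O''.Q) ++ ((O''.e , k , O'.c) ∷ O'.Q)

    private
      vo' : Valid r' x k O'.c
      vo' = valid c' O'.out∈
      vi' : Valid r' O'.e l x
      vi' = valid c' O'.in∈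
      vo'' : Valid r'' z l O''.c
      vo'' = valid c'' O''.out∈
      vi'' : Valid r'' O''.e k z
      vi'' = valid c'' O''.in∈

    joined-path : Path r O'.e joined O'.e
    joined-path = path-++
      (splice-valid s l vi' vo'' ∷ keep-path (swapSplice s) O''.pth (Q∌ c'' o''))
      (splice-valid (swapSplice s) k vi'' vo' ∷ keep-path s O'.pth (Q∌ c' o'))

    private
      inU : ∀ {v} → v ∈ O'.e ∷ map src O'.Q → V r' v × v ≢ x
      inU (here refl) = proj₁ (Valid-V (ir' s) l vi') , Valid-≢ (ir' s) l vi'
      inU (there h) with ∈-map⁻ src h
      ... | (a , κ , b) , h' , refl =
        proj₁ (Valid-V (ir' s) κ (valid c' (Q⊆ c' o' h'))) , proj₁ (Q∌ c' o' h')
      inG : ∀ {v} → v ∈ O''.e ∷ map src O''.Q → V r'' v × v ≢ z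
      inG (here refl) = proj₁ (Valid-V (ir'' s) k vi'') , Valid-≢ (ir'' s) k vi''
      inG (there h) with ∈-map⁻ src h
      ... | (a , κ , b) , h' , refl =
        proj₁ (Valid-V (ir'' s) κ (valid c'' (Q⊆ c'' o'' h'))) , proj₁ (Q∌ c'' o'' h')

      reorder : (O'.e ∷ map src O'.Q) ++ (O''.e ∷ map src O''.Q) ↭ map src joined
      reorder = ↭trans (prep O'.e (++-comm (map src O'.Q) (O''.e ∷ map src O''.Q)))
        (↭trans (prep O'.e (↭-sym (shift O''.e (map src O''.Q) (map src O'.Q))))
          (↭-reflexive (sym (map-++ src ((O'.e , l , O''.c) ∷ O''.Q) ((O''.e , k , O'.c) ∷ O'.Q)))))

    joined-uniq : Unique (map src joined)
    joined-uniq = unique-↭ reorder (unique-++ (unique-tail (srcs-uniq c' o')) (unique-tail (srcs-uniq c'' o''))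
      λ h h' → let v , n = inU h ; v₂ , n₂ = inG h' in disj s v n v₂ n₂)

    private
      splitJ : ∀ {t} → t ∈ joined → (t ≡ (O'.e , l , O''.c) ⊎ t ∈ O''.Q) ⊎ (t ≡ (O''.e , k , O'.c) ⊎ t ∈ O'.Q)
      splitJ (here p) = inj₁ (inj₁ p)
      splitJ (there h) with ∈-++⁻ O''.Q h
      ... | inj₁ h' = inj₁ (inj₂ h')
      ... | inj₂ (here p) = inj₂ (inj₁ p)
      ... | inj₂ (there h') = inj₂ (inj₂ h')

      in-x : ∀ {a κ} → (a , κ , x) ∈ C' → a ≡ O'.e × κ ≡ l
      in-x h = tgt-uniq c' h O'.in∈
      in-z : ∀ {a κ} → (a , κ , z) ∈ C'' → a ≡ O''.e × κ ≡ k
      in-z h = tgt-uniq c'' h O''.in∈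
      out-x : ∀ {b κ} → (x , κ , b) ∈ C' → κ ≡ k × b ≡ O'.c
      out-x h = src-uniq c' h O'.out∈
      out-z : ∀ {b κ} → (z , κ , b) ∈ C'' → κ ≡ l × b ≡ O''.c
      out-z h = src-uniq c'' h O''.out∈

      joinA : (O'.e , l , O''.c) ∈ joined
      joinA = here refl
      joinB : (O''.e , k , O'.c) ∈ joined
      joinB = ∈-++⁺ʳ (_ ∷ O''.Q) (here refl)

    joined-glue : (∀ {a b a' b'} → (a , jmp , b) ∈ C' → (a' , jmp , b') ∈ C'' → k ≡ jmp ⊎ l ≡ jmp) →
                  Glue s joined C' C''
    joined-glue turn = record
      { cases = cs
      ; uu = λ h na nb → there (∈-++⁺ʳ O''.Q (there (Q⊇ c' o' h na nb)))
      ; gg = λ h na nb → there (∈-++⁺ˡ (Q⊇ c'' o'' h na nb))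
      ; ug = λ h h' → ugj (in-x h) (out-z h')
      ; gu = λ h h' → guj (in-z h) (out-x h')
      ; in'out'' = λ h → io (in-x h)
      ; out''in' = λ h → oi (out-z h)
      ; in''out' = λ h → io' (in-z h)
      ; out'in'' = λ h → oi' (out-x h)
      ; sep = λ h h' → tn (turn h h') }
      where
      cs : ∀ {a κ b} → (a , κ , b) ∈ joined → _
      cs h with splitJ h
      ... | inj₁ (inj₁ refl) = inj₂ (inj₁ (O'.in∈ , O''.out∈))
      ... | inj₁ (inj₂ h') = inj₁ (inj₂ (Q⊆ c'' o'' h' , Q∌ c'' o'' h'))
      ... | inj₂ (inj₁ refl) = inj₂ (inj₂ (O''.in∈ , O'.out∈))
      ... | inj₂ (inj₂ h') = inj₁ (inj₁ (Q⊆ c' o' h' , Q∌ c' o' h'))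
      ugj : ∀ {a κ b} → a ≡ O'.e × κ ≡ l → κ ≡ l × b ≡ O''.c → (a , κ , b) ∈ joined
      ugj (refl , refl) (_ , refl) = joinA
      guj : ∀ {a κ b} → a ≡ O''.e × κ ≡ k → κ ≡ k × b ≡ O'.c → (a , κ , b) ∈ joined
      guj (refl , refl) (_ , refl) = joinB
      io : ∀ {a κ} → a ≡ O'.e × κ ≡ l → ∃[ b ] (z , κ , b) ∈ C''
      io (_ , refl) = _ , O''.out∈
      oi : ∀ {b κ} → κ ≡ l × b ≡ O''.c → ∃[ a ] (a , κ , x) ∈ C'
      oi (refl , _) = _ , O'.in∈
      io' : ∀ {a κ} → a ≡ O''.e × κ ≡ k → ∃[ b ] (x , κ , b) ∈ C'
      io' (_ , refl) = _ , O'.out∈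
      oi' : ∀ {b κ} → κ ≡ k × b ≡ O'.c → ∃[ a ] (a , κ , z) ∈ C''
      oi' (refl , _) = _ , O''.in∈
      tn : k ≡ jmp ⊎ l ≡ jmp → ∃[ c ] ((x , jmp , c) ∈ C' ⊎ (c , jmp , x) ∈ C')
      tn (inj₁ p) = O'.c , inj₁ (subst (λ κ → (x , κ , O'.c) ∈ C') p O'.out∈)
      tn (inj₂ p) = O'.e , inj₂ (subst (λ κ → (O'.e , κ , x) ∈ C') p O'.in∈)

    joined-cyc : Glue s joined C' C'' → Cyc r joined
    joined-cyc g = record
      { base = O'.e ; path = joined-path ; uniq = joined-uniq
      ; one = glue-one g c' c'' ; noback = glue-noback g c' c'' }

  module _ {q r' x r'' z r} (s : Splice q r' x r'' z r) {C'} (c' : Cyc r' C')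
           (x∉ : ∀ {k c} → (x , k , c) ∈ C' → ⊥) where

    x∉tgt : ∀ {e l} → (e , l , x) ∈ C' → ⊥
    x∉tgt h = let _ , _ , h' = succ c' h in x∉ h'

    avoids : ∀ {u k v} → (u , k , v) ∈ C' → u ≢ x × v ≢ x
    avoids h = (λ { refl → x∉ h }) , (λ { refl → x∉tgt h })

    kept-glue : Glue s C' C' []
    kept-glue = record
      { cases = λ h → inj₁ (inj₁ (h , avoids h))
      ; uu = λ h _ _ → h ; gg = λ () ; ug = λ _ () ; gu = λ ()
      ; in'out'' = λ h → ⊥-elim (x∉tgt h) ; out''in' = λ () ; in''out' = λ ()
      ; out'in'' = λ h → ⊥-elim (x∉ h) ; sep = λ _ () }

    kept-cyc : Cyc r C'
    kept-cyc = record
      { base = base c' ; path = keep-path s (path c') avoids ; uniq = uniq c'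
      ; one = one c' ; noback = noback c' }

  xorK : ∀ {r B W} → Pre r B W → ∀ d {a b} → Valid r a (seg d) b → Xor (Us B a (seg d) b) (Us W a (seg d) b)
  xorK p fwd v = xor p v
  xorK p bwd v = Xor-map ⊎-swap ⊎-swap ⊎-swap ⊎-swap (xor p v)

  Xor-¬ : ∀ {P Q : Set} → Xor P Q → ¬ P → Q
  Xor-¬ (inj₁ (p , _)) n = ⊥-elim (n p)
  Xor-¬ (inj₂ (_ , q)) n = q

  White : (r : Ring) → List Edge → E → Kind → Kind → Set
  White r B x k l = ∃[ W ] (Cyc r W × Pre r B W × Opening r W x k l)

  Thru : Ring → E → Turn → Set
  Thru r x t = Σ (Dicycle r) λ d → Opening r (black d) x (tOut t) (tIn t)

  module _ {r : Ring} (ir : IsRing r) {x : E} {i : K} (lx : lab x ≡ just i) (vx : V r x) where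

    whiteAt : ∀ t ((d , o) : Thru r x t) → White r (black d) x (wOut t) (wIn t)
    whiteAt (out s) (d , o) with nbr ir (opp s) vx
    ... | p , v = go (Xor-¬ (xorK (pre d) (opp s) v) free)
      where
      open Opening o
      free : ¬ Us (black d) x (seg (opp s)) p
      free (inj₁ h) = opp-≢ (proj₁ (src-uniq (cb d) h out∈))
      free (inj₂ h) = alt (pre d) h out∈ lx
      fin : ∀ {W} → Cyc r W → Pre r (black d) W → (x , seg (opp s) , p) ∈ W → White r (black d) x (seg (opp s)) jmp
      fin {W} cy pr h with ju→ pr in∈
      ... | inj₁ h' = W , cy , pr , open-at ir cy h h'
      ... | inj₂ h' with proj₁ (src-uniq cy h h')
      ... | ()
      go : Us (Dicycle.white d) x (seg (opp s)) p → White r (black d) x (seg (opp s)) jmp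
      go (inj₁ h) = fin (cw d) (pre d) h
      go (inj₂ h) = fin (revCyc (cw d)) (preRevW (pre d)) (subst (λ κ → (x , κ , p) ∈ rev (Dicycle.white d)) (rv-rv (seg (opp s))) (rev-∈ h))
    whiteAt (inn s) (d , o) with nbr ir s vx
    ... | p , v = go (Xor-¬ (xorK (pre d) s v) free)
      where
      open Opening o
      free : ¬ Us (black d) x (seg s) p
      free (inj₁ h) with proj₁ (src-uniq (cb d) h out∈)
      ... | ()
      free (inj₂ h) = opp-≢ (proj₂ (tgt-uniq (cb d) h in∈))
      fin : ∀ {W} → Cyc r W → Pre r (black d) W → (p , seg (opp s) , x) ∈ W → White r (black d) x jmp (seg (opp s))
      fin {W} cy pr h with ju→ pr out∈
      ... | inj₁ h' = W , cy , pr , open-at ir cy h' h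
      ... | inj₂ h' with proj₂ (tgt-uniq cy h h')
      ... | ()
      go : Us (Dicycle.white d) x (seg s) p → White r (black d) x jmp (seg (opp s))
      go (inj₁ h) = fin (revCyc (cw d)) (preRevW (pre d)) (rev-∈ h)
      go (inj₂ h) = fin (cw d) (pre d) h

    white-straight : (d : Dicycle r) → (∀ {k c} → (x , k , c) ∈ black d → ⊥) → White r (black d) x (seg fwd) (seg fwd)
    white-straight d x∉ with nxt ir vx | prv ir vx
    ... | n , vn | p , vp = go (Xor-¬ (xor (pre d) vn) free)
      where
      free : ¬ Us (black d) x (seg fwd) n
      free (inj₁ h) = x∉ h
      free (inj₂ h) = let _ , _ , h' = succ (cb d) h in x∉ h'
      free' : ¬ Us (black d) p (seg fwd) x
      free' (inj₁ h) = let _ , _ , h' = succ (cb d) h in x∉ h'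
      free' (inj₂ h) = x∉ h
      fin : ∀ {W} → Cyc r W → Pre r (black d) W → (x , seg fwd , n) ∈ W → White r (black d) x (seg fwd) (seg fwd)
      fin {W} cy pr h with Xor-¬ (xor pr vp) free'
      ... | inj₁ h' = W , cy , pr , open-at ir cy h h'
      ... | inj₂ h' with proj₁ (src-uniq cy h h')
      ... | ()
      go : Us (Dicycle.white d) x (seg fwd) n → White r (black d) x (seg fwd) (seg fwd)
      go (inj₁ h) = fin (cw d) (pre d) h
      go (inj₂ h) = fin (revCyc (cw d)) (preRevW (pre d)) (rev-∈ h)

  Avoids : ∀ {r} → E → Dicycle r → Set
  Avoids v d = ∀ {k c} → (v , k , c) ∈ black d → ⊥

  bar : Turn → Turn
  bar (out d) = inn d
  bar (inn d) = out d

  module _ {q r' x r'' z r} (s : Splice q r' x r'' z r) where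

    open-z : ∀ {C} t → Opening r'' C z (tOut (bar t)) (tIn (bar t)) → Opening r'' C z (tIn t) (tOut t)
    open-z (out d) o = o
    open-z (inn d) o = o

    open-zw : ∀ {C} t → Opening r'' C z (wOut (bar t)) (wIn (bar t)) → Opening r'' C z (wIn t) (wOut t)
    open-zw (out d) o = o
    open-zw (inn d) o = o

    module JoinD (t : Turn) (th' : Thru r' x t) (th'' : Thru r'' z (bar t)) where
      d' = proj₁ th'
      d'' = proj₁ th''
      w' = whiteAt (ir' s) (labx s) (x∈ s) t th'
      w'' = whiteAt (ir'' s) (labz s) (z∈ s) (bar t) th''
      module BJ = Join s (cb d') (proj₂ th') (cb d'') (open-z t (proj₂ th''))
      module WJ = Join s (proj₁ (proj₂ w')) (proj₂ (proj₂ (proj₂ w')))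
                         (proj₁ (proj₂ w'')) (open-zw t (proj₂ (proj₂ (proj₂ w''))))

      turnB : tOut t ≡ jmp ⊎ tIn t ≡ jmp
      turnB = go t
        where
        go : ∀ t → tOut t ≡ jmp ⊎ tIn t ≡ jmp
        go (out d) = inj₂ refl
        go (inn d) = inj₁ refl

      turnW : wOut t ≡ jmp ⊎ wIn t ≡ jmp
      turnW = go t
        where
        go : ∀ t → wOut t ≡ jmp ⊎ wIn t ≡ jmp
        go (out d) = inj₂ refl
        go (inn d) = inj₁ refl

      glueB : Glue s BJ.joined (black d') (black d'')
      glueB = BJ.joined-glue (λ _ _ → turnB)

      glueW = WJ.joined-glue (λ _ _ → turnW)

      joinD : Dicycle r
      joinD = record
        { black = BJ.joined ; white = WJ.joined
        ; cb = BJ.joined-cyc glueB ; cw = WJ.joined-cyc glueW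
        ; pre = glue-pre glueB (cb d') (cb d'') glueW (proj₁ (proj₂ w')) (proj₁ (proj₂ w''))
                  (proj₁ (proj₂ (proj₂ w'))) (proj₁ (proj₂ (proj₂ w'')))
        ; jump = jm turnB }
        where
        open Opening (proj₂ th') using (c; e)
        open Opening (open-z t (proj₂ th'')) using () renaming (c to c₂; e to e₂; Q to Q₂)
        jm : tOut t ≡ jmp ⊎ tIn t ≡ jmp → ∃[ a ] ∃[ b ] (a , jmp , b) ∈ BJ.joined
        jm (inj₁ p) = e₂ , c , subst (λ κ → (e₂ , κ , c) ∈ BJ.joined) p (there (∈-++⁺ʳ Q₂ (here refl)))
        jm (inj₂ p) = e , c₂ , subst (λ κ → (e , κ , c₂) ∈ BJ.joined) p (here refl)

    pre-circle : Pre r'' [] (circle (ir'' s))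
    pre-circle = record
      { alt = λ () ; xor = λ n → inj₂ ((λ { (inj₁ ()) ; (inj₂ ()) }) , inj₁ (circ∈ (ir'' s) n))
      ; ju→ = λ () ; ju← = λ h → ⊥-elim (nojmp (circ-fwd (ir'' s) h)) }
      where
      nojmp : jmp ≢ seg fwd
      nojmp ()

    circle-open : Opening r'' (circle (ir'' s)) z (seg fwd) (seg fwd)
    circle-open = let _ , n = nxt (ir'' s) (z∈ s) ; _ , p = prv (ir'' s) (z∈ s) in
      open-at (ir'' s) (circ (ir'' s)) (circ∈ (ir'' s) n) (circ∈ (ir'' s) p)

    liftD : (d : Dicycle r') → Avoids x d → Dicycle r
    liftD d x∉ = record
      { black = black d ; white = WJ.joined
      ; cb = kept-cyc s (cb d) x∉ ; cw = WJ.joined-cyc glueW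
      ; pre = glue-pre (kept-glue s (cb d) x∉) (cb d) (emptyCyc z) glueW (proj₁ (proj₂ w)) (circ (ir'' s))
                (proj₁ (proj₂ (proj₂ w))) pre-circle
      ; jump = jump d }
      where
      w = white-straight (ir' s) (labx s) (x∈ s) d x∉
      module WJ = Join s (proj₁ (proj₂ w)) (proj₂ (proj₂ (proj₂ w))) (circ (ir'' s)) circle-open
      glueW = WJ.joined-glue (λ _ h → ⊥-elim (nojmp (circ-fwd (ir'' s) h)))
        where
        nojmp : jmp ≢ seg fwd
        nojmp ()

    invK : ∀ d {a b} → Valid r a (seg d) b →
      ((Valid r' a (seg d) b × a ≢ x × b ≢ x) ⊎ (Valid r'' a (seg d) b × a ≢ z × b ≢ z)) ⊎
      ((Valid r' a (seg d) x × Valid r'' z (seg d) b) ⊎ (Valid r'' a (seg d) z × Valid r' x (seg d) b))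
    invK fwd v = inv s v
    invK bwd v with inv s v
    ... | inj₁ (inj₁ (m , p , q)) = inj₁ (inj₁ (m , q , p))
    ... | inj₁ (inj₂ (m , p , q)) = inj₁ (inj₂ (m , q , p))
    ... | inj₂ (inj₁ (m , m')) = inj₂ (inj₂ (m' , m))
    ... | inj₂ (inj₂ (m , m')) = inj₂ (inj₁ (m' , m))

  Hits : ∀ {r} → E → Kind → E → Dicycle r → Set
  Hits a k b d = (a , k , b) ∈ black d

  record Joint {q r' x r'' z r} (s : Splice q r' x r'' z r) : Set where
    field
      J   : Dicycle r
      d'  : Dicycle r'
      d'' : Dicycle r''
      gl  : Glue s (black J) (black d') (black d'')
  open Joint public

  swapJoint : ∀ {q r' x r'' z r} {s : Splice q r' x r'' z r} → Joint s → Joint (swapSplice s)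
  swapJoint j = record { J = J j ; d' = d'' j ; d'' = d' j ; gl = swapGlue (gl j) }

  SameBlack : ∀ r r' → Dicycle r → Dicycle r' → Set
  SameBlack r r' d d' = black d ≡ black d'

  module HalfCover {q r' x r'' z r} (s : Splice q r' x r'' z r) (js : List (Joint s))
    {R' : List (Dicycle r')} {R'' : List (Dicycle r'')} {K' K'' : List (Dicycle r)}
    (a' : All (Avoids x) R') (a'' : All (Avoids z) R'')
    (k' : Pointwise (SameBlack r' r) R' K') (k'' : Pointwise (SameBlack r'' r) R'' K'') where

    private
      none'' : ∀ {a k b} → V r' a × a ≢ x → All (¬_ ∘ Hits a k b) K''
      none'' {a} {k} {b} (va , na) = go a'' k''
        where
        go : ∀ {R K} → All (Avoids z) R → Pointwise (SameBlack r'' r) R K → All (¬_ ∘ Hits a k b) K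
        go [] [] = []
        go (_∷_ {d} v vs) (refl ∷ es) =
          (λ h → disj s va na (proj₁ (Valid-V (ir'' s) k (valid (cb d) h))) (proj₁ (avoids (swapSplice s) (cb d) v h)))
          ∷ go vs es

      pw : ∀ {a k b a₂ k₂ b₂} → (∀ j → (Hits a k b (d' j) → Hits a₂ k₂ b₂ (J j)) × (Hits a₂ k₂ b₂ (J j) → Hits a k b (d' j))) →
        (∀ {d} → Avoids x d → (Hits a k b d → (a₂ , k₂ , b₂) ∈ black d) × ((a₂ , k₂ , b₂) ∈ black d → Hits a k b d)) →
        Pointwise (λ c d → (Hits a k b c → Hits a₂ k₂ b₂ d) × (Hits a₂ k₂ b₂ d → Hits a k b c)) (map d' js ++ R') (map J js ++ K')
      pw {a} {k} {b} {a₂} {k₂} {b₂} f g = goJ js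
        where
        goK : ∀ {R K} → All (Avoids x) R → Pointwise (SameBlack r' r) R K →
          Pointwise (λ c d → (Hits a k b c → Hits a₂ k₂ b₂ d) × (Hits a₂ k₂ b₂ d → Hits a k b c)) R K
        goK [] [] = []
        goK (_∷_ {d} v vs) (_∷_ {y = d₂} e es) = conv d₂ e ∷ goK vs es
          where
          conv : ∀ d₂ → SameBlack r' r d d₂ → (Hits a k b d → Hits a₂ k₂ b₂ d₂) × (Hits a₂ k₂ b₂ d₂ → Hits a k b d)
          conv d₂ e = (λ h → subst ((a₂ , k₂ , b₂) ∈_) e (proj₁ (g {d} v) h)) ,
                      (λ h → proj₂ (g {d} v) (subst ((a₂ , k₂ , b₂) ∈_) (sym e) h))
        goJ : ∀ js → Pointwise _ (map d' js ++ R') (map J js ++ K')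
        goJ [] = goK a' k'
        goJ (j ∷ js) = f j ∷ goJ js

      finish : ∀ {a k b} → V r' a × a ≢ x → ExOne (Hits a k b) (map J js ++ K') → ExOne (Hits a k b) (map J js ++ K' ++ K'')
      finish {a} {k} {b} va e = subst (ExOne (Hits a k b)) (++-assoc (map J js) K' K'') (ExOne-++ˡ e (none'' va))

    cover-uu : ∀ {a d b} → Valid r' a (seg d) b → a ≢ x → b ≢ x →
      ExOne (Hits a (seg d) b) (map d' js ++ R') → ExOne (Hits a (seg d) b) (map J js ++ K' ++ K'')
    cover-uu {a} {d} {b} v na nb e = let va , vb = Valid-V (ir' s) (seg d) v in
      finish (va , na) (ExOne-cong (pw
        (λ j → (λ h → uu (gl j) h na nb) , uu⁻ (gl j) (cb (d' j)) (cb (d'' j)) va na vb nb)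
        (λ _ → id , id)) e)

    cover-ug : ∀ {a d b} → Valid r' a (seg d) x → Valid r'' z (seg d) b →
      ExOne (Hits a (seg d) x) (map d' js ++ R') → ExOne (Hits a (seg d) b) (map J js ++ K' ++ K'')
    cover-ug {a} {d} {b} v v₂ e =
      let va , _ = Valid-V (ir' s) (seg d) v ; na = Valid-≢ (ir' s) (seg d) v
          _ , vb = Valid-V (ir'' s) (seg d) v₂ ; nb = Valid-≢ (ir'' s) (seg d) v₂ ∘ sym in
      finish (va , na) (ExOne-cong (pw
        (λ j → (λ h → into j h (in'out'' (gl j) h)) ,
               (λ h → proj₁ (ug⁻ (gl j) (cb (d' j)) (cb (d'' j)) va na vb nb h)))
        (λ {δ} av → (λ h → ⊥-elim (x∉tgt s (cb δ) av h)) ,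
              (λ h → ⊥-elim (disj s (proj₂ (Valid-V (ir' s) (seg d) (valid (cb δ) h))) (proj₂ (avoids s (cb δ) av h)) vb nb)))) e)
      where
      into : ∀ j → (a , seg d , x) ∈ black (d' j) → ∃[ b' ] (z , seg d , b') ∈ black (d'' j) → (a , seg d , b) ∈ black (J j)
      into j h (b' , h') with Valid-func (ir'' s) d (valid (cb (d'' j)) h') v₂
      ... | refl = ug (gl j) h h'

  w₁ : (E → Bool) → Edge → ℕ
  w₁ A (a , seg _ , b) = 0
  w₁ A (a , jmp , b) = A a ⊸ A b

  wt : (E → Bool) → List Edge → ℕ
  wt A [] = 0
  wt A (e ∷ C) = w₁ A e + wt A C

  tot : ∀ {r} → (E → Bool) → List (Dicycle r) → ℕ
  tot A [] = 0
  tot A (d ∷ F) = wt A (black d) + tot A F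

  wt-++ : ∀ A C {D} → wt A (C ++ D) ≡ wt A C + wt A D
  wt-++ A [] = refl
  wt-++ A (e ∷ C) {D} rewrite wt-++ A C {D} = sym (+-assoc (w₁ A e) (wt A C) (wt A D))

  tot-++ : ∀ {r} A (F : List (Dicycle r)) {G} → tot A (F ++ G) ≡ tot A F + tot A G
  tot-++ A [] = refl
  tot-++ A (e ∷ C) {D} rewrite tot-++ A C {D} = sym (+-assoc (wt A (black e)) (tot A C) (tot A D))

  wt-↭ : ∀ A {C D} → C ↭ D → wt A C ≡ wt A D
  wt-↭ A ↭refl = refl
  wt-↭ A (prep x p) = cong (w₁ A x +_) (wt-↭ A p)
  wt-↭ A (swap {xs} {ys} x y p) rewrite wt-↭ A p = lem (w₁ A x) (w₁ A y) (wt A ys)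
    where
    lem : ∀ a b c → a + (b + c) ≡ b + (a + c)
    lem = solve-∀
  wt-↭ A (↭trans p q) = trans (wt-↭ A p) (wt-↭ A q)

  tot-↭ : ∀ {r} A {F G : List (Dicycle r)} → F ↭ G → tot A F ≡ tot A G
  tot-↭ A ↭refl = refl
  tot-↭ A (prep x p) = cong (wt A (black x) +_) (tot-↭ A p)
  tot-↭ A (swap {xs} {ys} x y p) rewrite tot-↭ A p = lem (wt A (black x)) (wt A (black y)) (tot A ys)
    where
    lem : ∀ a b c → a + (b + c) ≡ b + (a + c)
    lem = solve-∀
  tot-↭ A (↭trans p q) = trans (tot-↭ A p) (tot-↭ A q)

  wt-cong : ∀ {A B} C → (∀ {a k b} → (a , k , b) ∈ C → A a ≡ B a × A b ≡ B b) → wt A C ≡ wt B C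
  wt-cong [] f = refl
  wt-cong ((a , seg _ , b) ∷ C) f = wt-cong C (f ∘ there)
  wt-cong ((a , jmp , b) ∷ C) f = cong₂ _+_ (cong₂ _⊸_ (proj₁ (f (here refl))) (proj₂ (f (here refl)))) (wt-cong C (f ∘ there))

  -- The field cut makes every nontrivial partition of the attachments of a bridge be crossed twice in each direction;
  -- for the partition induced by an edge of the tree this gives its four dicycles.
  record Fam (r : Ring) : Set where
    field
      F     : List (Dicycle r)
      cover : ∀ d {a b} → Valid r a (seg d) b → ExOne (λ c → (a , seg d , b) ∈ black c) F
      cut   : ∀ A i → (∀ {a} → A a ≡ true → lab a ≡ just i) → ∀ {a b} → V r a → V r b →
              lab a ≡ just i → lab b ≡ just i → A a ≡ true → A b ≡ false → 2 ≤ tot A F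
  open Fam public

  record Four (r : Ring) (x : E) (F : List (Dicycle r)) : Set where
    field
      th   : ∀ t → Thru r x t
      R    : List (Dicycle r)
      perm : F ↭ map (proj₁ ∘ th) turns ++ R
      av   : All (Avoids x) R

  module _ {r : Ring} (ir : IsRing r) {x : E} {i : K} (lx : lab x ≡ just i) (vx : V r x) where

    private
      Hit : Turn → Dicycle r → Set
      Hit (out d) c = (x , seg d , proj₁ (nbr ir d vx)) ∈ black c
      Hit (inn d) c = (proj₁ (nbr ir (opp d) vx) , seg d , x) ∈ black c

      opening : ∀ t {c} → Hit t c → Opening r (black c) x (tOut t) (tIn t)
      opening (out d) {c} h with pred (cb c) h
      ... | e , jmp , h' = open-at ir (cb c) h h'
      ... | e , seg d' , h' = ⊥-elim (alt (pre c) h' h lx)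
      opening (inn d) {c} h with succ (cb c) h
      ... | jmp , e , h' = open-at ir (cb c) h' h
      ... | seg d' , e , h' = ⊥-elim (alt (pre c) h h' lx)

      excl : ∀ {t t' c} → Hit t c → Hit t' c → t ≡ t'
      excl {t} {t'} {c} h h' =
        let o = opening t {c} h ; o' = opening t' {c} h' in
        turn-inj t t' (proj₁ (src-uniq (cb c) (Opening.out∈ o) (Opening.out∈ o')))
                      (proj₂ (tgt-uniq (cb c) (Opening.in∈ o) (Opening.in∈ o')))

      avoid : ∀ {c} → (∀ t → ¬ Hit t c) → Avoids x c
      avoid {c} n {seg d} h with Valid-func ir d (valid (cb c) h) (proj₂ (nbr ir d vx))
      ... | refl = n (out d) h
      avoid {c} n {jmp} h with pred (cb c) h
      ... | e , jmp , h' = ⊥-elim (alt (pre c) h' h lx)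
      ... | e , seg d , h' with Valid-inj ir d (valid (cb c) h') (prevV d)
        where
        prevV : ∀ d → Valid r (proj₁ (nbr ir (opp d) vx)) (seg d) x
        prevV fwd = proj₂ (nbr ir bwd vx)
        prevV bwd = proj₂ (nbr ir fwd vx)
      ... | refl = n (inn d) h'

      extract : ∀ ts → Unique ts → (F : List (Dicycle r)) → (∀ {t} → t ∈ ts → ExOne (Hit t) F) →
        Σ (All (λ t → Σ (Dicycle r) (Hit t)) ts) λ ds → ∃[ R ]
          (F ↭ All.reduce proj₁ ds ++ R × (∀ {t} → t ∈ ts → All (¬_ ∘ Hit t) R))
      extract [] _ F _ = [] , F , ↭refl , λ ()
      extract (t ∷ ts) (n ∷ u) F ex with ExOne-split (ex (here refl))
      ... | d , R₁ , p , h , none with extract ts u R₁ (λ t'∈ → ExOne-tail (ExOne-↭ p (ex (there t'∈)))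
                                        λ h' → All.lookup n t'∈ (excl {c = d} h h'))
      ... | ds , R , q , none' = (d , h) ∷ ds , R , ↭trans p (prep d q) , nn
        where
        nn : ∀ {t'} → t' ∈ t ∷ ts → All (¬_ ∘ Hit t') R
        nn (here refl) = AllP.++⁻ʳ (All.reduce proj₁ ds) (All-resp-↭ q none)
          where import Data.List.Relation.Unary.All.Properties as AllP
        nn (there t'∈) = none' t'∈

    private
      turn∈ : ∀ t → t ∈ turns
      turn∈ (out fwd) = here refl
      turn∈ (out bwd) = there (here refl)
      turn∈ (inn fwd) = there (there (here refl))
      turn∈ (inn bwd) = there (there (there (here refl)))

      build : ∀ {F} → (Σ (All (λ t → Σ (Dicycle r) (Hit t)) turns) λ ds → ∃[ R ]
                (F ↭ All.reduce proj₁ ds ++ R × (∀ {t} → t ∈ turns → All (¬_ ∘ Hit t) R))) → Four r x F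
      build ((d₁ , h₁) ∷ (d₂ , h₂) ∷ (d₃ , h₃) ∷ (d₄ , h₄) ∷ [] , R , p , none) = record
        { th = λ { (out fwd) → d₁ , opening (out fwd) {d₁} h₁
                 ; (out bwd) → d₂ , opening (out bwd) {d₂} h₂
                 ; (inn fwd) → d₃ , opening (inn fwd) {d₃} h₃
                 ; (inn bwd) → d₄ , opening (inn bwd) {d₄} h₄ }
        ; R = R ; perm = p
        ; av = All.tabulate λ {c} c∈ → avoid {c} (λ t → All.lookup (none (turn∈ t)) c∈) }

    four : (fam : Fam r) → Four r x (F fam)
    four fam = build (extract turns turns-unique (F fam) (λ {t} _ → cov t))
      where
      cov : ∀ t → ExOne (Hit t) (F fam)
      cov (out d) = cover fam d (proj₂ (nbr ir d vx))
      cov (inn fwd) = cover fam fwd (proj₂ (nbr ir bwd vx))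
      cov (inn bwd) = cover fam bwd (proj₂ (nbr ir fwd vx))

  -- Prescribing the value of A at x turns the cut bound of the family into bounds for its part away from x.
  module HalfCut (_≟_ : DecidableEquality E) {r x i} (ir : IsRing r) (lx : lab x ≡ just i) (vx : V r x)
                 (fam : Fam r) (fo : Four r x (F fam)) (A : E → Bool) where
    open Four fo hiding (perm)
    open Opening

    ends : ∀ t → Opening r (black (proj₁ (th t))) x (tOut t) (tIn t)
    ends t = proj₂ (th t)

    rest : Turn → ℕ
    rest t = wt A (Q (ends t))

    sumQ : ℕ
    sumQ = tot A R + (rest (out fwd) + rest (out bwd) + (rest (inn fwd) + rest (inn bwd)))

    pin pout : Dir → Bool
    pin d = A (e (ends (out d)))
    pout d = A (c (ends (inn d)))

    private
      ov : Bool → E → Bool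
      ov β a with a ≟ x
      ... | yes _ = β
      ... | no _ = A a

      ov-x : ∀ β → ov β x ≡ β
      ov-x β with x ≟ x
      ... | yes _ = refl
      ... | no n = ⊥-elim (n refl)

      ov-≢ : ∀ β {a} → a ≢ x → ov β a ≡ A a
      ov-≢ β {a} n with a ≟ x
      ... | yes p = ⊥-elim (n p)
      ... | no _ = refl

      ovQ : ∀ β t → wt (ov β) (Q (ends t)) ≡ rest t
      ovQ β t = wt-cong (Q (ends t)) λ h → let n , n' = Q∌ (cb (proj₁ (th t))) (ends t) h in ov-≢ β n , ov-≢ β n'

      ovR : ∀ β → tot (ov β) R ≡ tot A R
      ovR β = go R av
        where
        go : ∀ R → All (Avoids x) R → tot (ov β) R ≡ tot A R
        go [] [] = refl
        go (d ∷ R) (v ∷ vs) = cong₂ _+_ (wt-cong (black d) λ h →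
            ov-≢ β (λ { refl → v h }) , ov-≢ β (λ { refl → let _ , _ , h' = succ (cb d) h in v h' })) (go R vs)

      e≢x : ∀ t → e (ends t) ≢ x
      e≢x t = Valid-≢ ir (tIn t) (valid (cb (proj₁ (th t))) (in∈ (ends t)))
      c≢x : ∀ t → c (ends t) ≢ x
      c≢x t p = Valid-≢ ir (tOut t) (valid (cb (proj₁ (th t))) (out∈ (ends t))) (sym p)

      ov-out : ∀ β d → wt (ov β) (black (proj₁ (th (out d)))) ≡ (pin d ⊸ β) + rest (out d)
      ov-out β d = trans (wt-↭ (ov β) (perm (ends (out d))))
        (cong₂ _+_ (cong₂ _⊸_ (ov-≢ β (e≢x (out d))) (ov-x β)) (ovQ β (out d)))

      ov-inn : ∀ β d → wt (ov β) (black (proj₁ (th (inn d)))) ≡ (β ⊸ pout d) + rest (inn d)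
      ov-inn β d = trans (wt-↭ (ov β) (perm (ends (inn d))))
        (cong₂ _+_ (cong₂ _⊸_ (ov-x β) (ov-≢ β (c≢x (inn d)))) (ovQ β (inn d)))

      ov-tot : ∀ β → tot (ov β) (F fam) ≡ sumQ + ((pin fwd ⊸ β) + (pin bwd ⊸ β) + ((β ⊸ pout fwd) + (β ⊸ pout bwd)))
      ov-tot β = trans (tot-↭ (ov β) (Four.perm fo))
        (trans (cong₂ _+_ (ov-out β fwd) (cong₂ _+_ (ov-out β bwd) (cong₂ _+_ (ov-inn β fwd) (cong₂ _+_ (ov-inn β bwd) (ovR β)))))
          (lem (pin fwd ⊸ β) (pin bwd ⊸ β) (β ⊸ pout fwd) (β ⊸ pout bwd)
               (rest (out fwd)) (rest (out bwd)) (rest (inn fwd)) (rest (inn bwd)) (tot A R)))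
        where
        lem : ∀ p₁ p₂ o₁ o₂ q₁ q₂ q₃ q₄ t →
          p₁ + q₁ + (p₂ + q₂ + (o₁ + q₃ + (o₂ + q₄ + t))) ≡ t + (q₁ + q₂ + (q₃ + q₄)) + (p₁ + p₂ + (o₁ + o₂))
        lem = solve-∀

    module _ (supp : ∀ {a} → A a ≡ true → lab a ≡ just i) where
      private
        ov-supp : ∀ β {a} → ov β a ≡ true → lab a ≡ just i
        ov-supp β {a} p with a ≟ x
        ... | yes refl = lx
        ... | no _ = supp p

      boundT : ∃[ u ] (V r u × u ≢ x × lab u ≡ just i × A u ≡ true) → 2 ≤ sumQ + (b2n (pin fwd) + b2n (pin bwd))
      boundT (u , vu , nu , lu , au) = subst (2 ≤_) eq
        (cut fam (ov false) i (ov-supp false) vu vx lu lx (trans (ov-≢ false nu) au) (ov-x false))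
        where
        eq : tot (ov false) (F fam) ≡ sumQ + (b2n (pin fwd) + b2n (pin bwd))
        eq = trans (ov-tot false) (cong (sumQ +_) (trans (+-identityʳ _) (cong₂ _+_ (⊸-false (pin fwd)) (⊸-false (pin bwd)))))

      boundF : ∃[ u ] (V r u × u ≢ x × lab u ≡ just i × A u ≡ false) → 2 ≤ sumQ + (b2n (not (pout fwd)) + b2n (not (pout bwd)))
      boundF (u , vu , nu , lu , au) = subst (2 ≤_) eq
        (cut fam (ov true) i (ov-supp true) vx vu lx lu (ov-x true) (trans (ov-≢ true nu) au))
        where
        eq : tot (ov true) (F fam) ≡ sumQ + (b2n (not (pout fwd)) + b2n (not (pout bwd)))
        eq = trans (ov-tot true) (cong (sumQ +_) (cong₂ _+_ (cong₂ _+_ (⊸-true (pin fwd)) (⊸-true (pin bwd)))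
                                                            (cong₂ _+_ (true-⊸ (pout fwd)) (true-⊸ (pout bwd)))))

      private
        vl-in : ∀ d → V r (e (ends (out d))) × lab (e (ends (out d))) ≡ just i
        vl-in d with valid (cb (proj₁ (th (out d)))) (in∈ (ends (out d)))
        ... | _ , v , _ , _ , p , p' = v , trans p (trans (sym p') lx)
        vl-out : ∀ d → V r (c (ends (inn d))) × lab (c (ends (inn d))) ≡ just i
        vl-out d with valid (cb (proj₁ (th (inn d)))) (out∈ (ends (inn d)))
        ... | _ , _ , v , _ , p , p' = v , trans p' (trans (sym p) lx)

      witness-in : ∀ d {β} → pin d ≡ β → ∃[ u ] (V r u × u ≢ x × lab u ≡ just i × A u ≡ β)
      witness-in d p = _ , proj₁ (vl-in d) , e≢x (out d) , proj₂ (vl-in d) , p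

      witness-out : ∀ d {β} → pout d ≡ β → ∃[ u ] (V r u × u ≢ x × lab u ≡ just i × A u ≡ β)
      witness-out d p = _ , proj₁ (vl-out d) , c≢x (inn d) , proj₂ (vl-out d) , p

    module _ {j} (j≢i : j ≢ i) (supp : ∀ {a} → A a ≡ true → lab a ≡ just j) where

      private
        Ax : A x ≡ false
        Ax with A x in eq
        ... | false = refl
        ... | true = ⊥-elim (j≢i (just-injective (trans (sym (supp eq)) lx)))

        ov-A : ∀ a → ov false a ≡ A a
        ov-A a with a ≟ x
        ... | yes refl = sym Ax
        ... | no _ = refl

        pinF : ∀ d → pin d ≡ false
        pinF d with pin d in eq
        ... | false = refl
        ... | true with valid (cb (proj₁ (th (out d)))) (in∈ (ends (out d)))
        ... | _ , _ , _ , _ , p , p' = ⊥-elim (j≢i (just-injective (trans (sym (supp eq)) (trans p (trans (sym p') lx)))))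

      boundO : ∀ {a b} → V r a → V r b → lab a ≡ just j → lab b ≡ just j → A a ≡ true → A b ≡ false → 2 ≤ sumQ
      boundO {a} {b} va vb la lb pa pb = subst (2 ≤_) eq
        (cut fam (ov false) j (λ {u} p → supp (trans (sym (ov-A u)) p)) va vb la lb (trans (ov-A a) pa) (trans (ov-A b) pb))
        where
        eq : tot (ov false) (F fam) ≡ sumQ
        eq = trans (ov-tot false) (trans (cong (sumQ +_) (cong₂ _+_ (cong₂ _+_ (cong (_⊸ false) (pinF fwd)) (cong (_⊸ false) (pinF bwd))) refl))
                                         (+-identityʳ sumQ))

  module _ {q r' x r'' z r} (s : Splice q r' x r'' z r) where

    lifts : ∀ {R : List (Dicycle r')} → All (Avoids x) R → ∃[ L ] Pointwise (SameBlack r' r) R L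
    lifts [] = [] , []
    lifts (_∷_ {d} v vs) = let L , p = lifts vs in liftD s d v ∷ L , refl ∷ p

    mkJoint : ∀ t → Thru r' x t → Thru r'' z (bar t) → Joint s
    mkJoint t th' th'' = record { J = JoinD.joinD s t th' th'' ; d' = proj₁ th' ; d'' = proj₁ th'' ; gl = JoinD.glueB s t th' th'' }

  module _ (_≟_ : DecidableEquality E) (_≟ₖ_ : DecidableEquality K)
           {q r' x r'' z r} (s : Splice q r' x r'' z r) (fam' : Fam r') (fam'' : Fam r'')
           (four' : Four r' x (F fam')) (four'' : Four r'' z (F fam'')) where
    private
      module F' = Four four'
      module F'' = Four four''
      module H' = HalfCut _≟_ (ir' s) (labx s) (x∈ s) fam' four'
      module H'' = HalfCut _≟_ (ir'' s) (labz s) (z∈ s) fam'' four''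

      joint : Turn → Joint s
      joint t = mkJoint s t (F'.th t) (F''.th (bar t))

      js : List (Joint s)
      js = map joint turns

      K' K'' : List (Dicycle r)
      K' = proj₁ (lifts s F'.av)
      K'' = proj₁ (lifts (swapSplice s) F''.av)

      pw' : Pointwise (SameBlack r' r) F'.R K'
      pw' = proj₂ (lifts s F'.av)
      pw'' : Pointwise (SameBlack r'' r) F''.R K''
      pw'' = proj₂ (lifts (swapSplice s) F''.av)

      family : List (Dicycle r)
      family = map J js ++ K' ++ K''

      swap-perm : F fam'' ↭ map (d' ∘ swapJoint) js ++ F''.R
      swap-perm = ↭trans F''.perm (++⁺ʳ F''.R
        (++-comm (proj₁ (F''.th (out fwd)) ∷ proj₁ (F''.th (out bwd)) ∷ []) (proj₁ (F''.th (inn fwd)) ∷ proj₁ (F''.th (inn bwd)) ∷ [])))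

      module HC = HalfCover s js {K' = K'} {K''} F'.av F''.av pw' pw''
      module HS = HalfCover (swapSplice s) (map swapJoint js) {K' = K''} {K'} F''.av F'.av pw'' pw'

      cov : ∀ d {a b} → Valid r a (seg d) b → ExOne (Hits a (seg d) b) family
      cov d {a} {b} v = go (invK s d v)
        where
        go : ((Valid r' a (seg d) b × a ≢ x × b ≢ x) ⊎ (Valid r'' a (seg d) b × a ≢ z × b ≢ z)) ⊎
             ((Valid r' a (seg d) x × Valid r'' z (seg d) b) ⊎ (Valid r'' a (seg d) z × Valid r' x (seg d) b)) →
             ExOne (Hits a (seg d) b) family
        go (inj₁ (inj₁ (m , na , nb))) = HC.cover-uu m na nb (ExOne-↭ F'.perm (cover fam' d m))
        go (inj₁ (inj₂ (m , na , nb))) = ExOne-↭ (++⁺ˡ (map J js) (++-comm K'' K'))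
                                            (HS.cover-uu m na nb (ExOne-↭ swap-perm (cover fam'' d m)))
        go (inj₂ (inj₁ (m , m'))) = HC.cover-ug m m' (ExOne-↭ F'.perm (cover fam' d m))
        go (inj₂ (inj₂ (m , m'))) = ExOne-↭ (++⁺ˡ (map J js) (++-comm K'' K'))
                                            (HS.cover-ug m m' (ExOne-↭ swap-perm (cover fam'' d m)))

      module _ (A : E → Bool) where
        module A' = H' A
        module A'' = H'' A

        tot-pw : ∀ {ρ} {R : List (Dicycle ρ)} {L : List (Dicycle r)} → Pointwise (SameBlack ρ r) R L → tot A L ≡ tot A R
        tot-pw [] = refl
        tot-pw (p ∷ ps) = cong₂ _+_ (cong (wt A) (sym p)) (tot-pw ps)

        j-out : ∀ d → wt A (black (J (joint (out d)))) ≡ (A'.pin d ⊸ A''.pout d) + (A''.rest (inn d) + A'.rest (out d))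
        j-out d = cong ((A'.pin d ⊸ A''.pout d) +_) (wt-++ A (Opening.Q (A''.ends (inn d))))

        j-inn : ∀ d → wt A (black (J (joint (inn d)))) ≡ A''.rest (out d) + ((A''.pin d ⊸ A'.pout d) + A'.rest (inn d))
        j-inn d = wt-++ A (Opening.Q (A''.ends (out d)))

        tot-family : tot A family ≡ CutCount.total A'.sumQ A''.sumQ (A'.pin fwd) (A'.pin bwd) (A'.pout fwd) (A'.pout bwd)
                                      (A''.pin fwd) (A''.pin bwd) (A''.pout fwd) (A''.pout bwd)
        tot-family = trans
          (cong₂ _+_ (j-out fwd) (cong₂ _+_ (j-out bwd) (cong₂ _+_ (j-inn fwd) (cong₂ _+_ (j-inn bwd)
            (trans (tot-++ A K') (cong₂ _+_ (tot-pw pw') (tot-pw pw'')))))))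
          (lem (A'.pin fwd ⊸ A''.pout fwd) (A'.pin bwd ⊸ A''.pout bwd) (A''.pin fwd ⊸ A'.pout fwd) (A''.pin bwd ⊸ A'.pout bwd)
               (A'.rest (out fwd)) (A'.rest (out bwd)) (A'.rest (inn fwd)) (A'.rest (inn bwd))
               (A''.rest (out fwd)) (A''.rest (out bwd)) (A''.rest (inn fwd)) (A''.rest (inn bwd))
               (tot A F'.R) (tot A F''.R))
          where
          add₃ : ∀ u v w u' v' w' → u + v + w + (u' + v' + w') ≡ (u + u') + (v + v') + (w + w')
          add₃ = solve-∀
          one₃ : ∀ p s q → p + (s + q) ≡ q + s + p
          one₃ = solve-∀
          two₃ : ∀ s a q → s + (a + q) ≡ q + s + a
          two₃ = solve-∀
          sum₅ : ∀ a b c d t → a + (b + (c + (d + t))) ≡ t + (a + b + (c + d))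
          sum₅ = solve-∀
          sum₅' : ∀ a b c d t → c + (d + (a + (b + t))) ≡ t + (a + b + (c + d))
          sum₅' = solve-∀
          sum₄ : ∀ a b c d → a + (b + (c + (d + 0))) ≡ a + b + (c + d)
          sum₄ = solve-∀
          lem : ∀ p₁ p₂ a₁ a₂ q₁ q₂ q₃ q₄ s₁ s₂ s₃ s₄ t t' →
            p₁ + (s₃ + q₁) + (p₂ + (s₄ + q₂) + (s₁ + (a₁ + q₃) + (s₂ + (a₂ + q₄) + (t + t')))) ≡
            t + (q₁ + q₂ + (q₃ + q₄)) + (t' + (s₁ + s₂ + (s₃ + s₄))) + (p₁ + p₂ + (a₁ + a₂))
          lem p₁ p₂ a₁ a₂ q₁ q₂ q₃ q₄ s₁ s₂ s₃ s₄ t t' =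
            trans (cong₂ _+_ (one₃ p₁ s₃ q₁) (trans (cong₂ _+_ (one₃ p₂ s₄ q₂) (trans (cong₂ _+_ (two₃ s₁ a₁ q₃)
              (trans (cong₂ _+_ (two₃ s₂ a₂ q₄) (sym (+-identityʳ (t + t'))))
                (add₃ q₄ s₂ a₂ t t' 0))) (add₃ q₃ s₁ a₁ (q₄ + t) (s₂ + t') (a₂ + 0))))
              (add₃ q₂ s₄ p₂ (q₃ + (q₄ + t)) (s₁ + (s₂ + t')) (a₁ + (a₂ + 0)))))
            (trans (add₃ q₁ s₃ p₁ (q₂ + (q₃ + (q₄ + t))) (s₄ + (s₁ + (s₂ + t'))) (p₂ + (a₁ + (a₂ + 0))))
              (cong₂ _+_ (cong₂ _+_ (sum₅ q₁ q₂ q₃ q₄ t) (sum₅' s₁ s₂ s₃ s₄ t')) (sum₄ p₁ p₂ a₁ a₂)))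

        enough' : 2 ≤ A'.sumQ → 2 ≤ tot A family
        enough' h = ≤-trans h (≤-trans (m≤m+n _ _) (≤-trans (m≤m+n _ _) (≤-reflexive (sym tot-family))))
        enough'' : 2 ≤ A''.sumQ → 2 ≤ tot A family
        enough'' h = ≤-trans h (≤-trans (m≤n+m _ A'.sumQ) (≤-trans (m≤m+n _ _) (≤-reflexive (sym tot-family))))

        same : (∀ {a} → A a ≡ true → lab a ≡ just q) → ∀ {a b} → V r a → V r b →
               lab a ≡ just q → lab b ≡ just q → A a ≡ true → A b ≡ false → 2 ≤ tot A family
        same supp {a} {b} va vb la lb pa pb = ≤-trans
          (CutCount.bound A'.sumQ A''.sumQ _ _ _ _ _ _ _ _ (A'.boundT supp) (A'.boundF supp) (A''.boundT supp) (A''.boundF supp)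
            (mix _ _ _ _ (A'.witness-in supp fwd , A'.witness-in supp fwd) (A'.witness-in supp bwd , A'.witness-in supp bwd)
                         (A'.witness-out supp fwd , A'.witness-out supp fwd) (A'.witness-out supp bwd , A'.witness-out supp bwd))
            (mix _ _ _ _ (A''.witness-in supp fwd , A''.witness-in supp fwd) (A''.witness-in supp bwd , A''.witness-in supp bwd)
                         (A''.witness-out supp fwd , A''.witness-out supp fwd) (A''.witness-out supp bwd , A''.witness-out supp bwd))
            (side va la pa) (side vb lb pb))
          (≤-reflexive (sym tot-family))
          where
          side : ∀ {β v} → V r v → lab v ≡ just q → A v ≡ β →
            (∃[ u ] (V r' u × u ≢ x × lab u ≡ just q × A u ≡ β)) ⊎ (∃[ u ] (V r'' u × u ≢ z × lab u ≡ just q × A u ≡ β))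
          side vv l p with Vinv s vv
          ... | inj₁ (v' , n) = inj₁ (_ , v' , n , l , p)
          ... | inj₂ (v' , n) = inj₂ (_ , v' , n , l , p)

        other : ∀ {i} → i ≢ q → (∀ {a} → A a ≡ true → lab a ≡ just i) → ∀ {a b} → V r a → V r b →
               lab a ≡ just i → lab b ≡ just i → A a ≡ true → A b ≡ false → 2 ≤ tot A family
        other n supp {a} {b} va vb la lb pa pb = go (Vinv s va) (Vinv s vb)
          where
          go : (V r' a × a ≢ x) ⊎ (V r'' a × a ≢ z) → (V r' b × b ≢ x) ⊎ (V r'' b × b ≢ z) → 2 ≤ tot A family
          go (inj₁ (v , _)) (inj₁ (v' , _)) = enough' (A'.boundO n supp v v' la lb pa pb)
          go (inj₂ (v , _)) (inj₂ (v' , _)) = enough'' (A''.boundO n supp v v' la lb pa pb)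
          go (inj₁ (v , m)) (inj₂ (v' , m')) = ⊥-elim (n (share s v m v' m' la lb))
          go (inj₂ (v , m)) (inj₁ (v' , m')) = ⊥-elim (n (share s v' m' v m lb la))

    spliced : Fam r
    spliced = record
      { F = family ; cover = cov
      ; cut = λ A i supp → ct A i supp (i ≟ₖ q) }
      where
      ct : ∀ A i → (∀ {a} → A a ≡ true → lab a ≡ just i) → Dec (i ≡ q) → ∀ {a b} → V r a → V r b →
           lab a ≡ just i → lab b ≡ just i → A a ≡ true → A b ≡ false → 2 ≤ tot A family
      ct A i supp (yes refl) = same A supp
      ct A i supp (no n) = other A n supp

  substitute : DecidableEquality E → DecidableEquality K → ∀ {q r' x r'' z r} → Splice q r' x r'' z r →
    Fam r' → Fam r'' → Fam r
  substitute _≟_ _≟ₖ_ s fam' fam'' = spliced _≟_ _≟ₖ_ s fam' fam''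
    (four (ir' s) (labx s) (x∈ s) fam') (four (ir'' s) (labz s) (z∈ s) fam'')

  ring : List E → Ring
  ring w = record { V = _∈ w ; N = λ a b → (a , b) ∈ cpairs w }

  record _≈_ (r r' : Ring) : Set where
    field
      V→ : ∀ {a} → V r a → V r' a
      V← : ∀ {a} → V r' a → V r a
      N→ : ∀ {a b} → N r a b → N r' a b
      N← : ∀ {a b} → N r' a b → N r a b
  open _≈_ public

  rot-≈ : ∀ xs ys → ring (xs ++ ys) ≈ ring (ys ++ xs)
  rot-≈ xs ys = record { V→ = ∈-swap xs ; V← = ∈-swap ys ; N→ = cpairs-rot xs ys ; N← = cpairs-rot ys xs }

  Cyc-≈ : ∀ {r r' C} → r ≈ r' → Cyc r C → Cyc r' C
  Cyc-≈ q cy = record { base = base cy ; path = path-⊆ (V→ q) (N→ q) (path cy) ; uniq = uniq cy ; one = one cy ; noback = noback cy }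

  Dual : Ring → List Edge → Set
  Dual r B = ∃[ W ] (Cyc r B × Cyc r W × Pre r B W)

  Dual-≈ : ∀ {r r' B} → r ≈ r' → Dual r B → Dual r' B
  Dual-≈ q (W , cb , cw , p) = W , Cyc-≈ q cb , Cyc-≈ q cw ,
    record { alt = alt p ; xor = λ n → xor p (N← q n) ; ju→ = ju→ p ; ju← = ju← p }

  dicycle : ∀ {r} B → Dual r B → (∃[ a ] ∃[ b ] (a , jmp , b) ∈ B) → Dicycle r
  dicycle B du j = record
    { black = B ; white = proj₁ du ; cb = proj₁ (proj₂ du) ; cw = proj₁ (proj₂ (proj₂ du))
    ; pre = proj₂ (proj₂ (proj₂ du)) ; jump = j }

  Dicycle-≈ : ∀ {r r'} → r ≈ r' → Dicycle r → Dicycle r'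
  Dicycle-≈ q d = dicycle (black d) (Dual-≈ q (white d , cb d , cw d , pre d)) (jump d)

  tot-map-≈ : ∀ {r r'} (q : r ≈ r') A F → tot A (map (Dicycle-≈ q) F) ≡ tot A F
  tot-map-≈ q A [] = refl
  tot-map-≈ q A (d ∷ F) = cong (wt A (black d) +_) (tot-map-≈ q A F)

  Fam-≈ : ∀ {r r'} → r ≈ r' → Fam r → Fam r'
  Fam-≈ {r} {r'} q fam = record
    { F = map (Dicycle-≈ q) (F fam)
    ; cover = λ d v → ExOne-map (Dicycle-≈ q) (λ _ → id) (λ _ → id) (cover fam d (back d v))
    ; cut = λ A i supp va vb la lb pa pb → subst (2 ≤_) (sym (tot-map-≈ q A (F fam)))
              (cut fam A i supp (V← q va) (V← q vb) la lb pa pb) }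
    where
    back : ∀ d {a b} → Valid r' a (seg d) b → Valid r a (seg d) b
    back fwd v = N← q v
    back bwd v = N← q v

  fw : List (E × E) → List Edge
  fw = map λ { (a , b) → a , seg fwd , b }

  fw-∈ : ∀ {a b} {ps} → (a , b) ∈ ps → (a , seg fwd , b) ∈ fw ps
  fw-∈ = ∈-map⁺ _

  fw-∈⁻ : ∀ {a k b} {ps} → (a , k , b) ∈ fw ps → k ≡ seg fwd × (a , b) ∈ ps
  fw-∈⁻ h with ∈-map⁻ _ h
  ... | _ , h' , refl = refl , h'

  fw-path : ∀ {r} a xs b → (∀ {c d} → (c , d) ∈ links a xs b → N r c d) → Path r a (fw (links a xs b)) b
  fw-path a [] b f = f (here refl) ∷ []
  fw-path a (x ∷ xs) b f = f (here refl) ∷ fw-path x xs b (f ∘ there)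

  fw-src : ∀ ps → map src (fw ps) ≡ map proj₁ ps
  fw-src [] = refl
  fw-src (_ ∷ ps) = cong (_ ∷_) (fw-src ps)

  fwd≢opp : ∀ {d : Dir} → seg d ≡ seg fwd → seg (opp d) ≡ seg fwd → ⊥
  fwd≢opp {fwd} _ ()
  fwd≢opp {bwd} ()

  isRing : ∀ {x u a b} → Unique (x ∷ u) → a ∈ x ∷ u → b ∈ x ∷ u → a ≢ b → IsRing (ring (x ∷ u))
  isRing {x} {u} {a} {b} uq a∈ b∈ a≢b = record
    { V-src = proj₁ ∘ cpairs-mem {w = x ∷ u}
    ; V-tgt = proj₂ ∘ cpairs-mem {w = x ∷ u}
    ; irr = λ { h refl → distinct h }
    ; func = cpairs-func {w = x ∷ u} uq
    ; inj = cpairs-inj {w = x ∷ u} uq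
    ; nxt = cpairs-next
    ; prv = cpairs-prev
    ; circle = fw (cpairs (x ∷ u))
    ; circ = record
      { base = x ; path = fw-path x u x id
      ; uniq = subst Unique (sym (trans (fw-src (cpairs (x ∷ u))) (cpairs-src (x ∷ u)))) uq
      ; one = λ h → ⊥-elim (nojmp (proj₁ (fw-∈⁻ h)))
      ; noback = λ h h' → fwd≢opp (proj₁ (fw-∈⁻ h)) (proj₁ (fw-∈⁻ h')) }
    ; circ∈ = fw-∈
    ; circ-fwd = proj₁ ∘ fw-∈⁻ }
    where
    nojmp : jmp ≢ seg fwd
    nojmp ()
    distinct : ∀ {c} → (c , c) ∈ cpairs (x ∷ u) → ⊥
    distinct h = cpairs-irr uq a∈ (λ e → cpairs-irr uq b∈ (λ e' → a≢b (trans (sym e) e')) h refl) h refl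

  splice : ∀ {q x n u' z f g'} → let u = n ∷ u' ; g = f ∷ g' in
    x ∉ u → z ∉ g → Unique (g ++ u) → lab x ≡ just q → lab z ≡ just q →
    (∀ {a b i} → a ∈ u → b ∈ g → lab a ≡ just i → lab b ≡ just i → i ≡ q) →
    Splice q (ring (x ∷ u)) x (ring (z ∷ g)) z (ring (g ++ u))
  splice {q} {x} {n} {u'} {z} {f} {g'} x∉ z∉ uq lx lz sh = record
    { ir' = isRing (fresh x∉ uqU) (here refl) (there (here refl)) (λ { refl → x∉ (here refl) })
    ; ir'' = isRing (fresh z∉ uqG) (here refl) (there (here refl)) (λ { refl → z∉ (here refl) })
    ; x∈ = here refl ; z∈ = here refl ; labx = lx ; labz = lz
    ; V' = λ { (here e) n → ⊥-elim (n e) ; (there h) _ → ∈-++⁺ʳ (f ∷ g') h }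
    ; V'' = λ { (here e) n → ⊥-elim (n e) ; (there h) _ → ∈-++⁺ˡ h }
    ; disj = λ a∈ na a∈' na' → dj (strip a∈' na') (strip a∈ na)
    ; share = λ a∈ na b∈ nb → sh (strip a∈ na) (strip b∈ nb)
    ; n' = λ h na nb → cU (core h na nb)
    ; n'' = λ h na nb → cG (core h na nb)
    ; nx = last-first
    ; nz = last-first'
    ; Vinv = vinv
    ; inv = inv' }
    where
    u = n ∷ u'
    g = f ∷ g'
    fresh : ∀ {v w} → v ∉ w → Unique w → Unique (v ∷ w)
    fresh v∉ uw = All.tabulate (λ h e → v∉ (subst (_∈ _) (sym e) h)) ∷ uw
    parts = unique-++⁻ g uq
    uqG = proj₁ parts
    uqU = proj₁ (proj₂ parts)
    dj = proj₂ (proj₂ parts)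
    strip : ∀ {v a : E} {w} → a ∈ v ∷ w → a ≢ v → a ∈ w
    strip (here e) n = ⊥-elim (n e)
    strip (there h) _ = h
    whole : ∀ {p} → p ∈ links f g' n ++ links n u' f → p ∈ cpairs (g ++ u)
    whole = subst (_ ∈_) (sym (links-++ f g' n u' f))
    core : ∀ {v h t a b} → (a , b) ∈ cpairs (v ∷ h ∷ t) → a ≢ v → b ≢ v → ∀ e → (a , b) ∈ links h t e
    core (here refl) na nb = ⊥-elim (na refl)
    core (there k) na nb with links-end k
    ... | inj₁ (_ , c) = c
    ... | inj₂ (e , _) = ⊥-elim (nb e)
    cU : ∀ {p} → (∀ e → p ∈ links n u' e) → p ∈ cpairs (g ++ u)
    cU h = whole (∈-++⁺ʳ (links f g' n) (h f))
    cG : ∀ {p} → (∀ e → p ∈ links f g' e) → p ∈ cpairs (g ++ u)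
    cG h = whole (∈-++⁺ˡ (h n))
    last' : ∀ {v h t a} → v ∉ h ∷ t → (a , v) ∈ cpairs (v ∷ h ∷ t) → ∀ e → (a , e) ∈ links h t e
    last' v∉ (here refl) = ⊥-elim (v∉ (here refl))
    last' v∉ (there k) with links-end k
    ... | inj₁ (m , _) = ⊥-elim (v∉ (there m))
    ... | inj₂ (_ , c) = c
    first' : ∀ {v h t b} → v ∉ h ∷ t → (v , b) ∈ cpairs (v ∷ h ∷ t) → b ≡ h
    first' v∉ (here refl) = refl
    first' v∉ (there k) = ⊥-elim (v∉ (proj₁ (links-mem k)))
    last-first : ∀ {a b} → (a , x) ∈ cpairs (x ∷ u) → (z , b) ∈ cpairs (z ∷ g) → (a , b) ∈ cpairs (g ++ u)
    last-first h h' with first' z∉ h'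
    ... | refl = whole (∈-++⁺ʳ (links f g' n) (last' x∉ h f))
    last-first' : ∀ {a b} → (a , z) ∈ cpairs (z ∷ g) → (x , b) ∈ cpairs (x ∷ u) → (a , b) ∈ cpairs (g ++ u)
    last-first' h h' with first' x∉ h'
    ... | refl = whole (∈-++⁺ˡ (last' z∉ h n))
    vinv : ∀ {a} → a ∈ g ++ u → (a ∈ x ∷ u × a ≢ x) ⊎ (a ∈ z ∷ g × a ≢ z)
    vinv h with ∈-++⁻ g h
    ... | inj₁ k = inj₂ (there k , λ { refl → z∉ k })
    ... | inj₂ k = inj₁ (there k , λ { refl → x∉ k })
    inv' : ∀ {a b} → (a , b) ∈ cpairs (g ++ u) →
      (((a , b) ∈ cpairs (x ∷ u) × a ≢ x × b ≢ x) ⊎ ((a , b) ∈ cpairs (z ∷ g) × a ≢ z × b ≢ z)) ⊎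
      (((a , x) ∈ cpairs (x ∷ u) × (z , b) ∈ cpairs (z ∷ g)) ⊎ ((a , z) ∈ cpairs (z ∷ g) × (x , b) ∈ cpairs (x ∷ u)))
    inv' h with ∈-++⁻ (links f g' n) (subst (_ ∈_) (links-++ f g' n u' f) h)
    ... | inj₁ k with links-end k
    ... | inj₁ (m , c) = inj₁ (inj₂ (there (c z) , (λ { refl → z∉ (proj₁ (links-mem k)) }) , (λ { refl → z∉ (there m) })))
    ... | inj₂ (refl , c) = inj₂ (inj₂ (there (c z) , here refl))
    inv' h | inj₂ k with links-end k
    ... | inj₁ (m , c) = inj₁ (inj₁ (there (c x) , (λ { refl → x∉ (proj₁ (links-mem k)) }) , (λ { refl → x∉ (there m) })))
    ... | inj₂ (refl , c) = inj₂ (inj₁ (there (c x) , here refl))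

  -- Base families

  wt-jump : ∀ A {C a b} → (a , jmp , b) ∈ C → A a ≡ true → A b ≡ false → 1 ≤ wt A C
  wt-jump A {e ∷ C} (here refl) p q rewrite p | q = s≤s z≤n
  wt-jump A {e ∷ C} (there h) p q = ≤-trans (wt-jump A h p q) (m≤n+m _ (w₁ A e))

  tot-jump : ∀ {r} A {F : List (Dicycle r)} {d a b} → d ∈ F → (a , jmp , b) ∈ black d → A a ≡ true → A b ≡ false → 1 ≤ tot A F
  tot-jump A {d ∷ F} (here refl) h p q = ≤-trans (wt-jump A h p q) (m≤m+n _ (tot A F))
  tot-jump A {d ∷ F} (there m) h p q = ≤-trans (tot-jump A m h p q) (m≤n+m _ (wt A (black d)))

  CrossBoth : ∀ {r} → (E → Bool) → List (Dicycle r) → Set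
  CrossBoth A ds =
    (∃[ c ] ∃[ u ] ∃[ v ] (c ∈ ds × (u , jmp , v) ∈ black c × A u ≡ true × A v ≡ false)) ×
    (∃[ c ] ∃[ u ] ∃[ v ] (c ∈ ds × (v , jmp , u) ∈ black c × A u ≡ true × A v ≡ false))

  module _ {r : Ring} (ds : List (Dicycle r))
           (only : All (λ c → ∀ {a d b} → (a , seg d , b) ∈ black c → d ≡ fwd) ds)
           (once : ∀ {a b} → N r a b → ExOne (Hits a (seg fwd) b) ds)
           (cross : ∀ A i → (∀ {a} → A a ≡ true → lab a ≡ just i) → ∀ {a b} → V r a → V r b →
                    lab a ≡ just i → lab b ≡ just i → A a ≡ true → A b ≡ false →
                    CrossBoth {r} A ds) where

    private
      b≢f : bwd ≢ fwd
      b≢f ()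

      none-rev : ∀ {a b} (ds : List (Dicycle r)) → All (λ c → ∀ {a d b} → (a , seg d , b) ∈ black c → d ≡ fwd) ds →
                 All (¬_ ∘ Hits a (seg fwd) b) (map revD ds)
      none-rev [] [] = []
      none-rev (c ∷ ds) (o ∷ os) = (λ h → b≢f (o (rev-∈⁻ h))) ∷ none-rev ds os

    bothWays : Fam r
    bothWays = record
      { F = ds ++ map revD ds
      ; cover = cv
      ; cut = λ A i supp va vb la lb pa pb → ct A (cross A i supp va vb la lb pa pb) }
      where
      cv : ∀ d {a b} → Valid r a (seg d) b → ExOne (Hits a (seg d) b) (ds ++ map revD ds)
      cv fwd v = ExOne-++ˡ (once v) (none-rev ds only)
      cv bwd v = ExOne-++ʳ (All.map (λ o h → b≢f (o h)) only) (ExOne-map revD (λ c h → rev-∈ h) (λ c h → rev-∈⁻ h) (once v))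
      ct : ∀ A → CrossBoth {r} A ds → 2 ≤ tot A (ds ++ map revD ds)
      ct A ((c , u , v , c∈ , h , p , q) , (c' , u' , v' , c'∈ , h' , p' , q')) =
        subst (2 ≤_) (sym (tot-++ A ds))
          (+-mono-≤ (tot-jump A c∈ h p q) (tot-jump A (∈-map⁺ revD c'∈) (rev-∈ h') p' q'))

  data ShortEdges (a b : E) : Edge → Set where
    e₁ : ShortEdges a b (a , seg fwd , b)
    e₂ : ShortEdges a b (b , jmp , a)

  shortB : E → E → List Edge
  shortB a b = (a , seg fwd , b) ∷ (b , jmp , a) ∷ []

  short-view : ∀ {a b e} → e ∈ shortB a b → ShortEdges a b e
  short-view (here refl) = e₁
  short-view (there (here refl)) = e₂

  module Chord {a b ρ i} (uq : Unique (a ∷ b ∷ ρ)) (la : lab a ≡ just i) (lb : lab b ≡ just i) where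
    private
      r = ring (a ∷ b ∷ ρ)
      a∉ : a ∉ b ∷ ρ
      a∉ = unique-∉ uq
      a≢b : a ≢ b
      a≢b e = a∉ (here e)
      B = shortB a b

    W : List Edge
    W = fw (links b ρ a) ++ (a , jmp , b) ∷ []

    private
      data WV : Edge → Set where
        w₁' : ∀ {c d} → (c , d) ∈ links b ρ a → WV (c , seg fwd , d)
        w₂' : WV (a , jmp , b)

      wv : ∀ {e} → e ∈ W → WV e
      wv h with ∈-++⁻ (fw (links b ρ a)) h
      ... | inj₂ (here refl) = w₂'
      ... | inj₁ k with ∈-map⁻ _ k
      ... | _ , k' , refl = w₁' k'

      srcB : ∀ {c d} → (c , d) ∈ links b ρ a → c ≢ a
      srcB k refl = a∉ (proj₁ (links-mem k))

    cycB : Cyc r B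
    cycB = record
      { base = a
      ; path = here refl ∷ _∷_ {k = jmp} ((λ e → a≢b (sym e)) , there (here refl) , here refl , i , lb , la) []
      ; uniq = (a≢b ∷ []) ∷ [] ∷ []
      ; one = λ h h' _ _ → on (short-view h) (short-view h')
      ; noback = λ h h' → nb (short-view h) (short-view h') }
      where
      on : ∀ {c d c' d'} → ShortEdges a b (c , jmp , d) → ShortEdges a b (c' , jmp , d') → c ≡ c'
      on e₂ e₂ = refl
      nb : ∀ {c κ d} → ShortEdges a b (c , seg κ , d) → ShortEdges a b (d , seg (opp κ) , c) → ⊥
      nb e₁ ()

    cycW : Cyc r W
    cycW = record
      { base = b
      ; path = path-++ (fw-path b ρ a there) (_∷_ {k = jmp} (a≢b , here refl , there (here refl) , i , la , lb) [])
      ; uniq = subst Unique (sym srcs) (unique-↭ (++-comm (a ∷ []) (b ∷ ρ)) uq)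
      ; one = λ h h' _ _ → on (wv h) (wv h')
      ; noback = λ h h' → nb (wv h) (wv h') }
      where
      srcs : map src W ≡ (b ∷ ρ) ++ a ∷ []
      srcs = trans (map-++ src (fw (links b ρ a)) _)
               (cong (_++ a ∷ []) (trans (fw-src (links b ρ a)) (links-src b ρ a)))
      on : ∀ {c d c' d'} → WV (c , jmp , d) → WV (c' , jmp , d') → c ≡ c'
      on w₂' w₂' = refl
      nb : ∀ {c κ d} → WV (c , seg κ , d) → WV (d , seg (opp κ) , c) → ⊥
      nb (w₁' _) ()

    private
      juBW : ∀ {c d} → (c , jmp , d) ∈ B → Us W c jmp d
      juBW h with short-view h
      ... | e₂ = inj₂ (∈-++⁺ʳ (fw (links b ρ a)) (here refl))
      juWB : ∀ {c d} → (c , jmp , d) ∈ W → Us B c jmp d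
      juWB h with wv h
      ... | w₂' = inj₂ (there (here refl))
      onlyB : ∀ {c d} → (c , d) ∈ links b ρ a → ¬ Us B c (seg fwd) d
      onlyB k (inj₁ h) with short-view h
      ... | e₁ = srcB k refl
      onlyB k (inj₂ h) with short-view h
      ... | ()
      onlyW : ¬ Us W a (seg fwd) b
      onlyW (inj₁ h) with wv h
      ... | w₁' k = srcB k refl
      onlyW (inj₂ h) with wv h
      ... | ()
      xr : ∀ {c d} → (c , d) ∈ cpairs (a ∷ b ∷ ρ) → Xor (Us B c (seg fwd) d) (Us W c (seg fwd) d)
      xr (here refl) = inj₁ (inj₁ (here refl) , onlyW)
      xr (there k) = inj₂ (onlyB k , inj₁ (∈-++⁺ˡ (fw-∈ k)))

      altB : ∀ {c k d k' e j} → (c , k , d) ∈ B → (d , k' , e) ∈ B → lab d ≡ just j → Alt k k'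
      altB h h' _ = al (short-view h) (short-view h')
        where
        al : ∀ {c k d k' e} → ShortEdges a b (c , k , d) → ShortEdges a b (d , k' , e) → Alt k k'
        al e₁ e₁ = ⊥-elim (a≢b refl)
        al e₁ e₂ = tt
        al e₂ e₁ = tt
        al e₂ e₂ = ⊥-elim (a≢b refl)

    short : Dual r B
    short = W , cycB , cycW , record { alt = altB ; xor = xr ; ju→ = juBW ; ju← = juWB }

    module _ (neutral : ∀ {c} → c ∈ ρ → lab c ≡ nothing) where

      private
        altW : ∀ {c k d k' e j} → (c , k , d) ∈ W → (d , k' , e) ∈ W → lab d ≡ just j → Alt k k'
        altW h h' l with wv h | wv h'
        ... | w₁' k | w₂' = tt
        ... | w₂' | w₁' k = tt
        ... | w₂' | w₂' = a≢b refl
        ... | w₁' k | w₁' k' with links-end k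
        ... | inj₂ (refl , _) = srcB k' refl
        ... | inj₁ (m , _) with trans (sym l) (neutral m)
        ... | ()

      long : Dual r W
      long = B , cycW , cycB , record
        { alt = altW ; xor = λ n → Data.Sum.swap (Data.Sum.map sw sw (xr n)) ; ju→ = juWB ; ju← = juBW }
        where
        import Data.Sum
        sw : ∀ {P Q : Set} → P × Q → Q × P
        sw (p , q) = q , p

      private
        ds : List (Dicycle r)
        ds = dicycle B short (b , a , there (here refl)) ∷
             dicycle W long (a , b , ∈-++⁺ʳ (fw (links b ρ a)) (here refl)) ∷ []

        once : ∀ {c d} → (c , d) ∈ cpairs (a ∷ b ∷ ρ) → ExOne (Hits c (seg fwd) d) ds
        once (here refl) = here (here refl) ((λ h → onlyW (inj₁ h)) ∷ [])
        once (there k) = there (λ h → onlyB k (inj₁ h)) (here (∈-++⁺ˡ (fw-∈ k)) [])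

        only : All (λ c → ∀ {a d b} → (a , seg d , b) ∈ black c → d ≡ fwd) ds
        only = ob ∷ ow ∷ []
          where
          ob : ∀ {c d e} → (c , seg d , e) ∈ B → d ≡ fwd
          ob h with short-view h
          ... | e₁ = refl
          ow : ∀ {c d e} → (c , seg d , e) ∈ W → d ≡ fwd
          ow h with wv h
          ... | w₁' _ = refl

        j₁ : (b , jmp , a) ∈ B
        j₁ = there (here refl)
        j₂ : (a , jmp , b) ∈ W
        j₂ = ∈-++⁺ʳ (fw (links b ρ a)) (here refl)

        cross : ∀ A (j : K) → (∀ {a} → A a ≡ true → lab a ≡ just j) → ∀ {u v} → u ∈ a ∷ b ∷ ρ → v ∈ a ∷ b ∷ ρ →
          lab u ≡ just j → lab v ≡ just j → A u ≡ true → A v ≡ false →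
          CrossBoth A ds
        cross A j _ {u} {v} u∈ v∈ lu lv pu pv = go u∈ v∈
          where
          t≢f : true ≢ false
          t≢f ()
          j≢n : ∀ {k : K} → just k ≢ nothing
          j≢n ()
          go : u ∈ a ∷ b ∷ ρ → v ∈ a ∷ b ∷ ρ → CrossBoth A ds
          go (here refl) (here refl) = ⊥-elim (t≢f (trans (sym pu) pv))
          go (here refl) (there (here refl)) =
            (_ , a , b , there (here refl) , j₂ , pu , pv) , (_ , a , b , here refl , j₁ , pu , pv)
          go (there (here refl)) (here refl) =
            (_ , b , a , here refl , j₁ , pu , pv) , (_ , b , a , there (here refl) , j₂ , pu , pv)
          go (there (here refl)) (there (here refl)) = ⊥-elim (t≢f (trans (sym pu) pv))
          go (there (there m)) _ = ⊥-elim (j≢n (trans (sym lu) (neutral m)))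
          go (here _) (there (there m)) = ⊥-elim (j≢n (trans (sym lv) (neutral m)))
          go (there (here _)) (there (there m)) = ⊥-elim (j≢n (trans (sym lv) (neutral m)))

      chordFam : Fam r
      chordFam = bothWays ds only once cross

  module Single {w i p q} (uq : Unique w) (p∈ : p ∈ w) (q∈ : q ∈ w) (p≢q : p ≢ q) (all : ∀ {a} → a ∈ w → lab a ≡ just i) where
    private
      irr-w : ∀ {a b} → (a , b) ∈ cpairs w → a ≢ b
      irr-w h refl = cpairs-irr uq p∈ (λ e → cpairs-irr uq q∈ (λ e' → p≢q (trans (sym e) e')) h refl) h refl

      dual : ∀ {a b} → (a , b) ∈ cpairs w → Dual (ring w) (shortB a b)
      dual {a} {b} h with cpairs-front uq (irr-w h) h
      ... | ρ , xs , ys , refl , e =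
        Dual-≈ (rot-≈ ys xs) (subst (λ l → Dual (ring l) (shortB a b)) (sym e)
          (Chord.short (subst Unique e (unique-↭ (++-comm xs ys) uq)) (all (proj₁ (cpairs-mem {w = xs ++ ys} h))) (all (proj₂ (cpairs-mem {w = xs ++ ys} h)))))

      mk : ∀ {e} → e ∈ cpairs w → Dicycle (ring w)
      mk {a , b} h = dicycle (shortB a b) (dual h) (b , a , there (here refl))

      pairs : All (_∈ cpairs w) (cpairs w)
      pairs = All.tabulate id

      ds = All.reduce mk pairs

      at : ∀ {a b} → (a , b) ∈ cpairs w → ∃[ c ] (c ∈ ds × (b , jmp , a) ∈ black c)
      at {a} {b} h = go pairs h
        where
        go : ∀ {xs} (ps : All (_∈ cpairs w) xs) → (a , b) ∈ xs → ∃[ c ] (c ∈ All.reduce mk ps × (b , jmp , a) ∈ black c)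
        go (m ∷ ps) (here refl) = mk m , here refl , there (here refl)
        go (m ∷ ps) (there k) = let c , c∈ , e = go ps k in c , there c∈ , e

      once : ∀ {a b} → (a , b) ∈ cpairs w → ExOne (Hits a (seg fwd) b) ds
      once {a} {b} h = ExOne-reduce mk pairs to from
        (ExOne-unique proj₁ (subst Unique (sym (cpairs-src w)) uq) (∈-map⁺ proj₁ h))
        where
        to : ∀ {e} (m : e ∈ cpairs w) → proj₁ e ≡ a → (a , seg fwd , b) ∈ black (mk m)
        to m refl with cpairs-func {w = w} uq m h
        ... | refl = here refl
        from : ∀ {e} (m : e ∈ cpairs w) → (a , seg fwd , b) ∈ black (mk m) → proj₁ e ≡ a
        from m k with short-view k
        ... | e₁ = refl

      only : All (λ c → ∀ {a d b} → (a , seg d , b) ∈ black c → d ≡ fwd) ds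
      only = all-reduce mk pairs λ m h → go (short-view h)
        where
        go : ∀ {a b c d e} → ShortEdges a b (c , seg d , e) → d ≡ fwd
        go e₁ = refl

      not-t : ∀ {b} → b ≡ true → not b ≡ false
      not-t refl = refl
      not-f : ∀ {b} → b ≡ false → not b ≡ true
      not-f refl = refl
      not-t' : ∀ {b} → not b ≡ true → b ≡ false
      not-t' {false} _ = refl
      not-f' : ∀ {b} → not b ≡ false → b ≡ true
      not-f' {true} _ = refl

    singleFam : Fam (ring w)
    singleFam = bothWays ds only once λ A j _ u∈ v∈ _ _ pu pv →
      let a , b , h , na , nb = crossing (not ∘ A) v∈ u∈ (not-f pv) (not-t pu)
          c , c∈ , k = at h
          a' , b' , h' , pa , pb = crossing A u∈ v∈ pu pv
          c' , c'∈ , k' = at h'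
      in (c , b , a , c∈ , k , not-f' nb , not-t' na) , (c' , a' , b' , c'∈ , k' , pa , pb)

  quad : E × E → E × E → List Edge
  quad (y , x) (y' , x') = (x , seg bwd , y) ∷ (y , jmp , y') ∷ (y' , seg fwd , x') ∷ (x' , jmp , x) ∷ []

  module Quad {y x y' x' ρ l p} (uq : Unique (y ∷ x ∷ y' ∷ x' ∷ ρ)) (l≢p : l ≢ p)
    (ly : lab y ≡ just l) (lx : lab x ≡ just p) (ly' : lab y' ≡ just l) (lx' : lab x' ≡ just p) where
    private
      w : List E
      w = y ∷ x ∷ y' ∷ x' ∷ ρ
      r = ring w
      B = quad (y , x) (y' , x')
      W : List Edge
      W = (x , jmp , x') ∷ fw (links x' ρ y) ++ (y , jmp , y') ∷ (y' , seg bwd , x) ∷ []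

      y∉ : y ∉ x ∷ y' ∷ x' ∷ ρ
      y∉ = unique-∉ uq
      x∉ : x ∉ y' ∷ x' ∷ ρ
      x∉ = unique-∉ (unique-tail uq)
      y'∉ : y' ∉ x' ∷ ρ
      y'∉ = unique-∉ (unique-tail (unique-tail uq))

      data BV : Edge → Set where
        b₁ : BV (x , seg bwd , y)
        b₂ : BV (y , jmp , y')
        b₃ : BV (y' , seg fwd , x')
        b₄ : BV (x' , jmp , x)

      bv : ∀ {e} → e ∈ B → BV e
      bv (here refl) = b₁
      bv (there (here refl)) = b₂
      bv (there (there (here refl))) = b₃
      bv (there (there (there (here refl)))) = b₄

      data WV : Edge → Set where
        v₁ : WV (x , jmp , x')
        v₂ : ∀ {c d} → (c , d) ∈ links x' ρ y → WV (c , seg fwd , d)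
        v₃ : WV (y , jmp , y')
        v₄ : WV (y' , seg bwd , x)

      wv : ∀ {e} → e ∈ W → WV e
      wv (here refl) = v₁
      wv (there h) with ∈-++⁻ (fw (links x' ρ y)) h
      ... | inj₂ (here refl) = v₃
      ... | inj₂ (there (here refl)) = v₄
      ... | inj₁ k with ∈-map⁻ _ k
      ... | _ , k' , refl = v₂ k'

      v₃∈ : (y , jmp , y') ∈ W
      v₃∈ = there (∈-++⁺ʳ (fw (links x' ρ y)) (here refl))
      v₄∈ : (y' , seg bwd , x) ∈ W
      v₄∈ = there (∈-++⁺ʳ (fw (links x' ρ y)) (there (here refl)))

      srcs : ∀ {c d} → (c , d) ∈ links x' ρ y → c ∈ x' ∷ ρ
      srcs k = proj₁ (links-mem k)

      y∈ : y ∈ w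
      y∈ = here refl
      x∈w : x ∈ w
      x∈w = there (here refl)
      y'∈ : y' ∈ w
      y'∈ = there (there (here refl))
      x'∈ : x' ∈ w
      x'∈ = there (there (there (here refl)))
      y≢y' : y ≢ y'
      y≢y' e = y∉ (there (here e))
      x≢x' : x ≢ x'
      x≢x' e = x∉ (there (here e))

      lp : ∀ {a i} → lab a ≡ just l → lab a ≡ just i → i ≡ l
      lp p q = just-injective (trans (sym q) p)
      pp : ∀ {a i} → lab a ≡ just p → lab a ≡ just i → i ≡ p
      pp p q = just-injective (trans (sym q) p)

      cycB : Cyc r B
      cycB = record
        { base = x
        ; path = _∷_ {k = seg bwd} (here refl) (_∷_ {k = jmp} (y≢y' , y∈ , y'∈ , l , ly , ly')
            (_∷_ {k = seg fwd} (there (there (here refl))) (_∷_ {k = jmp} ((λ e → x≢x' (sym e)) , x'∈ , x∈w , p , lx' , lx) [])))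
        ; uniq = ((λ e → y∉ (here (sym e))) ∷ (λ e → x∉ (here e)) ∷ x≢x' ∷ []) ∷
                 (y≢y' ∷ (λ e → y∉ (there (there (here e)))) ∷ []) ∷ ((λ e → y'∉ (here e)) ∷ []) ∷ [] ∷ []
        ; one = λ h h' → on (bv h) (bv h')
        ; noback = λ h h' → nb (bv h) (bv h') }
        where
        on : ∀ {a b a' b' i} → BV (a , jmp , b) → BV (a' , jmp , b') → lab a ≡ just i → lab a' ≡ just i → a ≡ a'
        on b₂ b₂ _ _ = refl
        on b₄ b₄ _ _ = refl
        on b₂ b₄ q q' = ⊥-elim (l≢p (trans (sym (lp ly q)) (pp lx' q')))
        on b₄ b₂ q q' = ⊥-elim (l≢p (trans (sym (lp ly q')) (pp lx' q)))
        nb : ∀ {a d b} → BV (a , seg d , b) → BV (b , seg (opp d) , a) → ⊥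
        nb b₁ b₃ = y≢y' refl
        nb b₃ b₁ = y≢y' refl

      cycW : Cyc r W
      cycW = record
        { base = x
        ; path = _∷_ {k = jmp} (x≢x' , x∈w , x'∈ , p , lx , lx') (path-++ (fw-path x' ρ y (λ k → there (there (there k))))
            (_∷_ {k = jmp} (y≢y' , y∈ , y'∈ , l , ly , ly') (_∷_ {k = seg bwd} (there (here refl)) [])))
        ; uniq = subst Unique (sym eq) (unique-↭ perm uq)
        ; one = λ h h' → on (wv h) (wv h')
        ; noback = λ h h' → nb (wv h) (wv h') }
        where
        eq : map src W ≡ x ∷ (x' ∷ ρ) ++ y ∷ y' ∷ []
        eq = cong (x ∷_) (trans (map-++ src (fw (links x' ρ y)) _)
               (cong (_++ y ∷ y' ∷ []) (trans (fw-src (links x' ρ y)) (links-src x' ρ y))))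
        perm : y ∷ x ∷ y' ∷ x' ∷ ρ ↭ x ∷ (x' ∷ ρ) ++ y ∷ y' ∷ []
        perm = ↭trans (swap y x ↭refl) (prep x (++-comm (y ∷ y' ∷ []) (x' ∷ ρ)))
        on : ∀ {a b a' b' i} → WV (a , jmp , b) → WV (a' , jmp , b') → lab a ≡ just i → lab a' ≡ just i → a ≡ a'
        on v₁ v₁ _ _ = refl
        on v₃ v₃ _ _ = refl
        on v₁ v₃ q q' = ⊥-elim (l≢p (trans (sym (lp ly q')) (pp lx q)))
        on v₃ v₁ q q' = ⊥-elim (l≢p (trans (sym (lp ly q)) (pp lx q')))
        nb : ∀ {a d b} → WV (a , seg d , b) → WV (b , seg (opp d) , a) → ⊥
        nb (v₂ k) v₄ = x∉ (there (srcs k))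
        nb v₄ (v₂ k) = x∉ (there (srcs k))

      alt' : ∀ {a k b k' c i} → (a , k , b) ∈ B → (b , k' , c) ∈ B → lab b ≡ just i → Alt k k'
      alt' h h' _ = al (bv h) (bv h')
        where
        al : ∀ {a k b k' c} → BV (a , k , b) → BV (b , k' , c) → Alt k k'
        al b₁ b₁ = ⊥-elim (y∉ (here refl))
        al b₁ b₂ = tt
        al b₁ b₃ = ⊥-elim (y≢y' refl)
        al b₁ b₄ = tt
        al b₂ b₁ = tt
        al b₂ b₂ = ⊥-elim (y≢y' refl)
        al b₂ b₃ = tt
        al b₂ b₄ = ⊥-elim (y'∉ (here refl))
        al b₃ b₁ = ⊥-elim (x≢x' refl)
        al b₃ b₂ = tt
        al b₃ b₃ = ⊥-elim (y'∉ (here refl))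
        al b₃ b₄ = tt
        al b₄ b₁ = tt
        al b₄ b₂ = ⊥-elim (y∉ (here refl))
        al b₄ b₃ = tt
        al b₄ b₄ = ⊥-elim (x≢x' refl)

      nW₁ : ¬ Us W y (seg fwd) x
      nW₁ (inj₁ h) with wv h
      ... | v₂ k = y∉ (there (there (srcs k)))
      nW₁ (inj₂ h) with wv h
      ... | v₄ = y∉ (here refl)
      nB₂ : ¬ Us B x (seg fwd) y'
      nB₂ (inj₁ h) with bv h
      ... | b₃ = x∉ (here refl)
      nB₂ (inj₂ h) with bv h
      ... | b₁ = y≢y' refl
      nW₃ : ¬ Us W y' (seg fwd) x'
      nW₃ (inj₁ h) with wv h
      ... | v₂ k = y'∉ (srcs k)
      nW₃ (inj₂ h) with wv h
      ... | v₄ = x≢x' refl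
      nB₄ : ∀ {c d} → (c , d) ∈ links x' ρ y → ¬ Us B c (seg fwd) d
      nB₄ k (inj₁ h) with bv h
      ... | b₃ = y'∉ (srcs k)
      nB₄ k (inj₂ h) with bv h
      ... | b₁ = y∉ (there (there (srcs k)))

      xr : ∀ {c d} → (c , d) ∈ cpairs w → Xor (Us B c (seg fwd) d) (Us W c (seg fwd) d)
      xr (here refl) = inj₁ (inj₂ (here refl) , nW₁)
      xr (there (here refl)) = inj₂ (nB₂ , inj₂ v₄∈)
      xr (there (there (here refl))) = inj₁ (inj₁ (there (there (here refl))) , nW₃)
      xr (there (there (there k))) = inj₂ (nB₄ k , inj₁ (there (∈-++⁺ˡ (fw-∈ k))))

      juB : ∀ {c d} → (c , jmp , d) ∈ B → Us W c jmp d
      juB h with bv h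
      ... | b₂ = inj₁ v₃∈
      ... | b₄ = inj₂ (here refl)
      juW : ∀ {c d} → (c , jmp , d) ∈ W → Us B c jmp d
      juW h with wv h
      ... | v₁ = inj₂ (there (there (there (here refl))))
      ... | v₃ = inj₁ (there (here refl))

    quadDual : Dual r B
    quadDual = W , cycB , cycW , record { alt = alt' ; xor = xr ; ju→ = juB ; ju← = juW }

  data QuadView : E × E → E × E → Edge → Set where
    q₁ : ∀ {y x P'} → QuadView (y , x) P' (x , seg bwd , y)
    q₂ : ∀ {y x y' x'} → QuadView (y , x) (y' , x') (y , jmp , y')
    q₃ : ∀ {P y' x'} → QuadView P (y' , x') (y' , seg fwd , x')
    q₄ : ∀ {y x y' x'} → QuadView (y , x) (y' , x') (x' , jmp , x)

  quad-view : ∀ P P' {e} → e ∈ quad P P' → QuadView P P' e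
  quad-view (y , x) (y' , x') (here refl) = q₁
  quad-view (y , x) (y' , x') (there (here refl)) = q₂
  quad-view (y , x) (y' , x') (there (there (here refl))) = q₃
  quad-view (y , x) (y' , x') (there (there (there (here refl)))) = q₄

  module Half {ps l p P₁ P₂} (uq : Unique (flat ps)) (l≢p : l ≢ p) (P₁∈ : P₁ ∈ ps) (P₂∈ : P₂ ∈ ps) (P₁≢P₂ : P₁ ≢ P₂)
              (labs : ∀ {y x} → (y , x) ∈ ps → lab y ≡ just l × lab x ≡ just p) where
    private
      irr-ps : ∀ {P P'} → (P , P') ∈ cpairs ps → P ≢ P'
      irr-ps h refl = cpairs-irr (flat-unique uq) P₁∈ (λ e → cpairs-irr (flat-unique uq) P₂∈ (λ e' → P₁≢P₂ (trans (sym e) e')) h refl) h refl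

      dual : ∀ {P P'} → (P , P') ∈ cpairs ps → Dual (ring (flat ps)) (quad P P')
      dual {y , x} {y' , x'} h with cpairs-front (flat-unique uq) (irr-ps h) h
      ... | ρ , xs , ys , e , e' = go e
        where
        eq : flat ys ++ flat xs ≡ y ∷ x ∷ y' ∷ x' ∷ flat ρ
        eq = trans (sym (flat-++ ys xs)) (cong flat e')
        go : ps ≡ xs ++ ys → Dual (ring (flat ps)) (quad (y , x) (y' , x'))
        go e = subst (λ v → Dual (ring v) (quad (y , x) (y' , x'))) (sym e'')
          (Dual-≈ (rot-≈ (flat ys) (flat xs)) (subst (λ v → Dual (ring v) (quad (y , x) (y' , x'))) (sym eq)
            (Quad.quadDual (subst Unique eq (unique-↭ (++-comm (flat xs) (flat ys)) (subst Unique e'' uq))) l≢p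
              (proj₁ lP) (proj₂ lP) (proj₁ lP') (proj₂ lP'))))
          where
          e'' : flat ps ≡ flat xs ++ flat ys
          e'' = trans (cong flat e) (flat-++ xs ys)
          lP = labs (proj₁ (cpairs-mem {w = ps} h))
          lP' = labs (proj₂ (cpairs-mem {w = ps} h))

      mk : ∀ {e} → e ∈ cpairs ps → Dicycle (ring (flat ps))
      mk {P , P'} h = dicycle (quad P P') (dual h) (_ , _ , there (here refl))

      pairs : All (_∈ cpairs ps) (cpairs ps)
      pairs = All.tabulate id

    half : List (Dicycle (ring (flat ps)))
    half = All.reduce mk pairs

    once-fwd : ∀ {y x} → (y , x) ∈ ps → ExOne (Hits y (seg fwd) x) half
    once-fwd {y} {x} h = ExOne-reduce mk pairs to from
      (ExOne-unique proj₂ (unique-↭ (↭-sym (cpairs-tgt ps)) (flat-unique uq)) (∈-resp-↭ (↭-sym (cpairs-tgt ps)) h))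
      where
      to : ∀ {e} (m : e ∈ cpairs ps) → proj₂ e ≡ (y , x) → (y , seg fwd , x) ∈ black (mk m)
      to m refl = there (there (here refl))
      from : ∀ {e} (m : e ∈ cpairs ps) → (y , seg fwd , x) ∈ black (mk m) → proj₂ e ≡ (y , x)
      from {P , P'} m k with quad-view P P' k
      ... | q₃ = refl

    once-bwd : ∀ {y x} → (y , x) ∈ ps → ExOne (Hits x (seg bwd) y) half
    once-bwd {y} {x} h = ExOne-reduce mk pairs to from
      (ExOne-unique proj₁ (subst Unique (sym (cpairs-src ps)) (flat-unique uq)) (subst (_ ∈_) (sym (cpairs-src ps)) h))
      where
      to : ∀ {e} (m : e ∈ cpairs ps) → proj₁ e ≡ (y , x) → (x , seg bwd , y) ∈ black (mk m)
      to m refl = here refl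
      from : ∀ {e} (m : e ∈ cpairs ps) → (x , seg bwd , y) ∈ black (mk m) → proj₁ e ≡ (y , x)
      from {P , P'} m k with quad-view P P' k
      ... | q₁ = refl

    none-fwd : ∀ {a b} → lab a ≡ just p → All (¬_ ∘ Hits a (seg fwd) b) half
    none-fwd {a} {b} la = all-reduce mk pairs no-hit
      where
      no-hit : ∀ {e} (m : e ∈ cpairs ps) → ¬ (a , seg fwd , b) ∈ black (mk m)
      no-hit {P , P'} m k with quad-view P P' k
      ... | q₃ = l≢p (just-injective (trans (sym (proj₁ (labs (proj₂ (cpairs-mem {w = ps} m))))) la))

    none-bwd : ∀ {a b} → lab a ≡ just l → All (¬_ ∘ Hits a (seg bwd) b) half
    none-bwd {a} {b} la = all-reduce mk pairs no-hit
      where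
      no-hit : ∀ {e} (m : e ∈ cpairs ps) → ¬ (a , seg bwd , b) ∈ black (mk m)
      no-hit {P , P'} m k with quad-view P P' k
      ... | q₁ = l≢p (just-injective (trans (sym la) (proj₂ (labs (proj₁ (cpairs-mem {w = ps} m))))))

    private
      at : ∀ {P P'} → (P , P') ∈ cpairs ps →
           ∃[ c ] (c ∈ half × (proj₁ P , jmp , proj₁ P') ∈ black c × (proj₂ P' , jmp , proj₂ P) ∈ black c)
      at {P} {P'} h = go pairs h
        where
        go : ∀ {xs} (qs : All (_∈ cpairs ps) xs) → (P , P') ∈ xs →
             ∃[ c ] (c ∈ All.reduce mk qs × (proj₁ P , jmp , proj₁ P') ∈ black c × (proj₂ P' , jmp , proj₂ P) ∈ black c)
        go (m ∷ qs) (here refl) = mk m , here refl , there (here refl) , there (there (there (here refl)))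
        go (m ∷ qs) (there k) = let c , c∈ , e = go qs k in c , there c∈ , e

    half-cut : ∀ A {i a b} → a ∈ flat ps → b ∈ flat ps → lab a ≡ just i → lab b ≡ just i →
      A a ≡ true → A b ≡ false → 1 ≤ tot A half
    half-cut A {i} {a} {b} a∈ b∈ la lb pa pb = go (flat-∈⁻ {ps = ps} a∈) (flat-∈⁻ {ps = ps} b∈)
      where
      flp : ∀ {b c} → not b ≡ c → b ≡ not c
      flp {true} refl = refl
      flp {false} refl = refl
      go : (∃[ x ] (a , x) ∈ ps) ⊎ (∃[ y ] (y , a) ∈ ps) → (∃[ x ] (b , x) ∈ ps) ⊎ (∃[ y ] (y , b) ∈ ps) → 1 ≤ tot A half
      go (inj₁ (_ , h)) (inj₁ (_ , h')) =
        let P , P' , k , u , v = crossing (A ∘ proj₁) h h' pa pb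
            c , c∈ , m , _ = at k in tot-jump A c∈ m u v
      go (inj₂ (_ , h)) (inj₂ (_ , h')) =
        let P , P' , k , u , v = crossing (not ∘ A ∘ proj₂) h' h (cong not pb) (cong not pa)
            c , c∈ , _ , m = at k in tot-jump A c∈ m (flp v) (flp u)
      go (inj₁ (_ , h)) (inj₂ (_ , h')) =
        ⊥-elim (l≢p (just-injective (trans (sym (proj₁ (labs h))) (trans la (trans (sym lb) (proj₂ (labs h')))))))
      go (inj₂ (_ , h)) (inj₁ (_ , h')) =
        ⊥-elim (l≢p (just-injective (trans (sym (proj₁ (labs h'))) (trans lb (trans (sym la) (proj₂ (labs h)))))))

  alternating : ∀ (P₁ P₂ : E × E) (ps : List (E × E)) {l p} → Unique (flat (P₁ ∷ P₂ ∷ ps)) → l ≢ p →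
    (∀ {y x} → (y , x) ∈ P₁ ∷ P₂ ∷ ps → lab y ≡ just l × lab x ≡ just p) → Fam (ring (flat (P₁ ∷ P₂ ∷ ps)))
  alternating (y₁ , x₁) (y₂ , x₂) ps {l} {p} uq l≢p labs = record
    { F = H.half ++ map (Dicycle-≈ eqv) H'.half
    ; cover = cv
    ; cut = λ A i supp va vb la lb pa pb → subst (2 ≤_) (sym (trans (tot-++ A H.half) (cong (tot A H.half +_) (tot-map-≈ eqv A H'.half))))
        (+-mono-≤ (H.half-cut A va vb la lb pa pb) (H'.half-cut A (V← eqv va) (V← eqv vb) la lb pa pb)) }
    where
    qs qs' : List (E × E)
    qs = (y₁ , x₁) ∷ (y₂ , x₂) ∷ ps
    qs' = pair-up x₁ ((y₂ , x₂) ∷ ps) y₁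
    eqv : ring (flat qs') ≈ ring (flat qs)
    eqv = subst (λ w → ring w ≈ ring (flat qs)) (sym (pair-up-flat x₁ ((y₂ , x₂) ∷ ps) y₁))
            (rot-≈ (x₁ ∷ y₂ ∷ x₂ ∷ flat ps) (y₁ ∷ []))
    uq' : Unique (flat qs')
    uq' = subst Unique (sym (pair-up-flat x₁ ((y₂ , x₂) ∷ ps) y₁)) (unique-↭ (++-comm (y₁ ∷ []) _) uq)
    x₁∉ : x₁ ∉ y₂ ∷ x₂ ∷ flat ps
    x₁∉ = unique-∉ (unique-tail uq)
    labs' : ∀ {x y} → (x , y) ∈ qs' → lab x ≡ just p × lab y ≡ just l
    labs' = pair-up-all x₁ ((y₂ , x₂) ∷ ps) y₁ (proj₂ (labs (here refl))) (proj₁ (labs (here refl))) (labs ∘ there)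
    P₁≢P₂ : (y₁ , x₁) ≢ (y₂ , x₂)
    P₁≢P₂ refl = x₁∉ (there (here refl))
    P₁'≢P₂' : (x₁ , y₂) ≢ (x₂ , proj₁ (pair-up-head x₂ ps y₁))
    P₁'≢P₂' refl = x₁∉ (there (here refl))
    module H = Half {ps = qs} uq l≢p (here refl) (there (here refl)) P₁≢P₂ labs
    module H' = Half {ps = qs'} uq' (l≢p ∘ sym) (here refl) (there (proj₂ (pair-up-head x₂ ps y₁))) P₁'≢P₂' labs'
    none-map : ∀ {a k b} F → All (¬_ ∘ Hits a k b) F → All (¬_ ∘ Hits a k b) (map (Dicycle-≈ eqv) F)
    none-map [] [] = []
    none-map (d ∷ F) (n ∷ ns) = n ∷ none-map F ns
    class : ∀ {a b} → (a , b) ∈ cpairs (flat qs) → (a , b) ∈ qs ⊎ (a , b) ∈ qs'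
    class (here refl) = inj₁ (here refl)
    class (there h) with pair-up-links x₁ ((y₂ , x₂) ∷ ps) y₁ h
    ... | inj₁ k = inj₁ (there k)
    ... | inj₂ k = inj₂ k
    cv : ∀ d {a b} → Valid (ring (flat qs)) a (seg d) b → ExOne (Hits a (seg d) b) (H.half ++ map (Dicycle-≈ eqv) H'.half)
    cv fwd {a} {b} v = go (class v)
      where
      go : (a , b) ∈ qs ⊎ (a , b) ∈ qs' → ExOne (Hits a (seg fwd) b) (H.half ++ map (Dicycle-≈ eqv) H'.half)
      go (inj₁ k) = ExOne-++ˡ (H.once-fwd k) (none-map H'.half (H'.none-fwd (proj₁ (labs k))))
      go (inj₂ k) = ExOne-++ʳ (H.none-fwd (proj₁ (labs' k))) (ExOne-map (Dicycle-≈ eqv) (λ _ → id) (λ _ → id) (H'.once-fwd k))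
    cv bwd {a} {b} v = go (class v)
      where
      go : (b , a) ∈ qs ⊎ (b , a) ∈ qs' → ExOne (Hits a (seg bwd) b) (H.half ++ map (Dicycle-≈ eqv) H'.half)
      go (inj₁ k) = ExOne-++ˡ (H.once-bwd k) (none-map H'.half (H'.none-bwd (proj₂ (labs k))))
      go (inj₂ k) = ExOne-++ʳ (H.none-bwd (proj₂ (labs' k))) (ExOne-map (Dicycle-≈ eqv) (λ _ → id) (λ _ → id) (H'.once-bwd k))

  Jumps : (E → Bool) → List Edge → Set
  Jumps A C = ∃[ a ] ∃[ b ] ((a , jmp , b) ∈ C × A a ≡ true × A b ≡ false)

  ⊸-one : ∀ a b → 1 ≤ (a ⊸ b) → a ≡ true × b ≡ false
  ⊸-one true false _ = refl , refl
  ⊸-one true true ()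
  ⊸-one false _ ()

  wt-jumps : ∀ A C → 1 ≤ wt A C → Jumps A C
  wt-jumps A ((a , seg _ , b) ∷ C) h = let u , v , m , p = wt-jumps A C h in u , v , there m , p
  wt-jumps A ((a , jmp , b) ∷ C) h with A a in p | A b in q
  ... | true | false = a , b , here refl , p , q
  ... | true | true = let u , v , m , r = wt-jumps A C h in u , v , there m , r
  ... | false | _ = let u , v , m , r = wt-jumps A C h in u , v , there m , r

  module _ (A : E → Bool) {i : K} (supp : ∀ {a} → A a ≡ true → lab a ≡ just i) where

    wt-≤1 : ∀ {r C} → Cyc r C → wt A C ≤ 1
    wt-≤1 {C = C} cy = go C id (uniq cy)
      where
      none : ∀ {a} D → (∀ {e} → e ∈ D → e ∈ C) → Unique (a ∷ map src D) → A a ≡ true → (∃[ b ] (a , jmp , b) ∈ C) → wt A D ≤ 0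
      none {a} D sub u pa (b , h) with wt A D in eq
      ... | zero = z≤n
      ... | suc k with wt-jumps A D (subst (1 ≤_) (sym eq) (s≤s z≤n))
      ... | u' , v , m , p , _ = ⊥-elim (unique-∉ u (subst (_∈ map src D) (one cy (sub m) h (supp p) (supp pa)) (∈-map⁺ src m)))
      go : ∀ D → (∀ {e} → e ∈ D → e ∈ C) → Unique (map src D) → wt A D ≤ 1
      go [] _ _ = z≤n
      go ((a , seg _ , b) ∷ D) sub (_ ∷ u) = go D (sub ∘ there) u
      go ((a , jmp , b) ∷ D) sub u with A a in p | A b
      ... | false | _ = go D (sub ∘ there) (unique-tail u)
      ... | true | true = go D (sub ∘ there) (unique-tail u)
      ... | true | false = s≤s (none D (sub ∘ there) u p (b , sub (here refl)))

    tot-one : ∀ {r} (F : List (Dicycle r)) → 1 ≤ tot A F → ∃[ j ] Jumps A (black (lookup F j))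
    tot-one (d ∷ F) h with wt A (black d) in eq
    ... | suc k = zero , wt-jumps A (black d) (subst (1 ≤_) (sym eq) (s≤s z≤n))
    ... | zero = let j , p = tot-one F h in suc j , p

    tot-two : ∀ {r} (F : List (Dicycle r)) → 2 ≤ tot A F →
      ∃[ j ] ∃[ k ] (j ≢ k × Jumps A (black (lookup F j)) × Jumps A (black (lookup F k)))
    tot-two (d ∷ F) h with wt A (black d) in eq | wt-≤1 (cb d)
    ... | zero | _ = let j , k , n , p , q = tot-two F h in suc j , suc k , (λ e → n (suc-injective e)) , p , q
    ... | suc zero | _ = let k , q = tot-one F (s≤s⁻¹ h) in
          zero , suc k , (λ ()) , wt-jumps A (black d) (subst (1 ≤_) (sym eq) (s≤s z≤n)) , q
    ... | suc (suc _) | s≤s ()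

  -- Substituting blocks for letters

  module Filling (_≟_ : DecidableEquality E) (_≟ₖ_ : DecidableEquality K) where

    record Item : Set where
      field
        rep twin : E
        blk     : List E
        letter    : K

    concatBlocks : List Item → List E
    concatBlocks [] = []
    concatBlocks (it ∷ its) = Item.blk it ++ concatBlocks its

    reps : List Item → List E
    reps = map Item.rep

    Fits : List E → Item → Set
    Fits T it = let open Item it in
      rep ∈ blk × lab rep ≡ just letter × lab twin ≡ just letter × twin ∉ blk × Fam (ring (twin ∷ blk)) ×
      (∀ {a b i} → a ∈ T → a ∉ blk → b ∈ blk → lab a ≡ just i → lab b ≡ just i → i ≡ letter)

    reps⊆ : ∀ {T its} → All (Fits T) its → ∀ {a} → a ∈ reps its → a ∈ concatBlocks its
    reps⊆ ((r , _) ∷ fs) (here refl) = ∈-++⁺ˡ r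
    reps⊆ {its = it ∷ its} (_ ∷ fs) (there h) = ∈-++⁺ʳ (Item.blk it) (reps⊆ fs h)

    reps-unique : ∀ {T its} → All (Fits T) its → Unique (concatBlocks its) → Unique (reps its)
    reps-unique [] _ = []
    reps-unique {its = it ∷ its} ((r , _) ∷ fs) u =
      let _ , u₂ , d = unique-++⁻ (Item.blk it) u in
      All.tabulate (λ h e → d r (subst (_∈ concatBlocks its) (sym e) (reps⊆ fs h))) ∷ reps-unique fs u₂

    private
      insert : ∀ {q x z} u g → u ≢ [] → g ≢ [] → x ∉ u → z ∉ g → Unique (g ++ u) → lab x ≡ just q → lab z ≡ just q →
        (∀ {a b i} → a ∈ u → b ∈ g → lab a ≡ just i → lab b ≡ just i → i ≡ q) →
        Fam (ring (x ∷ u)) → Fam (ring (z ∷ g)) → Fam (ring (g ++ u))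
      insert [] _ n _ = ⊥-elim (n refl)
      insert (_ ∷ _) [] _ n = ⊥-elim (n refl)
      insert (_ ∷ _) (_ ∷ _) _ _ x∉ z∉ uq lx lz sh f f' = substitute _≟_ _≟ₖ_ (splice x∉ z∉ uq lx lz sh) f f'

    fill : ∀ D its → Unique (D ++ concatBlocks its) → All (Fits (D ++ concatBlocks its)) its → (D ≢ [] ⊎ 2 ≤ length its) →
           Fam (ring (D ++ reps its)) → Fam (ring (D ++ concatBlocks its))
    fill D [] u fs _ f = f
    fill D (it ∷ its) u ((r∈ , lr , lz , z∉ , fz , sh) ∷ fs) ne f =
      subst (λ l → Fam (ring l)) (++-assoc D blk (concatBlocks its))
        (fill (D ++ blk) its (subst Unique assoc u) (subst (λ l → All (Fits l) its) assoc fs) (inj₁ ne')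
          (subst (λ l → Fam (ring l)) (sym (++-assoc D blk (reps its)))
            (Fam-≈ (rot-≈ (blk ++ reps its) D)
              (subst (λ l → Fam (ring l)) (sym (++-assoc blk (reps its) D))
                (insert (reps its ++ D) blk u≢[] blk≢[] r∉ z∉ uq lr lz shared
                  (Fam-≈ (rot-≈ D (rep ∷ reps its)) f) fz)))))
      where
      open Item it
      assoc : D ++ blk ++ concatBlocks its ≡ (D ++ blk) ++ concatBlocks its
      assoc = sym (++-assoc D blk (concatBlocks its))
      nonempty : ∀ {a : E} {xs} → a ∈ xs → xs ≢ []
      nonempty () refl
      blk≢[] : blk ≢ []
      blk≢[] = nonempty r∈
      ne' : D ++ blk ≢ []
      ne' = nonempty (∈-++⁺ʳ D r∈)
      u≢[] : reps its ++ D ≢ []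
      u≢[] = go its D ne
        where
        go : ∀ its D → D ≢ [] ⊎ 2 ≤ length (it ∷ its) → reps its ++ D ≢ []
        go (_ ∷ _) D _ ()
        go [] D (inj₁ n) = n
        go [] D (inj₂ (s≤s ()))
      parts = unique-++⁻ D u
      uD = proj₁ parts
      partsB = unique-++⁻ blk (proj₁ (proj₂ parts))
      rest : ∀ {a} → a ∈ reps its ++ D → a ∈ concatBlocks its ⊎ a ∈ D
      rest h with ∈-++⁻ (reps its) h
      ... | inj₁ k = inj₁ (reps⊆ fs k)
      ... | inj₂ k = inj₂ k
      apart : ∀ {a} → a ∈ reps its ++ D → a ∉ blk
      apart h b with rest h
      ... | inj₁ k = proj₂ (proj₂ partsB) b k
      ... | inj₂ k = proj₂ (proj₂ parts) k (∈-++⁺ˡ b)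
      r∉ : rep ∉ reps its ++ D
      r∉ h = apart h r∈
      inT : ∀ {a} → a ∈ reps its ++ D → a ∈ D ++ blk ++ concatBlocks its
      inT h with rest h
      ... | inj₁ k = ∈-++⁺ʳ D (∈-++⁺ʳ blk k)
      ... | inj₂ k = ∈-++⁺ˡ k
      uq : Unique (blk ++ reps its ++ D)
      uq = unique-++ (proj₁ partsB)
        (unique-++ (reps-unique fs (proj₁ (proj₂ partsB))) uD
          (λ h k → proj₂ (proj₂ parts) k (∈-++⁺ʳ blk (reps⊆ fs h))))
        (λ b h → apart h b)
      shared : ∀ {a b i} → a ∈ reps its ++ D → b ∈ blk → lab a ≡ just i → lab b ≡ just i → i ≡ letter
      shared h = sh (inT h) (apart h)

    Lettered : E → Set
    Lettered a = ∃[ i ] lab a ≡ just i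

    lettered? : ∀ a → Dec (Lettered a)
    lettered? a with lab a
    ... | just i = yes (i , refl)
    ... | nothing = no λ ()

    private
      text : List (E × List E) → List E
      text [] = []
      text ((x , ns) ∷ ps) = (x ∷ ns) ++ text ps

      Plain : List E → Set
      Plain ns = ∀ {a} → a ∈ ns → ¬ Lettered a

      Ok : E × List E → Set
      Ok (x , ns) = Lettered x × Plain ns

      cut-up : ∀ v → ∃[ ns ] ∃[ ps ] (v ≡ ns ++ text ps × Plain ns × All Ok ps × filter lettered? v ≡ map proj₁ ps)
      cut-up [] = [] , [] , refl , (λ ()) , [] , refl
      cut-up (a ∷ v) = go (cut-up v) (lettered? a)
        where
        go : ∃[ ns ] ∃[ ps ] (v ≡ ns ++ text ps × Plain ns × All Ok ps × filter lettered? v ≡ map proj₁ ps) → Dec (Lettered a) →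
             ∃[ ns ] ∃[ ps ] (a ∷ v ≡ ns ++ text ps × Plain ns × All Ok ps × filter lettered? (a ∷ v) ≡ map proj₁ ps)
        go (ns , ps , e , pl , ok , f) (yes la) =
          [] , (a , ns) ∷ ps , cong (a ∷_) e , (λ ()) , (la , pl) ∷ ok , trans (filter-accept lettered? la) (cong (a ∷_) f)
        go (ns , ps , e , pl , ok , f) (no na) =
          a ∷ ns , ps , cong (a ∷_) e , (λ { (here refl) → na ; (there h) → pl h }) , ok , trans (filter-reject lettered? na) f

      append : ∀ ms ps → Plain ms → All Ok ps → ps ≢ [] →
        ∃[ qs ] (text qs ≡ text ps ++ ms × All Ok qs × map proj₁ qs ≡ map proj₁ ps)
      append ms [] _ _ ne = ⊥-elim (ne refl)
      append ms ((x , ns) ∷ []) pm ((lx , pn) ∷ []) _ = (x , ns ++ ms) ∷ [] ,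
        cong (x ∷_) (trans (++-identityʳ (ns ++ ms)) (cong (_++ ms) (sym (++-identityʳ ns)))) ,
        (lx , (λ h → both (∈-++⁻ ns h))) ∷ [] , refl
        where
        both : ∀ {a} → a ∈ ns ⊎ a ∈ ms → ¬ Lettered a
        both (inj₁ h) = pn h
        both (inj₂ h) = pm h
      append ms ((x , ns) ∷ p ∷ ps) pm (o ∷ os) _ with append ms (p ∷ ps) pm os (λ ())
      ... | qs , e , oq , f = (x , ns) ∷ qs , trans (cong ((x ∷ ns) ++_) e) (sym (++-assoc (x ∷ ns) (text (p ∷ ps)) ms)) ,
                              o ∷ oq , cong (x ∷_) f

    -- Unlettered elements are inserted by substituting the block x, n₁, …, nₖ for x.
    module _ (v : List E) (uq : Unique v)
             (mate : ∀ {a i} → a ∈ v → lab a ≡ just i → ∃[ b ] (b ≢ a × lab b ≡ just i)) where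
      private
        Placed : E × List E → Set
        Placed (x , ns) = Ok (x , ns) × x ∈ v × Unique (x ∷ ns)

        item : ∀ {p} → Placed p → Item
        item {x , ns} (((i , li) , _) , x∈ , _) =
          record { rep = x ; twin = proj₁ (mate x∈ li) ; blk = x ∷ ns ; letter = i }

        fits : ∀ {T p} (h : Placed p) → Fits T (item h)
        fits {T} {x , ns} (((i , li) , pl) , x∈ , u) =
          here refl , li , lz , z∉ , Chord.chordFam (All.tabulate (λ h e → z∉ (subst (_∈ x ∷ ns) (sym e) h)) ∷ u) lz li neutral ,
          λ { _ _ (here refl) _ lb → just-injective (trans (sym lb) li) ; _ _ (there h) _ lb → ⊥-elim (pl h (_ , lb)) }
          where
          z = proj₁ (mate x∈ li)
          lz = proj₂ (proj₂ (mate x∈ li))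
          z∉ : z ∉ x ∷ ns
          z∉ (here e) = proj₁ (proj₂ (mate x∈ li)) e
          z∉ (there h) = pl h (i , lz)
          neutral : ∀ {c} → c ∈ ns → lab c ≡ nothing
          neutral {c} h with lab c in eq
          ... | nothing = refl
          ... | just j = ⊥-elim (pl h (j , eq))

        items : ∀ {ps} → All Placed ps → List Item
        items = All.reduce item

        items-fit : ∀ {T ps} (hs : All Placed ps) → All (Fits T) (items hs)
        items-fit [] = []
        items-fit (h ∷ hs) = fits h ∷ items-fit hs

        items-text : ∀ {ps} (hs : All Placed ps) → concatBlocks (items hs) ≡ text ps
        items-text [] = refl
        items-text {(x , ns) ∷ ps} (h ∷ hs) = cong ((x ∷ ns) ++_) (items-text hs)

        items-reps : ∀ {ps} (hs : All Placed ps) → reps (items hs) ≡ map proj₁ ps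
        items-reps [] = refl
        items-reps {(x , ns) ∷ ps} (h ∷ hs) = cong (x ∷_) (items-reps hs)

        items-length : ∀ {ps} (hs : All Placed ps) → length (items hs) ≡ length (map proj₁ ps)
        items-length [] = refl
        items-length (h ∷ hs) = cong suc (items-length hs)

        place : ∀ ps → All Ok ps → Unique (text ps) → (∀ {a} → a ∈ text ps → a ∈ v) → All Placed ps
        place [] [] _ _ = []
        place ((x , ns) ∷ ps) (o ∷ os) u i =
          (o , i (here refl) , proj₁ parts) ∷ place ps os (proj₁ (proj₂ parts)) (i ∘ ∈-++⁺ʳ (x ∷ ns))
          where parts = unique-++⁻ (x ∷ ns) u

      insertPlain : 2 ≤ length (filter lettered? v) → Fam (ring (filter lettered? v)) → Fam (ring v)
      insertPlain two≤ f = go (cut-up v)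
        where
        go : ∃[ ns ] ∃[ ps ] (v ≡ ns ++ text ps × Plain ns × All Ok ps × filter lettered? v ≡ map proj₁ ps) → Fam (ring v)
        go (ns , ps , e , pl , ok , fe) = close (append ns ps pl ok (λ { refl → absurd (subst (λ l → 2 ≤ length l) fe two≤) }))
          where
          absurd : 2 ≤ 0 → ⊥
          absurd ()
          close : ∃[ qs ] (text qs ≡ text ps ++ ns × All Ok qs × map proj₁ qs ≡ map proj₁ ps) → Fam (ring v)
          close (qs , e' , oq , fq) = subst (λ l → Fam (ring l)) (sym e)
            (Fam-≈ (rot-≈ (text ps) ns) (subst (λ l → Fam (ring l)) (trans (items-text hs) e')
              (fill [] (items hs) (subst Unique (sym (items-text hs)) u) (items-fit hs)
                (inj₂ (subst (2 ≤_) (trans (cong length reps≡) (sym (trans (items-length hs) refl))) two≤))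
                (subst (λ l → Fam (ring l)) (trans reps≡ (sym (items-reps hs))) f))))
            where
            perm : v ↭ text qs
            perm = ↭trans (↭-reflexive e) (↭trans (++-comm ns (text ps)) (↭-reflexive (sym e')))
            u : Unique (text qs)
            u = unique-↭ perm uq
            reps≡ : filter lettered? v ≡ map proj₁ qs
            reps≡ = trans fe (sym fq)
            hs : All Placed qs
            hs = place qs oq u (∈-resp-↭ (↭-sym perm))

  -- Words whose overlap graph is a tree

  module Trees (_≟_ : DecidableEquality E) (_≟ₖ_ : DecidableEquality K)
               {R : K → K → Set} (R-sym : ∀ {i j} → R i j → R j i) (acyclic : ¬ CycleIn R) where
    open Filling _≟_ _≟ₖ_
    open Leaf _≟ₖ_ R-sym acyclic

    Occurs : List E → K → Set
    Occurs w i = ∃[ a ] (a ∈ w × lab a ≡ just i)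

    Pattern : List E → K → K → Set
    Pattern w i j = ∃[ a ] ∃[ b ] ∃[ c ] ∃[ d ]
      ((lab a ≡ just i × lab b ≡ just j × lab c ≡ just i × lab d ≡ just j) × a ∷ b ∷ c ∷ d ∷ [] ⊆ w)

    -- The cyclic pattern i j i j, cut open somewhere, reads i j i j or j i j i.
    Cross : List E → K → K → Set
    Cross w i j = Pattern w i j ⊎ Pattern w j i

    record TreeWord (w : List E) : Set where
      field
        nodup  : Unique w
        some  : ∃[ a ] a ∈ w
        lettered : ∀ {a} → a ∈ w → ∃[ i ] lab a ≡ just i
        two   : ∀ {a i} → a ∈ w → lab a ≡ just i → ∃[ b ] (b ∈ w × b ≢ a × lab b ≡ just i)
        conn  : ConnectedOn (Occurs w) R
        R→X   : ∀ {i j} → Occurs w i → Occurs w j → i ≢ j → R i j → Cross w i j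
        X→R   : ∀ {i j} → i ≢ j → Cross w i j → R i j

    pattern-rot : ∀ xs ys {i j} → Pattern (xs ++ ys) i j → Cross (ys ++ xs) i j
    pattern-rot xs ys (a , b , c , d , (la , lb , lc , ld) , s) with ⊆-split xs s
    ... | [] , _ , refl , p , q = inj₁ (a , b , c , d , (la , lb , lc , ld) , SubP.++⁺ q p)
    ... | _ ∷ [] , _ , refl , p , q = inj₂ (b , c , d , a , (lb , lc , ld , la) , SubP.++⁺ q p)
    ... | _ ∷ _ ∷ [] , _ , refl , p , q = inj₁ (c , d , a , b , (lc , ld , la , lb) , SubP.++⁺ q p)
    ... | _ ∷ _ ∷ _ ∷ [] , _ , refl , p , q = inj₂ (d , a , b , c , (ld , la , lb , lc) , SubP.++⁺ q p)
    ... | _ ∷ _ ∷ _ ∷ _ ∷ [] , [] , refl , p , q = inj₁ (a , b , c , d , (la , lb , lc , ld) , SubP.++⁺ q p)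

    cross-rot : ∀ xs ys {i j} → Cross (xs ++ ys) i j → Cross (ys ++ xs) i j
    cross-rot xs ys (inj₁ p) = pattern-rot xs ys p
    cross-rot xs ys (inj₂ p) = ⊎-swap (pattern-rot xs ys p)

    star-map : ∀ {P Q : K → Set} → (∀ {i} → P i → Q i) → ∀ {x y} →
               Star (λ a b → P a × P b × R a b) x y → Star (λ a b → Q a × Q b × R a b) x y
    star-map f = StarP.map λ (p , q , r) → f p , f q , r

    star-sym : ∀ {P : K → Set} {x y} → Star (λ a b → P a × P b × R a b) x y → Star (λ a b → P a × P b × R a b) y x
    star-sym = StarP.reverse λ (p , q , r) → q , p , R-sym r

    tree-rot : ∀ xs ys → TreeWord (xs ++ ys) → TreeWord (ys ++ xs)
    tree-rot xs ys t = record
      { nodup = unique-↭ (++-comm xs ys) (TreeWord.nodup t)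
      ; some = let a , h = some in a , ∈-swap xs h
      ; lettered = λ h → lettered (∈-swap ys h)
      ; two = λ h l → let b , k , n , e = two (∈-swap ys h) l in b , ∈-swap xs k , n , e
      ; conn = λ i j p q → star-map there' (conn i j (back p) (back q))
      ; R→X = λ p q n r → cross-rot xs ys (R→X (back p) (back q) n r)
      ; X→R = λ n x → X→R n (cross-rot ys xs x) }
      where
      open TreeWord t
      back : ∀ {i} → Occurs (ys ++ xs) i → Occurs (xs ++ ys) i
      back (a , h , l) = a , ∈-swap ys h , l
      there' : ∀ {i} → Occurs (xs ++ ys) i → Occurs (ys ++ xs) i
      there' (a , h , l) = a , ∈-swap xs h , l

    letters : List E → List K
    letters w = deduplicate _≟ₖ_ (mapMaybe lab w)

    mapMaybe-∈⁺ : ∀ {w a i} → a ∈ w → lab a ≡ just i → i ∈ mapMaybe lab w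
    mapMaybe-∈⁺ {a ∷ w} (here refl) l with lab a
    mapMaybe-∈⁺ {a ∷ w} (here refl) refl | just i = here refl
    mapMaybe-∈⁺ {b ∷ w} (there h) l with lab b
    ... | just _ = there (mapMaybe-∈⁺ h l)
    ... | nothing = mapMaybe-∈⁺ h l

    mapMaybe-∈⁻ : ∀ w {i} → i ∈ mapMaybe lab w → Occurs w i
    mapMaybe-∈⁻ (a ∷ w) h with lab a in eq
    mapMaybe-∈⁻ (a ∷ w) (here refl) | just i = a , here refl , eq
    mapMaybe-∈⁻ (a ∷ w) (there h) | just i = let b , k , l = mapMaybe-∈⁻ w h in b , there k , l
    mapMaybe-∈⁻ (a ∷ w) h | nothing = let b , k , l = mapMaybe-∈⁻ w h in b , there k , l

    letters⁺ : ∀ {w i} → Occurs w i → i ∈ letters w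
    letters⁺ (a , h , l) = ∈-deduplicate⁺ _≟ₖ_ (mapMaybe-∈⁺ h l)

    letters⁻ : ∀ {w i} → i ∈ letters w → Occurs w i
    letters⁻ {w} h = mapMaybe-∈⁻ w (∈-deduplicate⁻ _≟ₖ_ (mapMaybe lab w) h)

    letters-unique : ∀ w → Unique (letters w)
    letters-unique w = deduplicate-! (mapMaybe lab w)
      where open import Data.List.Relation.Unary.Unique.DecPropositional.Properties _≟ₖ_ using (deduplicate-!)

    record Block : Set where
      field
        y x   : E
        ys xs : List E
      ytext gtext : List E
      ytext = y ∷ ys
      gtext = x ∷ xs
    open Block

    glue : List Block → List E
    glue [] = []
    glue (b ∷ bs) = ytext b ++ gtext b ++ glue bs

    glue-++ : ∀ as bs → glue (as ++ bs) ≡ glue as ++ glue bs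
    glue-++ [] bs = refl
    glue-++ (a ∷ as) bs = trans (cong (λ v → ytext a ++ gtext a ++ v) (glue-++ as bs))
      (trans (cong (ytext a ++_) (sym (++-assoc (gtext a) (glue as) (glue bs)))) (sym (++-assoc (ytext a) (gtext a ++ glue as) (glue bs))))

    Alternates : K → Block → Set
    Alternates l b = (∀ {a} → a ∈ ytext b → lab a ≡ just l) × (∀ {a} → a ∈ gtext b → lab a ≢ just l)

    parse : ∀ l v {e} → lab e ≢ just l → ∃[ g ] ∃[ bs ]
      (v ++ e ∷ [] ≡ g ++ glue bs × (∀ {a} → a ∈ g → lab a ≢ just l) × All (Alternates l) bs × (g ≢ [] ⊎ bs ≢ []))
    parse l [] {e} n = e ∷ [] , [] , refl , (λ { (here refl) → n }) , [] , inj₁ λ ()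
    parse l (a ∷ v) n with parse l v n | ≡-dec _≟ₖ_ (lab a) (just l)
    ... | g , bs , eq , ng , ab , _ | no na = a ∷ g , bs , cong (a ∷_) eq , (λ { (here refl) → na ; (there h) → ng h }) , ab , inj₁ λ ()
    ... | [] , [] , _ , _ , _ , inj₁ ne | yes _ = ⊥-elim (ne refl)
    ... | [] , [] , _ , _ , _ , inj₂ ne | yes _ = ⊥-elim (ne refl)
    ... | [] , b ∷ bs , eq , ng , (yb , gb) ∷ ab , _ | yes ya =
      [] , record { y = a ; ys = ytext b ; x = x b ; xs = xs b } ∷ bs , cong (a ∷_) eq , (λ ()) ,
      ((λ { (here refl) → ya ; (there h) → yb h }) , gb) ∷ ab , inj₂ λ ()
    ... | c ∷ g , bs , eq , ng , ab , _ | yes ya =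
      [] , record { y = a ; ys = [] ; x = c ; xs = g } ∷ bs , cong (a ∷_) eq , (λ ()) ,
      ((λ { (here refl) → ya }) , ng) ∷ ab , inj₂ λ ()

    absorb : ∀ l g bs → bs ≢ [] → (∀ {a} → a ∈ g → lab a ≢ just l) → All (Alternates l) bs →
      ∃[ bs' ] (glue bs' ≡ glue bs ++ g × All (Alternates l) bs')
    absorb l g [] ne _ _ = ⊥-elim (ne refl)
    absorb l g (b ∷ []) _ ng ((yb , gb) ∷ []) = record { y = y b ; ys = ys b ; x = x b ; xs = xs b ++ g } ∷ [] ,
      (let e : gtext b ++ g ≡ (gtext b ++ []) ++ g
           e = cong (_++ g) (sym (++-identityʳ (gtext b))) in
       trans (cong (ytext b ++_) (trans (++-identityʳ (gtext b ++ g)) e)) (sym (++-assoc (ytext b) (gtext b ++ []) g))) ,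
      (yb , λ h → both (∈-++⁻ (gtext b) h)) ∷ []
      where
      both : ∀ {a} → a ∈ gtext b ⊎ a ∈ g → lab a ≢ just l
      both (inj₁ h) = gb h
      both (inj₂ h) = ng h
    absorb l g (b ∷ b' ∷ bs) _ ng (ab ∷ abs) with absorb l g (b' ∷ bs) (λ ()) ng abs
    ... | bs' , eq , ok = b ∷ bs' ,
      trans (cong (λ v → ytext b ++ gtext b ++ v) eq)
        (trans (cong (ytext b ++_) (sym (++-assoc (gtext b) (glue (b' ∷ bs)) g))) (sym (++-assoc (ytext b) (gtext b ++ glue (b' ∷ bs)) g))) ,
      ab ∷ ok


    module Blocks (bs : List Block) (t : TreeWord (glue bs)) (lf : LeafOf (letters (glue bs)))
                  (ok : All (Alternates (LeafOf.l lf)) bs) where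
      open TreeWord t
      open LeafOf lf using (l; p; l≢p; lp)

      w : List E
      w = glue bs

      only : ∀ {m} → Occurs w m → m ≢ l → R m l → m ≡ p
      only o = LeafOf.only lf (letters⁺ o)

      occ-l : Occurs w l
      occ-l = letters⁻ (LeafOf.l∈ lf)
      occ-p : Occurs w p
      occ-p = letters⁻ (LeafOf.p∈ lf)

      same-letter : ∀ {a i j} → lab a ≡ just i → lab a ≡ just j → i ≡ j
      same-letter q r = just-injective (trans (sym q) r)

      mark : ∀ {cs a} → All (Alternates l) cs → a ∈ glue cs → lab a ≢ just l → ∃[ y' ] (lab y' ≡ just l × y' ∷ a ∷ [] ⊆ glue cs)
      mark {c ∷ cs} {a} ((yl , _) ∷ oks) h n with ∈-++⁻ (ytext c) h
      ... | inj₁ k = ⊥-elim (n (yl k))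
      ... | inj₂ k with ∈-++⁻ (gtext c) k
      ... | inj₁ k' = y c , yl (here refl) , refl ∷ SubP.++⁺ˡ (ys c) (SubP.++⁺ʳ (glue cs) (from∈ k'))
      ... | inj₂ k' = let y' , ly , s = mark oks k' n in y' , ly , SubP.++⁺ˡ (ytext c) (SubP.++⁺ˡ (gtext c) s)

      module At (as : List Block) (b : Block) (cs : List Block) (eq : bs ≡ as ++ b ∷ cs) where

        g : List E
        g = gtext b

        okb : Alternates l b
        okb = All.lookup ok (subst (b ∈_) (sym eq) (∈-++⁺ʳ as (here refl)))

        oka : All (Alternates l) as
        oka = All.tabulate λ h → All.lookup ok (subst (_ ∈_) (sym eq) (∈-++⁺ˡ h))

        okc : All (Alternates l) cs
        okc = All.tabulate λ h → All.lookup ok (subst (_ ∈_) (sym eq) (∈-++⁺ʳ as (there h)))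

        eqw : w ≡ glue as ++ ytext b ++ g ++ glue cs
        eqw = trans (cong glue eq) (glue-++ as (b ∷ cs))

        eqw' : w ≡ (glue as ++ ytext b) ++ g ++ glue cs
        eqw' = trans eqw (sym (++-assoc (glue as) (ytext b) (g ++ glue cs)))

        g⊆w : g ⊆ w
        g⊆w = subst (g ⊆_) (sym eqw') (SubP.++⁺ˡ (glue as ++ ytext b) (SubP.++⁺ʳ (glue cs) ⊆-refl))

        g∈w : ∀ {a} → a ∈ g → a ∈ w
        g∈w = ⊆-∈ g⊆w

        private
          u₁ = unique-++⁻ (glue as ++ ytext b) (subst Unique eqw' nodup)
          u₂ = unique-++⁻ g (proj₁ (proj₂ u₁))

        g-uniq : Unique g
        g-uniq = proj₁ u₂

        g∉pre : ∀ {a} → a ∈ g → a ∉ glue as ++ ytext b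
        g∉pre h k = proj₂ (proj₂ u₁) k (∈-++⁺ˡ h)

        g∉post : ∀ {a} → a ∈ g → a ∉ glue cs
        g∉post h k = proj₂ (proj₂ u₂) h k

        within : ∀ {a z} ys → a ∈ g → z ∈ g → a ∷ ys ++ z ∷ [] ⊆ w → a ∷ ys ++ z ∷ [] ⊆ g
        within ys a∈ z∈ s = ⊆-dropʳ (_ ∷ ys) g (g∉post z∈) (⊆-dropˡ (glue as ++ ytext b) (g∉pre a∈) (subst (_ ⊆_) eqw' s))

        -- Letters other than l and p do not alternate with l, so they stay within one gap of l.
        confine : ∀ {m a a'} → m ≢ l → m ≢ p → a ∈ g → lab a ≡ just m → a' ∈ w → lab a' ≡ just m → a' ∈ g
        confine {m} {a} {a'} m≢l m≢p a∈ la a'∈ la' with ∈-++⁻ (glue as) (subst (a' ∈_) eqw a'∈)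
        ... | inj₁ k = ⊥-elim (m≢p (only (_ , g∈w a∈ , la) m≢l (R-sym (X→R (m≢l ∘ sym) (inj₁ before)))))
          where
          before : Pattern w l m
          before = let y' , ly , s = mark oka k (λ e → m≢l (same-letter la' e)) in
            y' , a' , y b , a , (ly , la' , proj₁ okb (here refl) , la) ,
            subst (y' ∷ a' ∷ y b ∷ a ∷ [] ⊆_) (sym eqw) (SubP.++⁺ s (refl ∷ SubP.++⁺ˡ (ys b) (SubP.++⁺ʳ (glue cs) (from∈ a∈))))
        ... | inj₂ k with ∈-++⁻ (ytext b) k
        ... | inj₁ k' = ⊥-elim (m≢l (same-letter la' (proj₁ okb k')))
        ... | inj₂ k' with ∈-++⁻ g k'
        ... | inj₁ k'' = k''
        ... | inj₂ k'' = ⊥-elim (m≢p (only (_ , g∈w a∈ , la) m≢l (R-sym (X→R (m≢l ∘ sym) (inj₁ after)))))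
          where
          after : Pattern w l m
          after = let y' , ly , s = mark okc k'' (λ e → m≢l (same-letter la' e)) in
            y b , a , y' , a' , (proj₁ okb (here refl) , la , ly , la') ,
            subst (y b ∷ a ∷ y' ∷ a' ∷ [] ⊆_) (sym eqw) (SubP.++⁺ˡ (glue as) (refl ∷ SubP.++⁺ˡ (ys b) (SubP.++⁺ (from∈ a∈) s)))

        OccG : K → Set
        OccG i = ∃[ a ] (a ∈ g × lab a ≡ just i)

        g≢l : ∀ {m} → OccG m → m ≢ l
        g≢l (a , h , la) refl = proj₂ okb h la

        triple : ∀ {m j} → OccG m → m ≢ p → Cross w m j →
          ∃[ a ] ∃[ c ] ∃[ a' ] (lab a ≡ just m × lab c ≡ just j × lab a' ≡ just m × a ∷ c ∷ a' ∷ [] ⊆ g)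
        triple og@(a₀ , h₀ , l₀) m≢p (inj₁ (a , b' , c , d , (la , lb , lc , ld) , s)) =
          a , b' , c , la , lb , lc ,
          within (b' ∷ []) (confine (g≢l og) m≢p h₀ l₀ (⊆-∈ s (here refl)) la)
                 (confine (g≢l og) m≢p h₀ l₀ (⊆-∈ s (there (there (here refl)))) lc)
                 (⊆-trans (refl ∷ refl ∷ refl ∷ d ∷ʳ []) s)
        triple og@(a₀ , h₀ , l₀) m≢p (inj₂ (a , b' , c , d , (la , lb , lc , ld) , s)) =
          b' , c , d , lb , lc , ld ,
          within (c ∷ []) (confine (g≢l og) m≢p h₀ l₀ (⊆-∈ s (there (here refl))) lb)
                 (confine (g≢l og) m≢p h₀ l₀ (⊆-∈ s (there (there (there (here refl))))) ld)
                 (⊆-trans (a ∷ʳ refl ∷ refl ∷ refl ∷ []) s)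

        step : ∀ {m j} → OccG m → m ≢ p → Occurs w j → R m j → OccG j
        step {m} {j} og@(a , h , la) m≢p oj r with m ≟ₖ j
        ... | yes refl = og
        ... | no m≢j = let _ , c , _ , _ , lc , _ , s = triple og m≢p (R→X (a , g∈w h , la) oj m≢j r) in
                       c , ⊆-∈ s (there (here refl)) , lc

        reach : ∀ {m} → OccG m → Star (λ a b → (a ∈ letters w × a ≢ l) × (b ∈ letters w × b ≢ l) × R a b) m p →
                OccG p × Star (λ a b → OccG a × OccG b × R a b) m p
        reach og ε = og , ε
        reach {m} og (_◅_ {j = j} (_ , (j∈ , _) , r) s) with m ≟ₖ p
        ... | yes refl = og , ε
        ... | no m≢p = let oj = step og m≢p (letters⁻ j∈) r ; op , s' = reach oj s in op , (og , oj , r) ◅ s'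

        toP : ∀ {m} → OccG m → OccG p × Star (λ a b → OccG a × OccG b × R a b) m p
        toP {m} og@(a , h , la) = reach og (LeafOf.conn lf m p (letters⁺ (a , g∈w h , la) , g≢l og) (LeafOf.p∈ lf , l≢p ∘ sym))

        occP : OccG p
        occP = let i , li = lettered (g∈w (here refl)) in proj₁ (toP (x b , here refl , li))

        module Gap (z : E) (z∈ : z ∈ w) (z∉g : z ∉ g) (lz : lab z ≡ just p) where

          upTo : ∀ {i} → Occurs (z ∷ g) i → i ≢ p → OccG i
          upTo (_ , here refl , li) n = ⊥-elim (n (same-letter li lz))
          upTo (a , there h , li) n = a , h , li

          inW : ∀ {i} → Occurs (z ∷ g) i → Occurs w i
          inW (_ , here refl , li) = z , z∈ , li
          inW (a , there h , li) = a , g∈w h , li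

          lift : ∀ {i} → OccG i → Occurs (z ∷ g) i
          lift (a , h , li) = a , there h , li

          wayP : ∀ {i} → Occurs (z ∷ g) i → Star (λ a b → Occurs (z ∷ g) a × Occurs (z ∷ g) b × R a b) i p
          wayP (_ , here refl , li) with same-letter li lz
          ... | refl = ε
          wayP (a , there h , li) = star-map lift (proj₂ (toP (a , h , li)))

          crossP : ∀ {j} → OccG j → j ≢ p → Cross w j p → Pattern (z ∷ g) p j
          crossP oj n x = let a , c , a' , la , lc , la' , s = triple oj n x in
            z , a , c , a' , (lz , la , lc , la') , refl ∷ s

          quadruple : ∀ {i j} → OccG i → i ≢ p → OccG j → j ≢ p → Pattern w i j → Pattern (z ∷ g) i j
          quadruple oi@(a₀ , h₀ , l₀) ni oj@(b₀ , k₀ , m₀) nj (a , b' , c , d , (la , lb , lc , ld) , s) =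
            a , b' , c , d , (la , lb , lc , ld) ,
            z ∷ʳ within (b' ∷ c ∷ []) (confine (g≢l oi) ni h₀ l₀ (⊆-∈ s (here refl)) la)
                        (confine (g≢l oj) nj k₀ m₀ (⊆-∈ s (there (there (there (here refl))))) ld) s

          pattern→ : ∀ {i j} → Pattern (z ∷ g) i j → Cross w i j
          pattern→ (a , b' , c , d , ls , _ ∷ʳ s) = inj₁ (a , b' , c , d , ls , ⊆-trans s g⊆w)
          pattern→ (a , b' , c , d , (la , lb , lc , ld) , refl ∷ s) with ∈-++⁻ (glue as ++ ytext b) (subst (z ∈_) eqw' z∈)
          ... | inj₁ k = inj₁ (a , b' , c , d , (la , lb , lc , ld) , subst (_ ⊆_) (sym eqw') (SubP.++⁺ (from∈ k) (SubP.++⁺ʳ (glue cs) s)))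
          ... | inj₂ k with ∈-++⁻ g k
          ... | inj₁ k' = ⊥-elim (z∉g k')
          ... | inj₂ k' = inj₂ (b' , c , d , a , (lb , lc , ld , la) ,
                                subst (_ ⊆_) (sym eqw') (SubP.++⁺ˡ (glue as ++ ytext b) (SubP.++⁺ s (from∈ k'))))

          subTree : TreeWord (z ∷ g)
          subTree = record
            { nodup = All.tabulate (λ h e → z∉g (subst (_∈ g) (sym e) h)) ∷ g-uniq
            ; some = z , here refl
            ; lettered = λ { (here refl) → p , lz ; (there h) → lettered (g∈w h) }
            ; two = two'
            ; conn = λ i j oi oj → wayP oi ◅◅ star-sym (wayP oj)
            ; R→X = r→x
            ; X→R = λ { n (inj₁ q) → X→R n (pattern→ q) ; n (inj₂ q) → X→R n (⊎-swap (pattern→ q)) } }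
            where
            two' : ∀ {a i} → a ∈ z ∷ g → lab a ≡ just i → ∃[ b ] (b ∈ z ∷ g × b ≢ a × lab b ≡ just i)
            two' (here refl) li with same-letter li lz | occP
            ... | refl | a , h , la = a , there h , (λ { refl → z∉g h }) , la
            two' {a} {i} (there h) li with i ≟ₖ p
            ... | yes refl = z , here refl , (λ { refl → z∉g h }) , lz
            ... | no n = let b' , k , ne , lb = two (g∈w h) li in
                         b' , there (confine (g≢l (a , h , li)) n h li k lb) , ne , lb
            r→x : ∀ {i j} → Occurs (z ∷ g) i → Occurs (z ∷ g) j → i ≢ j → R i j → Cross (z ∷ g) i j
            r→x {i} {j} oi oj n r with i ≟ₖ p | j ≟ₖ p
            ... | yes refl | yes refl = ⊥-elim (n refl)
            ... | yes refl | no nj = inj₁ (crossP (upTo oj nj) nj (⊎-swap (R→X (inW oi) (inW oj) n r)))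
            ... | no ni | yes refl = inj₂ (crossP (upTo oi ni) ni (R→X (inW oi) (inW oj) n r))
            ... | no ni | no nj with R→X (inW oi) (inW oj) n r
            ... | inj₁ q = inj₁ (quadruple (upTo oi ni) ni (upTo oj nj) nj q)
            ... | inj₂ q = inj₂ (quadruple (upTo oj nj) nj (upTo oi ni) ni q)


    private
      no-single : ∀ {l p} b → Alternates l b → l ≢ p → Cross (glue (b ∷ [])) l p → ⊥
      no-single {l} {p} b (yl , gl) l≢p x = go x
        where
        w≡ : glue (b ∷ []) ≡ ytext b ++ gtext b
        w≡ = cong (ytext b ++_) (++-identityʳ (gtext b))
        clash : ∀ {u v} → lab u ≡ just p → lab v ≡ just l → u ∷ v ∷ [] ⊆ glue (b ∷ []) → ⊥
        clash {u} {v} lu lv s = gl (⊆-∈ (⊆-dropˡ (ytext b) (λ h → l≢p (just-injective (trans (sym (yl h)) lu)))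
          (subst (u ∷ v ∷ [] ⊆_) w≡ s)) (there (here refl))) lv
        go : Cross (glue (b ∷ [])) l p → ⊥
        go (inj₁ (a , c , d , e , (_ , lc , ld , _) , s)) = clash lc ld (⊆-trans (a ∷ʳ refl ∷ refl ∷ e ∷ʳ []) s)
        go (inj₂ (a , c , d , e , (la , lc , _) , s)) = clash la lc (⊆-trans (refl ∷ refl ∷ d ∷ʳ e ∷ʳ []) s)

    module Assemble (bs : List Block) (t : TreeWord (glue bs)) (lf : LeafOf (letters (glue bs)))
                    (ok : All (Alternates (LeafOf.l lf)) bs)
                    (IH : ∀ v → length v < length (glue bs) → TreeWord v → Fam (ring v)) where
      open Blocks bs t lf ok
      open TreeWord t
      open LeafOf lf using (l; p; l≢p; lp)

      private
        Plan : Block → Set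
        Plan b = ∃[ i ] ∃[ j ] (Fits w i × Fits w j × Item.blk i ≡ ytext b × Item.blk j ≡ gtext b ×
                   Item.letter i ≡ l × Item.letter j ≡ p)

        module Make (as : List Block) (b : Block) (cs : List Block) (eq : bs ≡ as ++ b ∷ cs) where
          open At as b cs eq

          Elsewhere : E → Set
          Elsewhere z = z ∈ glue as ⊎ z ∈ glue cs

          private
            u₁ = unique-++⁻ (glue as) (subst Unique eqw nodup)
            u₂ = unique-++⁻ (ytext b) (proj₁ (proj₂ u₁))

          notY : ∀ {z} → Elsewhere z → z ∉ ytext b
          notY (inj₁ h) k = proj₂ (proj₂ u₁) h (∈-++⁺ˡ k)
          notY (inj₂ h) k = proj₂ (proj₂ u₂) k (∈-++⁺ʳ g h)

          notG : ∀ {z} → Elsewhere z → z ∉ g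
          notG (inj₁ h) k = g∉pre k (∈-++⁺ˡ h)
          notG (inj₂ h) k = g∉post k h

          inW : ∀ {z} → Elsewhere z → z ∈ w
          inW (inj₁ h) = subst (_ ∈_) (sym eqw) (∈-++⁺ˡ h)
          inW (inj₂ h) = subst (_ ∈_) (sym eqw) (∈-++⁺ʳ (glue as) (∈-++⁺ʳ (ytext b) (∈-++⁺ʳ g h)))

          shorter : ∀ {z} → Elsewhere z → length (z ∷ g) < length w
          shorter {z} e = subst (length (z ∷ g) <_) (sym len) (go e)
            where
            len : length w ≡ length (glue as) + (suc (length (ys b)) + (length g + length (glue cs)))
            len = trans (cong length eqw) (trans (length-++ (glue as)) (cong (length (glue as) +_)
                    (trans (length-++ (ytext b)) (cong (suc (length (ys b)) +_) (length-++ g)))))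
            m : ℕ
            m = length g
            go : Elsewhere z → suc (suc m) ≤ length (glue as) + (suc (length (ys b)) + (m + length (glue cs)))
            go (inj₁ h) = +-mono-≤ (∈-length h) (s≤s (≤-trans (m≤m+n m _) (m≤n+m _ (length (ys b)))))
            go (inj₂ h) = ≤-trans (s≤s (≤-trans (≤-trans (≤-reflexive (+-comm 1 m)) (+-monoʳ-≤ m (∈-length h))) (m≤n+m _ (length (ys b)))))
                                  (m≤n+m _ (length (glue as)))

          plan : ∀ {z zy} → Elsewhere z → lab z ≡ just p → Elsewhere zy → lab zy ≡ just l → Plan b
          plan {z} {zy} ez lz ezy lzy with occP
          ... | x' , x'∈ , lx' = record { rep = y b ; twin = zy ; blk = ytext b ; letter = l } ,
            record { rep = x' ; twin = z ; blk = g ; letter = p } ,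
            (here refl , proj₁ okb (here refl) , lzy , notY ezy ,
              Single.singleFam {w = zy ∷ ytext b} {l} (All.tabulate (λ h e → notY ezy (subst (_∈ ytext b) (sym e) h)) ∷ proj₁ u₂)
                (here refl) (there (here refl)) (λ e → notY ezy (here e)) (λ { (here refl) → lzy ; (there h) → proj₁ okb h }) ,
              (λ _ _ h _ li → same-letter li (proj₁ okb h))) ,
            (x'∈ , lx' , lz , notG ez , IH (z ∷ g) (shorter ez) (Gap.subTree z (inW ez) (notG ez) lz) , shared') ,
            refl , refl , refl , refl
            where
            shared' : ∀ {a c i} → a ∈ w → a ∉ g → c ∈ g → lab a ≡ just i → lab c ≡ just i → i ≡ p
            shared' {i = i} a∈ a∉ c∈ la lc with i ≟ₖ p
            ... | yes e = e
            ... | no n = ⊥-elim (a∉ (confine (g≢l (_ , c∈ , lc)) n c∈ lc a∈ la))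

        plans : 2 ≤ length bs → ∀ as b cs → bs ≡ as ++ b ∷ cs → Plan b
        plans _ (a ∷ as) b cs eq = Make.plan (a ∷ as) b cs eq
          (inj₁ (∈-++⁺ʳ (ytext a) (∈-++⁺ˡ pz∈))) plz (inj₁ (here refl)) (proj₁ O.okb (here refl))
          where
          module O = At [] a (as ++ b ∷ cs) eq
          pz∈ = proj₁ (proj₂ O.occP)
          plz = proj₂ (proj₂ O.occP)
        plans _ [] b (c ∷ cs) eq = Make.plan [] b (c ∷ cs) eq
          (inj₂ (∈-++⁺ʳ (ytext c) (∈-++⁺ˡ pz∈))) plz (inj₂ (here refl)) (proj₁ O.okb (here refl))
          where
          module O = At (b ∷ []) c cs eq
          pz∈ = proj₁ (proj₂ O.occP)
          plz = proj₂ (proj₂ O.occP)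
        plans two≤ [] b [] eq = ⊥-elim (bad (subst (λ v → 2 ≤ length v) eq two≤))
          where
          bad : 2 ≤ 1 → ⊥
          bad (s≤s ())

        allPlans : 2 ≤ length bs → All Plan bs
        allPlans two≤ = All.tabulate λ h → let as , cs , eq = ∈-∃++ h in plans two≤ as _ cs eq

        items : ∀ {cs} → All Plan cs → List Item
        items [] = []
        items ((i , j , _) ∷ ps) = i ∷ j ∷ items ps

        pairs : ∀ {cs} → All Plan cs → List (E × E)
        pairs [] = []
        pairs ((i , j , _) ∷ ps) = (Item.rep i , Item.rep j) ∷ pairs ps

        items-fit : ∀ {cs} (ps : All Plan cs) → All (Fits w) (items ps)
        items-fit [] = []
        items-fit ((i , j , f , f' , _) ∷ ps) = f ∷ f' ∷ items-fit ps

        items-text : ∀ {cs} (ps : All Plan cs) → concatBlocks (items ps) ≡ glue cs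
        items-text [] = refl
        items-text {c ∷ cs} ((i , j , _ , _ , refl , refl , _) ∷ ps) = cong (λ v → ytext c ++ gtext c ++ v) (items-text ps)

        items-reps : ∀ {cs} (ps : All Plan cs) → reps (items ps) ≡ flat (pairs ps)
        items-reps [] = refl
        items-reps ((i , j , _) ∷ ps) = cong (λ v → Item.rep i ∷ Item.rep j ∷ v) (items-reps ps)

        pairs-lab : ∀ {cs} (ps : All Plan cs) {u v} → (u , v) ∈ pairs ps → lab u ≡ just l × lab v ≡ just p
        pairs-lab ((i , j , f , f' , _ , _ , refl , refl) ∷ ps) (here refl) = proj₁ (proj₂ f) , proj₁ (proj₂ f')
        pairs-lab (_ ∷ ps) (there h) = pairs-lab ps h

        long : ∀ cs → bs ≡ cs → 2 ≤ length cs
        long [] refl with proj₂ some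
        ... | ()
        long (b ∷ []) refl = ⊥-elim (no-single b (All.head ok) l≢p (R→X occ-l occ-p l≢p lp))
        long (_ ∷ _ ∷ _) _ = s≤s (s≤s z≤n)

        seed : ∀ {cs} (ps : All Plan cs) → 2 ≤ length cs → Unique (reps (items ps)) → Fam (ring (reps (items ps)))
        seed (P₁ ∷ P₂ ∷ ps) _ u = subst (λ v → Fam (ring v)) (sym (items-reps (P₁ ∷ P₂ ∷ ps)))
          (alternating _ _ (pairs ps) (subst Unique (items-reps (P₁ ∷ P₂ ∷ ps)) u) l≢p (pairs-lab (P₁ ∷ P₂ ∷ ps)))
        seed (_ ∷ []) (s≤s ()) _
        seed [] ()

        long-items : ∀ {cs} (ps : All Plan cs) → 2 ≤ length cs → 2 ≤ length (items ps)
        long-items (_ ∷ _) _ = s≤s (s≤s z≤n)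

      assembled : Fam (ring w)
      assembled = subst (λ v → Fam (ring v)) (items-text ps)
        (fill [] (items ps) u (subst (λ v → All (Fits v) (items ps)) (sym (items-text ps)) (items-fit ps))
          (inj₂ (long-items ps two≤)) (seed ps two≤ (reps-unique (items-fit ps) u)))
        where
        two≤ = long bs refl
        ps = allPlans two≤
        u : Unique (concatBlocks (items ps))
        u = subst Unique (sym (items-text ps)) nodup

    treeFam : ∀ n w → length w ≤ n → TreeWord w → Fam (ring w)
    treeFam zero [] _ t with proj₂ (TreeWord.some t)
    ... | ()
    treeFam (suc n) w len t = go (All.all? (λ a → ≡-dec _≟ₖ_ (lab a) (just i₀)) w)
      where
      open TreeWord t
      a₀ = proj₁ some
      a₀∈ = proj₂ some
      i₀ = proj₁ (lettered a₀∈)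
      l₀ : lab a₀ ≡ just i₀
      l₀ = proj₂ (lettered a₀∈)
      several : ∀ {a} → a ∈ w → lab a ≢ just i₀ → Fam (ring w)
      several {a} a∈ la = rotate (∈-∃++ x₀∈)
        where
        i₁ = proj₁ (lettered a∈)
        lf : LeafOf (letters w)
        lf = leaf (letters-unique w) (letters⁺ (a₀ , a₀∈ , l₀)) (letters⁺ (a , a∈ , proj₂ (lettered a∈)))
               (λ e → la (trans (proj₂ (lettered a∈)) (cong just (sym e))))
               (λ i j i∈ j∈ → star-map letters⁺ (conn i j (letters⁻ i∈) (letters⁻ j∈)))
        open LeafOf lf using (l; p; l≢p)
        occp : Occurs w p
        occp = letters⁻ (LeafOf.p∈ lf)
        x₀ = proj₁ occp
        x₀∈ = proj₁ (proj₂ occp)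
        x₀≢l : lab x₀ ≢ just l
        x₀≢l e = l≢p (just-injective (trans (sym e) (proj₂ (proj₂ occp))))
        finish : ∀ v → TreeWord v → (∀ {i} → Occurs w i → Occurs v i) → (∀ {i} → Occurs v i → Occurs w i) → length v ≡ length w →
                 ∀ bs → v ≡ glue bs → All (Alternates l) bs → Fam (ring v)
        finish v tv to from lv bs refl ok = Assemble.assembled bs tv lf' ok (λ u lt tu → treeFam n u (s≤s⁻¹ (≤-trans lt (≤-trans (≤-reflexive lv) len))) tu)
          where
          lf' : LeafOf (letters v)
          lf' = record
            { l = l ; p = p ; l∈ = letters⁺ (to (letters⁻ (LeafOf.l∈ lf))) ; p∈ = letters⁺ (to occp) ; l≢p = l≢p ; lp = LeafOf.lp lf
            ; only = λ m∈ → LeafOf.only lf (letters⁺ (from (letters⁻ m∈)))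
            ; conn = λ i j (i∈ , ni) (j∈ , nj) → star-map (λ (h , n) → letters⁺ (to (letters⁻ h)) , n)
                       (LeafOf.conn lf i j (letters⁺ (from (letters⁻ i∈)) , ni) (letters⁺ (from (letters⁻ j∈)) , nj)) }
        rotate : ∃[ A ] ∃[ B ] w ≡ A ++ x₀ ∷ B → Fam (ring w)
        rotate (A , B , eq) with parse l (B ++ A) x₀≢l
        ... | g , bs , eq' , ng , okb , _ = close bs eq' okb
          where
          occl : Occurs w l
          occl = letters⁻ (LeafOf.l∈ lf)
          cut₁ : w ≡ (A ++ x₀ ∷ []) ++ B
          cut₁ = trans eq (sym (++-assoc A (x₀ ∷ []) B))
          cut₂ : ∀ bs → (B ++ A) ++ x₀ ∷ [] ≡ g ++ glue bs → B ++ A ++ x₀ ∷ [] ≡ g ++ glue bs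
          cut₂ bs e = trans (sym (++-assoc B A (x₀ ∷ []))) e
          perm : w ↭ B ++ A ++ x₀ ∷ []
          perm = ↭trans (↭-reflexive cut₁) (++-comm (A ++ x₀ ∷ []) B)
          close : ∀ bs → (B ++ A) ++ x₀ ∷ [] ≡ g ++ glue bs → All (Alternates l) bs → Fam (ring w)
          close [] e _ = ⊥-elim (ng (subst (_ ∈_) (trans (cut₂ [] e) (++-identityʳ g)) (∈-resp-↭ perm (proj₁ (proj₂ occl)))) (proj₂ (proj₂ occl)))
          close (b ∷ bs) e ok with absorb l g (b ∷ bs) (λ ()) ng ok
          ... | bs' , e' , ok' = subst (λ v → Fam (ring v)) (sym cut₁)
            (Fam-≈ (rot-≈ B (A ++ x₀ ∷ [])) (subst (λ v → Fam (ring v)) (sym (cut₂ (b ∷ bs) e))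
              (Fam-≈ (rot-≈ (glue (b ∷ bs)) g) (finish (glue (b ∷ bs) ++ g) tree to from lenv bs' (sym e') ok'))))
            where
            perm' : w ↭ glue (b ∷ bs) ++ g
            perm' = ↭trans perm (↭trans (↭-reflexive (cut₂ (b ∷ bs) e)) (++-comm g (glue (b ∷ bs))))
            tree : TreeWord (glue (b ∷ bs) ++ g)
            tree = tree-rot g (glue (b ∷ bs)) (subst TreeWord (cut₂ (b ∷ bs) e) (tree-rot (A ++ x₀ ∷ []) B (subst TreeWord cut₁ t)))
            to : ∀ {i} → Occurs w i → Occurs (glue (b ∷ bs) ++ g) i
            to (c , h , lc) = c , ∈-resp-↭ perm' h , lc
            from : ∀ {i} → Occurs (glue (b ∷ bs) ++ g) i → Occurs w i
            from (c , h , lc) = c , ∈-resp-↭ (↭-sym perm') h , lc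
            lenv : length (glue (b ∷ bs) ++ g) ≡ length w
            lenv = sym (↭-length perm')
      go : Dec (All (λ a → lab a ≡ just i₀) w) → Fam (ring w)
      go (yes all) with two a₀∈ l₀
      ... | b , b∈ , b≢ , _ = Single.singleFam nodup b∈ a₀∈ b≢ (All.lookup all)
      go (no ¬all) = find (¬All⇒Any¬ (λ a → ≡-dec _≟ₖ_ (lab a) (just i₀)) w ¬all)
        where
        find : Any (λ a → ¬ (lab a ≡ just i₀)) w → Fam (ring w)
        find h = let a , a∈ , n = Membership.find h in several a∈ n

-- Bridges

open Equivalence using (to; from)

module Bridges {n : ℕ} (G : Graph n) (tc : TwoConnected G) (L : CycleIn (Graph.Adj G)) {s : ℕ} (T : Fin s → Subgraph n)
  (isB : ∀ i → IsBridge G L (T i)) (allB : ∀ B → IsBridge G L B → ∃[ i ] SameSub B (T i))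
  (disjoint : ∀ i j → i ≢ j → ∀ x → ¬ (Subgraph.V (T i) x × Subgraph.V (T j) x)) where

  open Graph G using (Adj; Adj-dec; irrefl) renaming (sym to adj-sym)
  open CycleIn L using (vtx)

  VT : Fin s → Fin n → Set
  VT i = Subgraph.V (T i)

  ET : Fin s → Fin n → Fin n → Set
  ET i = Subgraph.E (T i)

  On : Fin n → Set
  On = OnC L

  on? : ∀ x → Dec (On x)
  on? x = any? λ i → vtx i ≟ᶠ x

  Off : Fin n → Fin n → Set
  Off a b = ¬ On a × ¬ On b × Adj a b

  Comp : Fin n → Fin n → Set
  Comp v = Star Off v

  comp-off : ∀ {v y} → ¬ On v → Comp v y → ¬ On y
  comp-off n ε = n
  comp-off n ((_ , n' , _) ◅ st) = comp-off n' st

  comp-isComponent : ∀ {v} → ¬ On v → IsComponentOutside G L (Comp v)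
  comp-isComponent {v} nv = (v , ε) , (λ x → comp-off nv) , conn , closed
    where
    step : Fin n → Fin n → Set
    step a b = Comp v a × Comp v b × Adj a b
    down : ∀ {x y} → Comp v x → Star Off x y → Star step x y
    down c ε = ε
    down c (o@(_ , _ , ad) ◅ st) = (c , c ◅◅ (o ◅ ε) , ad) ◅ down (c ◅◅ (o ◅ ε)) st
    back : ∀ {x y} → Star step x y → Star step y x
    back = StarP.reverse λ (p , q , ad) → q , p , adj-sym ad
    conn : ConnectedOn (Comp v) Adj
    conn x y cx cy = back (down ε cx) ◅◅ down ε cy
    closed : ∀ x y → Comp v x → Adj x y → ¬ On y → Comp v y
    closed x y cx ad ny = cx ◅◅ ((comp-off nv cx , ny , ad) ◅ ε)

  owner : ∀ {v} → ¬ On v → ∃[ i ] SameSub (compSub G L (Comp v)) (T i)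
  owner {v} nv = allB _ (inj₂ (Comp v , comp-isComponent nv , (λ x → mk⇔ id id) , (λ x y → mk⇔ id id)))

  V?-off : ∀ i {v} → ¬ On v → Dec (VT i v)
  V?-off i {v} nv with owner nv
  ... | j , sv , _ with i ≟ᶠ j
  ... | yes refl = yes (to (sv v) (inj₁ ε))
  ... | no i≢j = no λ h → disjoint i j i≢j v (h , to (sv v) (inj₁ ε))

  LEdge-on : ∀ {x y} → LEdge G L x y → On x × On y
  LEdge-on (inj₁ (i , refl , refl)) = (i , refl) , (next i , refl)
  LEdge-on (inj₂ (i , refl , refl)) = (next i , refl) , (i , refl)

  another : ∀ v → ∃[ l ] (On l × l ≢ v)
  another v with vtx zero ≟ᶠ v
  ... | no n = vtx zero , (zero , refl) , n
  ... | yes e = vtx (suc zero) , (suc zero , refl) , λ e' → zero≢ (CycleIn.inj L zero (suc zero) (trans e (sym e')))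
    where
    zero≢ : ∀ {k} → _≢_ {A = Fin (suc (suc k))} zero (suc zero)
    zero≢ ()

  record BridgeData (i : Fin s) : Set where
    field
      V?    : ∀ x → Dec (VT i x)
      E-adj : ∀ {x y} → ET i x y → Adj x y
      E-sym : ∀ {x y} → ET i x y → ET i y x
      E-V   : ∀ {x y} → ET i x y → VT i x
      E-off : ∀ {x y} → ET i x y → ¬ LEdge G L x y
      path  : ∀ {a b} → On a → VT i a → On b → VT i b → a ≢ b →
              ∃[ vs ] (Unique vs × (∀ {v} → v ∈ vs → ¬ On v × VT i v) × (∀ {x y} → (x , y) ∈ links a vs b → ET i x y))
      many  : ∀ v → On v → ∃[ a ] (On a × VT i a × a ≢ v)
      exit  : ∀ {u v} → ET i u v → ∃[ a ] (On a × VT i a × Star (λ x y → ET i x y × x ≢ v × y ≢ v) u a)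
  open BridgeData public

  private
    chordData : ∀ i u v → Adj u v → ¬ LEdge G L u v → On u → On v → SameSub (T i) (chordSub G L u v) → BridgeData i
    chordData i u v ad nl ou ov (sv , se) = record
      { V? = λ x → map′ (from (sv x)) (to (sv x)) ((x ≟ᶠ u) ⊎-dec (x ≟ᶠ v))
      ; E-adj = λ {x} {y} h → adj (to (se x y) h)
      ; E-sym = λ {x} {y} h → from (se y x) (flp (to (se x y) h))
      ; E-V = λ {x} {y} h → from (sv x) (ends (to (se x y) h))
      ; E-off = λ {x} {y} h → off (to (se x y) h)
      ; path = λ {a} {b} _ va _ vb ne → [] , [] , (λ ()) , λ { (here refl) → from (se a b) (pair (to (sv a) va) (to (sv b) vb) ne) }
      ; many = λ w _ → pick w (u ≟ᶠ w)
      ; exit = λ {x} {y} h → x , onE (ends (to (se x y) h)) , from (sv x) (ends (to (se x y) h)) , ε }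
      where
      EE : Fin n → Fin n → Set
      EE x y = (x ≡ u × y ≡ v) ⊎ (x ≡ v × y ≡ u)
      adj : ∀ {x y} → EE x y → Adj x y
      adj (inj₁ (refl , refl)) = ad
      adj (inj₂ (refl , refl)) = adj-sym ad
      flp : ∀ {x y} → EE x y → EE y x
      flp (inj₁ (p , q)) = inj₂ (q , p)
      flp (inj₂ (p , q)) = inj₁ (q , p)
      ends : ∀ {x y} → EE x y → x ≡ u ⊎ x ≡ v
      ends (inj₁ (p , _)) = inj₁ p
      ends (inj₂ (p , _)) = inj₂ p
      off : ∀ {x y} → EE x y → ¬ LEdge G L x y
      off (inj₁ (refl , refl)) h = nl h
      off (inj₂ (refl , refl)) h = nl (Data.Sum.swap h)
        where import Data.Sum
      pair : ∀ {a b} → a ≡ u ⊎ a ≡ v → b ≡ u ⊎ b ≡ v → a ≢ b → EE a b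
      pair (inj₁ refl) (inj₁ refl) ne = ⊥-elim (ne refl)
      pair (inj₁ refl) (inj₂ refl) ne = inj₁ (refl , refl)
      pair (inj₂ refl) (inj₁ refl) ne = inj₂ (refl , refl)
      pair (inj₂ refl) (inj₂ refl) ne = ⊥-elim (ne refl)
      pick : ∀ w → Dec (u ≡ w) → ∃[ a ] (On a × VT i a × a ≢ w)
      pick w (no ne) = u , ou , from (sv u) (inj₁ refl) , ne
      pick w (yes refl) = v , ov , from (sv v) (inj₂ refl) , λ { refl → irrefl ad }
      onE : ∀ {x} → x ≡ u ⊎ x ≡ v → On x
      onE (inj₁ refl) = ou
      onE (inj₂ refl) = ov

    compData : ∀ i D → IsComponentOutside G L D → SameSub (T i) (compSub G L D) → BridgeData i
    compData i D ((x₀ , d₀) , D-off , D-conn , D-closed) (sv , se) = record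
      { V? = λ x → map′ (from (sv x)) (to (sv x)) (D? x ⊎-dec (on? x ×-dec any? λ y → D? y ×-dec Adj-dec y x))
      ; E-adj = λ {x} {y} h → proj₁ (to (se x y) h)
      ; E-sym = λ {x} {y} h → let ad , e = to (se x y) h in from (se y x) (adj-sym ad , Data.Sum.swap e)
      ; E-V = λ {x} {y} h → let ad , e = to (se x y) h in from (sv x) (inV ad e)
      ; E-off = λ {x} {y} h l → let _ , e = to (se x y) h ; ox , oy = LEdge-on l in
                off e ox oy
      ; path = pth
      ; many = λ v ov → let l , ol , l≢v = another v
                            a , oa , va , a≢v , _ = leave d₀ ol (proj₂ (proj₂ tc) v x₀ l (λ { refl → D-off v d₀ ov }) l≢v) in
                        a , oa , va , a≢v
      ; exit = λ {u} {v} h → ex h (on? u) }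
      where
      import Data.Sum
      VD : Fin n → Set
      VD x = D x ⊎ (On x × ∃[ y ] (D y × Adj y x))
      D? : ∀ y → Dec (D y)
      D? y with on? y
      ... | yes oy = no λ d → D-off y d oy
      ... | no ny = map′ (λ h → strip (to (sv y) h)) (λ d → from (sv y) (inj₁ d)) (V?-off i ny)
        where
        strip : VD y → D y
        strip (inj₁ d) = d
        strip (inj₂ (oy , _)) = ⊥-elim (ny oy)
      inV : ∀ {x y} → Adj x y → D x ⊎ D y → VD x
      inV ad (inj₁ d) = inj₁ d
      inV {x} {y} ad (inj₂ d) with on? x
      ... | yes ox = inj₂ (ox , y , d , adj-sym ad)
      ... | no nx = inj₁ (D-closed y x d (adj-sym ad) nx)
      off : ∀ {x y} → D x ⊎ D y → On x → On y → ⊥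
      off (inj₁ d) ox _ = D-off _ d ox
      off (inj₂ d) _ oy = D-off _ d oy
      edge : ∀ {x y} → Adj x y → D x ⊎ D y → ET i x y
      edge {x} {y} ad e = from (se x y) (ad , e)
      gate : ∀ {a} → On a → VT i a → ∃[ y ] (D y × Adj y a)
      gate {a} oa va with to (sv a) va
      ... | inj₁ d = ⊥-elim (D-off a d oa)
      ... | inj₂ (_ , g) = g
      pth : ∀ {a b} → On a → VT i a → On b → VT i b → a ≢ b →
            ∃[ vs ] (Unique vs × (∀ {v} → v ∈ vs → ¬ On v × VT i v) × (∀ {x y} → (x , y) ∈ links a vs b → ET i x y))
      pth {a} {b} oa va ob vb _ with gate oa va | gate ob vb
      ... | y , dy , ya | y' , dy' , y'b with simple _≟ᶠ_ (D-conn y y' dy dy')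
      ... | vs , w , u with walk-src w
      ... | us , refl = vs , u , (λ {v} h → let d = walk-mem dy w h in D-off v d , from (sv v) (inj₁ d)) , lk
        where
        lk : ∀ {p q} → (p , q) ∈ links a (y ∷ us) b → ET i p q
        lk (here refl) = edge (adj-sym ya) (inj₂ dy)
        lk (there h) with walk-links w h
        ... | inj₁ (dp , dq , ad) = edge ad (inj₁ dp)
        ... | inj₂ (refl , refl) = edge y'b (inj₁ dy')
      leave : ∀ {S : Fin n → Set} {x l} → D x → On l → Star (λ a b → S a × S b × Adj a b) x l →
              ∃[ a ] (On a × VT i a × S a × Star (λ p q → ET i p q × S p × S q) x a)
      leave d ol ε = ⊥-elim (D-off _ d ol)
      leave {x = x} d ol (_◅_ {j = x'} (sx , sx' , ad) st) with on? x'
      ... | yes ox' = x' , ox' , from (sv x') (inj₂ (ox' , x , d , ad)) , sx' , (edge ad (inj₁ d) , sx , sx') ◅ ε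
      ... | no nx' = let a , oa , va , sa , st' = leave (D-closed x x' d ad nx') ol st in
                     a , oa , va , sa , (edge ad (inj₁ d) , sx , sx') ◅ st'
      ex : ∀ {u v} → ET i u v → Dec (On u) → ∃[ a ] (On a × VT i a × Star (λ x y → ET i x y × x ≢ v × y ≢ v) u a)
      ex {u} {v} h (yes ou) = u , ou , from (sv u) (let ad , e = to (se u v) h in inV ad e) , ε
      ex {u} {v} h (no nu) =
        let ad , e = to (se u v) h ; l , ol , l≢v = another v
            a , oa , va , _ , st = leave (inD ad e) ol (proj₂ (proj₂ tc) v u l (λ { refl → irrefl ad }) l≢v) in
        a , oa , va , st
        where
        inD : Adj u v → D u ⊎ D v → D u
        inD ad (inj₁ d) = d
        inD ad (inj₂ d) = D-closed v u d (adj-sym ad) nu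

  bridgeData : ∀ i → BridgeData i
  bridgeData i with isB i
  ... | inj₁ (u , v , ad , nl , ou , ov , same) = chordData i u v ad nl ou ov same
  ... | inj₂ (D , comp , same) = compData i D comp same

  edge-owner : ∀ {u v} → Adj u v → ¬ LEdge G L u v → ∃[ i ] ET i u v
  edge-owner {u} {v} ad nl with on? u | on? v
  ... | no nu | _ = let i , _ , se = owner nu in i , to (se u v) (ad , inj₁ ε)
  ... | yes _ | no nv = let i , _ , se = owner nv in i , to (se u v) (ad , inj₂ ε)
  ... | yes ou | yes ov with allB (chordSub G L u v) (inj₁ (u , v , ad , nl , ou , ov , (λ _ → mk⇔ id id) , (λ _ _ → mk⇔ id id)))
  ... | i , _ , se = i , to (se u v) (inj₁ (refl , refl))

  -- Deleting the edge uv of the tree T i separates its vertices into those reaching u and those reaching v.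
  module Sides {i : Fin s} (treeT : IsTree (VT i) (ET i)) {u v : Fin n} (uv : ET i u v) where
    Av : Fin n → Fin n → Set
    Av p q = ET i p q × ¬ (p ≡ u × q ≡ v) × ¬ (p ≡ v × q ≡ u)

    private
      bd = bridgeData i

      Av-sym : ∀ {p q} → Av p q → Av q p
      Av-sym (e , n , n') = E-sym bd e , (λ (a , b) → n' (b , a)) , (λ (a , b) → n (b , a))

      back : ∀ {x y} → Star Av x y → Star Av y x
      back = StarP.reverse Av-sym

    Side : Fin n → Set
    Side x = Star Av x u ⊎ Star Av x v

    side : ∀ x → VT i x → Side x
    side x vx = go (proj₁ (proj₂ treeT) x u vx (E-V bd uv))
      where
      go : ∀ {x} → Star (λ a b → VT i a × VT i b × ET i a b) x u → Side x
      go ε = inj₁ ε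
      go {x} (_◅_ {j = y} (_ , _ , e) st) with (x ≟ᶠ u) ×-dec (y ≟ᶠ v) | (x ≟ᶠ v) ×-dec (y ≟ᶠ u)
      ... | yes (refl , _) | _ = inj₁ ε
      ... | no _ | yes (refl , _) = inj₂ ε
      ... | no n | no n' with go st
      ... | inj₁ s' = inj₁ ((e , n , n') ◅ s')
      ... | inj₂ s' = inj₂ ((e , n , n') ◅ s')

    uncut : Star Av u v → ⊥
    uncut st with simple _≟ᶠ_ st
    ... | vs , w , uq = go w uq
      where
      go : ∀ {vs} → Walk Av u vs v → Unique vs → ⊥
      go ([ _ ]) _ = irrefl (E-adj bd uv)
      go ((_ , n , _) ∷ [ _ ]) _ = n (refl , refl)
      go (_∷_ {y = y} q (_∷_ {y = t} q' w')) uq with walk-src w'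
      ... | us , refl = proj₂ (proj₂ treeT) (cycleOf (u ∷ y ∷ t ∷ us) uq (s≤s (s≤s (s≤s z≤n))) edges)
        where
        full : ∀ {p q} → ET i p q → VT i p × VT i q × ET i p q
        full e = E-V bd e , E-V bd (E-sym bd e) , e
        edges : ∀ {a b} → (a , b) ∈ cpairs (u ∷ y ∷ t ∷ us) → VT i a × VT i b × ET i a b
        edges h with walk-links {e = u} (q ∷ (q' ∷ w')) h
        ... | inj₁ (e , _) = full e
        ... | inj₂ (refl , refl) = full (E-sym bd uv)

    separated : ∀ {x} → Star Av x u → Star Av x v → ⊥
    separated p q = uncut (back p ◅◅ q)

    u-exit : ∃[ a ] (On a × VT i a × Star Av a u)
    u-exit with exit bd uv
    ... | a , oa , va , st = a , oa , va , back (go st)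
      where
      go : ∀ {x y} → Star (λ x y → ET i x y × x ≢ v × y ≢ v) x y → Star Av x y
      go = StarP.map λ (e , n , n') → e , (λ (_ , q) → n' q) , (λ (p , _) → n p)

    v-exit : ∃[ a ] (On a × VT i a × Star Av a v)
    v-exit with exit bd (E-sym bd uv)
    ... | a , oa , va , st = a , oa , va , back (go st)
      where
      go : ∀ {x y} → Star (λ x y → ET i x y × x ≢ u × y ≢ u) x y → Star Av x y
      go = StarP.map λ (e , n , n') → e , (λ (p , _) → n p) , (λ (_ , q) → n' q)

    through : ∀ {a b} vs → (∀ {x y} → (x , y) ∈ links a vs b → ET i x y) → Star Av a u → Star Av b v →
              (u , v) ∈ links a vs b ⊎ (v , u) ∈ links a vs b
    through {a} {b} vs f p q with (u , v) ∈? links a vs b | (v , u) ∈? links a vs b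
      where open import Data.List.Membership.DecPropositional (×-≡-dec _≟ᶠ_ _≟ᶠ_) using (_∈?_)
    ... | yes h | _ = inj₁ h
    ... | no _ | yes h = inj₂ h
    ... | no n | no n' = ⊥-elim (uncut (back p ◅◅ walk a vs (λ h → f h , (λ { (refl , refl) → n h }) , (λ { (refl , refl) → n' h })) ◅◅ q))
      where
      walk : ∀ a vs → (∀ {x y} → (x , y) ∈ links a vs b → Av x y) → Star Av a b
      walk a [] g = g (here refl) ◅ ε
      walk a (c ∷ vs) g = g (here refl) ◅ walk c vs (g ∘ there)

-- Overlap and the order of the attachments on L

module _ {k : ℕ} where
  private
    M : ℕ
    M = suc k

  dist-≥ : ∀ (a p : Fin M) → toℕ a ≤ toℕ p → dist a p ≡ toℕ p ∸ toℕ a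
  dist-≥ a p h = trans (cong (_% M) eq) (trans ([m+n]%n≡m%n (toℕ p ∸ toℕ a) M) (m<n⇒m%n≡m (≤-<-trans (m∸n≤m (toℕ p) (toℕ a)) (toℕ<n p))))
    where
    open import Data.Nat.Properties using (m∸n≤m)
    eq : toℕ p + (M ∸ toℕ a) ≡ (toℕ p ∸ toℕ a) + M
    eq = trans (sym (+-∸-assoc (toℕ p) (<⇒≤ (toℕ<n a)))) (+-∸-comm M h)

  dist-< : ∀ (a p : Fin M) → toℕ p < toℕ a → dist a p ≡ toℕ p + (M ∸ toℕ a)
  dist-< a p h = m<n⇒m%n≡m (subst (toℕ p + (M ∸ toℕ a) <_) (m+[n∸m]≡n (<⇒≤ (toℕ<n a))) (+-monoˡ-< (M ∸ toℕ a) h))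
    where open import Data.Nat.Properties using (+-monoˡ-<)

  arc-in : ∀ {a b p : Fin M} → toℕ a ≤ toℕ p → toℕ p ≤ toℕ b → OnArc a b p
  arc-in {a} {b} {p} h h' rewrite dist-≥ a p h | dist-≥ a b (≤-trans h h') = ∸-monoˡ-≤ (toℕ a) h'

  arc-in⁻ : ∀ {a b p : Fin M} → toℕ a < toℕ b → OnArc a b p → toℕ a ≤ toℕ p × toℕ p ≤ toℕ b
  arc-in⁻ {a} {b} {p} a<b h with toℕ p <? toℕ a
  ... | yes p<a = ⊥-elim (<-irrefl refl (<-≤-trans lt (≤-trans (m≤n+m _ (toℕ p)) h')))
    where
    h' : toℕ p + (M ∸ toℕ a) ≤ toℕ b ∸ toℕ a
    h' = subst₂ _≤_ (dist-< a p p<a) (dist-≥ a b (<⇒≤ a<b)) h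
      where open import Relation.Binary.PropositionalEquality using (subst₂)
    lt : toℕ b ∸ toℕ a < M ∸ toℕ a
    lt = ∸-monoˡ-< (toℕ<n b) (<⇒≤ a<b)
  ... | no p≮a = ≮⇒≥ p≮a , subst₂ _≤_ (m+[n∸m]≡n (≮⇒≥ p≮a)) (m+[n∸m]≡n (<⇒≤ a<b))
      (+-monoʳ-≤ (toℕ a) (subst₂ _≤_ (dist-≥ a p (≮⇒≥ p≮a)) (dist-≥ a b (<⇒≤ a<b)) h))
    where open import Relation.Binary.PropositionalEquality using (subst₂)

  arc-out : ∀ {a b p : Fin M} → toℕ b < toℕ a → toℕ a ≤ toℕ p ⊎ toℕ p ≤ toℕ b → OnArc a b p
  arc-out {a} {b} {p} b<a (inj₁ h) rewrite dist-≥ a p h | dist-< a b b<a =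
    ≤-trans (∸-monoˡ-≤ (toℕ a) (<⇒≤ (toℕ<n p))) (m≤n+m _ (toℕ b))
  arc-out {a} {b} {p} b<a (inj₂ h) rewrite dist-< a p (≤-<-trans h b<a) | dist-< a b b<a = +-monoˡ-≤ (M ∸ toℕ a) h

  arc-out⁻ : ∀ {a b p : Fin M} → toℕ b < toℕ a → OnArc a b p → toℕ b < toℕ p → toℕ p < toℕ a → ⊥
  arc-out⁻ {a} {b} {p} b<a h b<p p<a = <-irrefl refl (<-≤-trans b<p
    (+-cancelʳ-≤ (M ∸ toℕ a) (toℕ p) (toℕ b) (subst₂ _≤_ (dist-< a p p<a) (dist-< a b b<a) h)))
    where open import Relation.Binary.PropositionalEquality using (subst₂)

least : ∀ {n} {P : Fin n → Set} → (∀ q → Dec (P q)) → ∃ P → ∃[ a ] (P a × ∀ q → P q → toℕ a ≤ toℕ q)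
least {suc n} {P} P? w with P? zero
... | yes p = zero , p , λ _ _ → z≤n
... | no np = go w
  where
  go : ∃ P → ∃[ a ] (P a × ∀ q → P q → toℕ a ≤ toℕ q)
  go (zero , p) = ⊥-elim (np p)
  go (suc q , p) = let a , pa , f = least (λ q → P? (suc q)) (q , p) in
    suc a , pa , λ { zero p → ⊥-elim (np p) ; (suc q) p → s≤s (f q p) }

greatest : ∀ {n} {P : Fin n → Set} → (∀ q → Dec (P q)) → ∃ P → ∃[ a ] (P a × ∀ q → P q → toℕ q ≤ toℕ a)
greatest {suc n} {P} P? w with any? (λ q → P? (suc q))
... | yes (q , p) = let a , pa , f = greatest (λ q → P? (suc q)) (q , p) in
    suc a , pa , λ { zero _ → z≤n ; (suc q) p → s≤s (f q p) }
... | no np = go w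
  where
  go : ∃ P → ∃[ a ] (P a × ∀ q → P q → toℕ q ≤ toℕ a)
  go (zero , p) = zero , p , λ { zero _ → z≤n ; (suc q) p → ⊥-elim (np (q , p)) }
  go (suc q , p) = ⊥-elim (np (q , p))

Increasing : ∀ {n} → List (Fin n) → Set
Increasing = AllPairs (λ a b → toℕ a < toℕ b)

increasing-⊆ : ∀ {n} {xs ys : List (Fin n)} → xs ⊆ ys → Increasing ys → Increasing xs
increasing-⊆ [] [] = []
increasing-⊆ (_ ∷ʳ s) (_ ∷ i) = increasing-⊆ s i
increasing-⊆ (refl ∷ s) (a ∷ i) = SubP.All-resp-⊆ s a ∷ increasing-⊆ s i

⊆-increasing : ∀ {n} {xs ys : List (Fin n)} → Increasing xs → Increasing ys → (∀ {a} → a ∈ xs → a ∈ ys) → xs ⊆ ys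
⊆-increasing {xs = []} {ys} _ _ f = minimum ys
⊆-increasing {xs = x ∷ xs} {[]} _ _ f with f (here refl)
... | ()
⊆-increasing {xs = x ∷ xs} {y ∷ ys} (ax ∷ ix) (ay ∷ iy) f with f (here refl)
... | here refl = refl ∷ ⊆-increasing ix iy λ h → strip h (f (there h))
  where
  strip : ∀ {a} → a ∈ xs → a ∈ x ∷ ys → a ∈ ys
  strip h (here refl) = ⊥-elim (<-irrefl refl (All.lookup ax h))
  strip h (there k) = k
... | there x∈ = y ∷ʳ ⊆-increasing (ax ∷ ix) iy λ h → strip h (f h)
  where
  strip : ∀ {a} → a ∈ x ∷ xs → a ∈ y ∷ ys → a ∈ ys
  strip h (there k) = k
  strip (here refl) (here refl) = x∈
  strip (there h) (here refl) = ⊥-elim (<-asym (All.lookup ax h) (All.lookup ay x∈))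

module Labels {n : ℕ} (G : Graph n) (tc : TwoConnected G) (L : CycleIn (Graph.Adj G)) {s : ℕ} (T : Fin s → Subgraph n)
  (isB : ∀ i → IsBridge G L (T i)) (allB : ∀ B → IsBridge G L B → ∃[ i ] SameSub B (T i))
  (disjoint : ∀ i j → i ≢ j → ∀ x → ¬ (Subgraph.V (T i) x × Subgraph.V (T j) x)) where

  open Bridges G tc L T isB allB disjoint
  open CycleIn L using (m; vtx)

  lab : Fin (suc (suc (suc m))) → Maybe (Fin s)
  lab q with any? (λ i → V? (bridgeData i) (vtx q))
  ... | yes (i , _) = just i
  ... | no _ = nothing

  lab-V : ∀ {q i} → lab q ≡ just i → VT i (vtx q)
  lab-V {q} e with any? (λ i → V? (bridgeData i) (vtx q))
  lab-V refl | yes (i , v) = v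

  V-lab : ∀ {q i} → VT i (vtx q) → lab q ≡ just i
  V-lab {q} {i} v with any? (λ i → V? (bridgeData i) (vtx q))
  ... | no n = ⊥-elim (n (i , v))
  ... | yes (j , v') with i ≟ᶠ j
  ... | yes refl = refl
  ... | no i≢j = ⊥-elim (disjoint i j i≢j _ (v , v'))

module Positions {n : ℕ} (G : Graph n) (tc : TwoConnected G) (L : CycleIn (Graph.Adj G)) {s : ℕ} (T : Fin s → Subgraph n)
  (isB : ∀ i → IsBridge G L (T i)) (allB : ∀ B → IsBridge G L B → ∃[ i ] SameSub B (T i))
  (disjoint : ∀ i j → i ≢ j → ∀ x → ¬ (Subgraph.V (T i) x × Subgraph.V (T j) x))
  (bd : ∀ i → Bridges.BridgeData G tc L T isB allB disjoint i)
  (lab : Fin (suc (suc (suc (CycleIn.m L)))) → Maybe (Fin s))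
  (lab-V : ∀ {q i} → lab q ≡ just i → Subgraph.V (T i) (CycleIn.vtx L q))
  (V-lab : ∀ {q i} → Subgraph.V (T i) (CycleIn.vtx L q) → lab q ≡ just i)
  (tree : IsTree (λ (_ : Fin s) → ⊤) (λ i j → Overlap G L (T i) (T j))) where

  open Bridges G tc L T isB allB disjoint
  open CycleIn L using (m; vtx)

  Pos : Set
  Pos = Fin (suc (suc (suc m)))

  open Core lab using (Fam; ring)
  open Core.Filling lab _≟ᶠ_ _≟ᶠ_ using (lettered?; insertPlain)

  R : Fin s → Fin s → Set
  R i j = Overlap G L (T i) (T j)

  R-sym : ∀ {i j} → R i j → R j i
  R-sym r (a , b , ne , f , g) = r (b , a , ne ∘ sym , g , f)

  acyclic : ¬ CycleIn R
  acyclic c = proj₂ (proj₂ tree) record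
    { m = CycleIn.m c ; vtx = CycleIn.vtx c ; inj = CycleIn.inj c ; step = λ i → tt , tt , CycleIn.step c i }

  open Core.Trees lab _≟ᶠ_ _≟ᶠ_ R-sym acyclic

  w₀ : List Pos
  w₀ = filter lettered? (allFin _)

  w₀∈ : ∀ {a i} → lab a ≡ just i → a ∈ w₀
  w₀∈ {a} {i} l = ∈-filter⁺ lettered? (∈-allFin a) (i , l)

  w₀-inc : Increasing w₀
  w₀-inc = AllPairsP.filter⁺ lettered? (AllPairsP.tabulate⁺-< id)

  Chain : Fin s → Fin s → Set
  Chain i j = ∃[ a ] ∃[ b ] ∃[ c ] ∃[ d ] ((lab a ≡ just i × lab b ≡ just j × lab c ≡ just i × lab d ≡ just j) ×
                (toℕ a < toℕ b × toℕ b < toℕ c × toℕ c < toℕ d))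

  pattern→chain : ∀ {i j} → Pattern w₀ i j → Chain i j
  pattern→chain (a , b , c , d , ls , sub) with increasing-⊆ sub w₀-inc
  ... | (p ∷ _) ∷ (q ∷ _) ∷ (r ∷ _) ∷ _ = a , b , c , d , ls , p , q , r

  chain→pattern : ∀ {i j} → Chain i j → Pattern w₀ i j
  chain→pattern (a , b , c , d , ls@(la , lb , lc , ld) , p , q , r) = a , b , c , d , ls ,
    ⊆-increasing ((p ∷ <-trans p q ∷ <-trans p (<-trans q r) ∷ []) ∷ (q ∷ <-trans q r ∷ []) ∷ (r ∷ []) ∷ [] ∷ []) w₀-inc
      (λ { (here refl) → w₀∈ la ; (there (here refl)) → w₀∈ lb ; (there (there (here refl))) → w₀∈ lc
         ; (there (there (there (here refl)))) → w₀∈ ld })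

  attached : ∀ {q i} → lab q ≡ just i → Attachment G L (T i) (vtx q)
  attached l = (_ , refl) , lab-V l

  attached⁻ : ∀ {q i} → Attachment G L (T i) (vtx q) → lab q ≡ just i
  attached⁻ (_ , v) = V-lab v

  chain→R : ∀ {i j} → Chain i j → R i j
  chain→R (p₁ , p₂ , p₃ , p₄ , (l₁ , l₂ , l₃ , l₄) , q₁ , q₂ , q₃) (a , b , a≢b , f , g) with <-cmp (toℕ a) (toℕ b)
  ... | tri≈ _ e _ = a≢b (toℕ-injective e)
  ... | tri< a<b _ _ = arc-out⁻ a<b (g p₂ (attached l₂))
          (≤-<-trans (proj₁ (arc-in⁻ a<b (f p₁ (attached l₁)))) q₁) (<-≤-trans q₂ (proj₂ (arc-in⁻ a<b (f p₃ (attached l₃)))))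
  ... | tri> _ _ b<a = arc-out⁻ b<a (f p₃ (attached l₃))
          (≤-<-trans (proj₁ (arc-in⁻ b<a (g p₂ (attached l₂)))) q₂) (<-≤-trans q₃ (proj₂ (arc-in⁻ b<a (g p₄ (attached l₄)))))

  lab? : ∀ i q → Dec (lab q ≡ just i)
  lab? i q = ≡-dec _≟ᶠ_ (lab q) (just i)

  another-pos : ∀ {q i} → lab q ≡ just i → ∃[ b ] (b ≢ q × lab b ≡ just i)
  another-pos {q} {i} l with many (bd i) (vtx q) (q , refl)
  ... | _ , (b , refl) , v , ne = b , (λ { refl → ne refl }) , V-lab v

  some-pos : ∀ i → ∃[ q ] lab q ≡ just i
  some-pos i with many (bd i) (vtx zero) (zero , refl)
  ... | _ , (b , refl) , v , _ = b , V-lab v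

  span : ∀ i → ∃[ a ] ∃[ b ] (lab a ≡ just i × lab b ≡ just i × toℕ a < toℕ b × (∀ q → lab q ≡ just i → toℕ a ≤ toℕ q × toℕ q ≤ toℕ b))
  span i with least (lab? i) (some-pos i) | greatest (lab? i) (some-pos i)
  ... | a , la , f | b , lb , g = a , b , la , lb , a<b , λ q l → f q l , g q l
    where
    a<b : toℕ a < toℕ b
    a<b with another-pos la
    ... | c , c≢a , lc with m≤n⇒m<n∨m≡n (f c lc)
    ... | inj₁ lt = <-≤-trans lt (g c lc)
    ... | inj₂ e = ⊥-elim (c≢a (toℕ-injective (sym e)))

  nonOverlap : ∀ {i j} → i ≢ j → ¬ Chain i j → ¬ Chain j i → NonOverlap G L (T i) (T j)
  nonOverlap {i} {j} i≢j nij nji with span i | span j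
  ... | i₀ , i₁ , l₀ , l₁ , i< , spi | j₀ , j₁ , k₀ , k₁ , j< , spj
    with any? (λ q → lab? j q ×-dec ((toℕ i₀ <? toℕ q) ×-dec (toℕ q <? toℕ i₁)))
  ... | no none = i₀ , i₁ , (λ { refl → <-irrefl refl i< }) ,
        (λ q h → arc-in (proj₁ (spi q (attached⁻ h))) (proj₂ (spi q (attached⁻ h)))) ,
        (λ q h → arc-out i< (outside q (attached⁻ h)))
    where
    outside : ∀ q → lab q ≡ just j → toℕ i₁ ≤ toℕ q ⊎ toℕ q ≤ toℕ i₀
    outside q l with toℕ q <? toℕ i₁ | toℕ i₀ <? toℕ q
    ... | no n | _ = inj₁ (≮⇒≥ n)
    ... | yes _ | no n = inj₂ (≮⇒≥ n)
    ... | yes p | yes p' = ⊥-elim (none (q , l , p' , p))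
  ... | yes (q , lq , lt , lt') = j₁ , j₀ , (λ { refl → <-irrefl refl j< }) ,
        (λ p h → arc-out j< (outside p (attached⁻ h))) ,
        (λ p h → arc-in (proj₁ (spj p (attached⁻ h))) (proj₂ (spj p (attached⁻ h))))
    where
    above : toℕ i₀ < toℕ j₀
    above with <-cmp (toℕ i₀) (toℕ j₀)
    ... | tri< h _ _ = h
    ... | tri≈ _ e _ = ⊥-elim (i≢j (just-injective (trans (sym l₀) (trans (cong lab (toℕ-injective e)) k₀))))
    ... | tri> _ _ h = ⊥-elim (nji (j₀ , i₀ , q , i₁ , (k₀ , l₀ , lq , l₁) , h , lt , lt'))
    outside : ∀ p → lab p ≡ just i → toℕ j₁ ≤ toℕ p ⊎ toℕ p ≤ toℕ j₀
    outside p l with toℕ p <? toℕ j₁ | toℕ j₀ <? toℕ p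
    ... | no n | _ = inj₁ (≮⇒≥ n)
    ... | yes _ | no n = inj₂ (≮⇒≥ n)
    ... | yes h | yes h' = ⊥-elim (nij (i₀ , j₀ , p , j₁ , (l₀ , k₀ , l , k₁) , above , h' , h))

  chain? : ∀ i j → Dec (Chain i j)
  chain? i j = any? λ a → any? λ b → any? λ c → any? λ d →
    (lab? i a ×-dec (lab? j b ×-dec (lab? i c ×-dec lab? j d))) ×-dec
    ((toℕ a <? toℕ b) ×-dec ((toℕ b <? toℕ c) ×-dec (toℕ c <? toℕ d)))

  treeWord : TreeWord w₀
  treeWord = record
    { nodup = UniqueP.filter⁺ lettered? (allFin⁺ _)
    ; some = let q , l = some-pos (proj₁ (proj₁ tree)) in q , w₀∈ l
    ; lettered = λ h → proj₂ (∈-filter⁻ lettered? {xs = allFin _} h)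
    ; two = λ _ l → let b , n , e = another-pos l in b , w₀∈ e , n , e
    ; conn = λ i j _ _ → go (proj₁ (proj₂ tree) i j tt tt)
    ; R→X = λ _ _ → r→x
    ; X→R = λ { _ (inj₁ p) → chain→R (pattern→chain p) ; _ (inj₂ p) → R-sym (chain→R (pattern→chain p)) } }
    where
    occurs : ∀ i → Occurs w₀ i
    occurs i = let q , l = some-pos i in q , w₀∈ l , l
    go : ∀ {i j} → Star (λ a b → ⊤ × ⊤ × R a b) i j → Star (λ a b → Occurs w₀ a × Occurs w₀ b × R a b) i j
    go = StarP.map λ (_ , _ , r) → occurs _ , occurs _ , r
    r→x : ∀ {i j} → i ≢ j → R i j → Cross w₀ i j
    r→x {i} {j} n r with chain? i j | chain? j i
    ... | yes c | _ = inj₁ (chain→pattern c)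
    ... | no _ | yes c = inj₂ (chain→pattern c)
    ... | no p | no q = ⊥-elim (r (nonOverlap n p q))

  family : Fam (ring (allFin (suc (suc (suc m)))))
  family = insertPlain (allFin _) (allFin⁺ _) (λ _ → another-pos) two≤
    (treeFam (length w₀) w₀ ≤-refl treeWord)
    where
    two≤ : 2 ≤ length w₀
    two≤ = go w₀ (TreeWord.two treeWord) (TreeWord.some treeWord) (TreeWord.lettered treeWord)
      where
      go : ∀ w → (∀ {a i} → a ∈ w → lab a ≡ just i → ∃[ b ] (b ∈ w × b ≢ a × lab b ≡ just i)) →
           ∃[ a ] a ∈ w → (∀ {a} → a ∈ w → ∃[ i ] lab a ≡ just i) → 2 ≤ length w
      go (x ∷ y ∷ w) _ _ _ = s≤s (s≤s z≤n)
      go (x ∷ []) two (_ , here refl) le with two (here refl) (proj₂ (le (here refl)))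
      ... | b , here refl , ne , _ = ⊥-elim (ne refl)

-- From words to cycles of G

links-tabulate : ∀ {A : Set} {k} (f : Fin (suc k) → A) e i → (f (inject₁ i) , f (suc i)) ∈ links (f zero) (tabulate (f ∘ suc)) e
links-tabulate f e zero = here refl
links-tabulate f e (suc i) = there (links-tabulate (f ∘ suc) e i)

links-tabulate-last : ∀ {A : Set} {k} (f : Fin (suc k) → A) e → (f (fromℕ k) , e) ∈ links (f zero) (tabulate (f ∘ suc)) e
links-tabulate-last {k = zero} f e = here refl
links-tabulate-last {k = suc k} f e = there (links-tabulate-last (f ∘ suc) e)

allFin-next : ∀ {k} (i : Fin (suc k)) → (i , next i) ∈ cpairs (allFin (suc k))
allFin-next {k} i with view i
... | ‵fromℕ = subst (λ j → (fromℕ k , j) ∈ cpairs (allFin (suc k))) (sym (next-fromℕ k)) (links-tabulate-last id zero)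
... | ‵inject₁ j = subst (λ j' → (inject₁ j , j') ∈ cpairs (allFin (suc k))) (sym (next-inject₁ j)) (links-tabulate id zero j)

allFin-next⁻ : ∀ {k} {a b : Fin (suc k)} → (a , b) ∈ cpairs (allFin (suc k)) → b ≡ next a
allFin-next⁻ {k} {a} h = cpairs-func {w = allFin (suc k)} (allFin⁺ (suc k)) h (allFin-next a)

next-toℕ : ∀ {k} (i : Fin (suc k)) → toℕ (next i) ≡ suc (toℕ i) ⊎ (toℕ (next i) ≡ 0 × toℕ i ≡ k)
next-toℕ {k} i with view i
... | ‵fromℕ = inj₂ (cong toℕ (next-fromℕ k) , toℕ-fromℕ k)
... | ‵inject₁ j = inj₁ (trans (cong toℕ (next-inject₁ j)) (cong suc (sym (toℕ-inject₁ j))))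

next-next : ∀ {k} (i : Fin (suc (suc (suc k)))) → next (next i) ≢ i
next-next {k} i e with next-toℕ i | next-toℕ (next i)
... | inj₁ p | inj₁ q = 2+≢ (trans (sym (cong suc p)) (trans (sym q) (cong toℕ e)))
  where
  2+≢ : ∀ {n} → suc (suc n) ≢ n
  2+≢ {n} h = <-irrefl (sym h) (s≤s (n≤1+n n))
... | inj₁ p | inj₂ (q , r) = absurd (trans (sym p) r) (trans (sym q) (cong toℕ e))
  where
  absurd : ∀ {n} → suc n ≡ suc (suc k) → 0 ≡ n → ⊥
  absurd () refl
... | inj₂ (p , r) | inj₁ q = absurd (trans (sym (cong suc p)) (trans (sym q) (trans (cong toℕ e) r)))
  where
  absurd : 1 ≡ suc (suc k) → ⊥
  absurd ()
... | inj₂ (p , _) | inj₂ (_ , r) = absurd (trans (sym p) r)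
  where
  absurd : 0 ≡ suc (suc k) → ⊥
  absurd ()

three : ∀ {A : Set} {l : List A} {x y z} → x ∈ l → y ∈ l → z ∈ l → x ≢ y → y ≢ z → x ≢ z → 3 ≤ length l
three {l = _ ∷ _ ∷ _ ∷ _} _ _ _ _ _ _ = s≤s (s≤s (s≤s z≤n))
three {l = p ∷ []} (here refl) (here refl) _ n _ _ = ⊥-elim (n refl)
three {l = p ∷ q ∷ []} (here refl) (here refl) _ n _ _ = ⊥-elim (n refl)
three {l = p ∷ q ∷ []} (there (here refl)) (there (here refl)) _ n _ _ = ⊥-elim (n refl)
three {l = p ∷ q ∷ []} (here refl) (there (here refl)) (here refl) _ _ n = ⊥-elim (n refl)
three {l = p ∷ q ∷ []} (here refl) (there (here refl)) (there (here refl)) _ n _ = ⊥-elim (n refl)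
three {l = p ∷ q ∷ []} (there (here refl)) (here refl) (here refl) _ n _ = ⊥-elim (n refl)
three {l = p ∷ q ∷ []} (there (here refl)) (here refl) (there (here refl)) _ _ n = ⊥-elim (n refl)

module Expansion {n : ℕ} (G : Graph n) (tc : TwoConnected G) (L : CycleIn (Graph.Adj G)) {s : ℕ} (T : Fin s → Subgraph n)
  (isB : ∀ i → IsBridge G L (T i)) (allB : ∀ B → IsBridge G L B → ∃[ i ] SameSub B (T i))
  (disjoint : ∀ i j → i ≢ j → ∀ x → ¬ (Subgraph.V (T i) x × Subgraph.V (T j) x))
  (bd : ∀ i → Bridges.BridgeData G tc L T isB allB disjoint i)
  (lab : Fin (suc (suc (suc (CycleIn.m L)))) → Maybe (Fin s))
  (lab-V : ∀ {q i} → lab q ≡ just i → Subgraph.V (T i) (CycleIn.vtx L q))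
  (V-lab : ∀ {q i} → Subgraph.V (T i) (CycleIn.vtx L q) → lab q ≡ just i) where

  open Graph G using (Adj) renaming (sym to adj-sym)
  open CycleIn L using (m; vtx; inj; step)
  open Bridges G tc L T isB allB disjoint

  Pos : Set
  Pos = Fin (suc (suc (suc m)))

  lab? : ∀ i q → Dec (lab q ≡ just i)
  lab? i q = ≡-dec _≟ᶠ_ (lab q) (just i)

  open Core lab hiding (inj; src-uniq)

  Good : Fin s → Pos → List (Fin n) → Pos → Set
  Good i a vs b = Unique vs × (∀ {v} → v ∈ vs → ¬ On v × VT i v) × (∀ {x y} → (x , y) ∈ links (vtx a) vs (vtx b) → ET i x y)

  Linked : Pos → Pos → Set
  Linked a b = a ≢ b × ∃[ i ] (lab a ≡ just i × lab b ≡ just i)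

  linked? : ∀ a b → Dec (Linked a b)
  linked? a b = ¬? (a ≟ᶠ b) ×-dec any? λ i → lab? i a ×-dec lab? i b

  pathFor : ∀ {a b} ((_ , i , _) : Linked a b) → ∃[ vs ] Good i a vs b
  pathFor {a} {b} (ne , i , la , lb) =
    path (bd i) (a , refl) (lab-V la) (b , refl) (lab-V lb) (λ e → ne (inj a b e))

  oriented : Pos → Pos → List (Fin n)
  oriented a b with linked? a b
  ... | yes l = proj₁ (pathFor l)
  ... | no _ = []

  oriented-good : ∀ {a b i} → a ≢ b → lab a ≡ just i → lab b ≡ just i → Good i a (oriented a b) b
  oriented-good {a} {b} {i} ne la lb with linked? a b
  ... | no n = ⊥-elim (n (ne , i , la , lb))
  ... | yes l@(_ , j , la' , _) = subst (λ k → Good k a (proj₁ (pathFor l)) b) (just-injective (trans (sym la') la)) (proj₂ (pathFor l))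

  -- Oriented by position, so that both directions of a jump use the same path of the bridge.
  interior : Pos → Pos → List (Fin n)
  interior a b with toℕ a <? toℕ b
  ... | yes _ = oriented a b
  ... | no _ = reverse (oriented b a)

  interior-good : ∀ {a b i} → a ≢ b → lab a ≡ just i → lab b ≡ just i → Good i a (interior a b) b
  interior-good {a} {b} {i} ne la lb with toℕ a <? toℕ b
  ... | yes _ = oriented-good ne la lb
  ... | no _ with oriented-good (ne ∘ sym) lb la
  ... | u , off , e = unique-↭ (↭-sym (↭-reverse vs)) u , (λ h → off (∈-resp-↭ (↭-reverse vs) h)) ,
        λ {x} {y} h → E-sym (bd i) (e (subst (λ l → (y , x) ∈ links (vtx b) l (vtx a)) (reverse-involutive vs)
          (links-reverse (vtx a) (reverse vs) (vtx b) h)))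
    where
    vs = oriented b a

  interior-flip : ∀ {a b x y} → a ≢ b → (x , y) ∈ links (vtx a) (interior a b) (vtx b) → (y , x) ∈ links (vtx b) (interior b a) (vtx a)
  interior-flip {a} {b} {x} {y} ne h with toℕ a <? toℕ b | toℕ b <? toℕ a
  ... | yes p | yes q = ⊥-elim (<-asym p q)
  ... | yes p | no q = links-reverse (vtx a) (oriented a b) (vtx b) h
  ... | no p | yes q = subst (λ l → (y , x) ∈ links (vtx b) l (vtx a)) (reverse-involutive (oriented b a))
                         (links-reverse (vtx a) (reverse (oriented b a)) (vtx b) h)
  ... | no p | no q with <-cmp (toℕ a) (toℕ b)
  ... | tri< t _ _ = ⊥-elim (p t)
  ... | tri≈ _ t _ = ⊥-elim (ne (toℕ-injective t))
  ... | tri> _ _ t = ⊥-elim (q t)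

  inside : Edge → List (Fin n)
  inside (a , seg _ , b) = []
  inside (a , jmp , b) = interior a b

  elinks : Edge → List (Fin n × Fin n)
  elinks e = links (vtx (src e)) (inside e) (vtx (tgt e))

  expand : List Edge → List (Fin n)
  expand [] = []
  expand (e ∷ C) = (vtx (src e) ∷ inside e) ++ expand C

  L-ring : Ring
  L-ring = ring (allFin (suc (suc (suc m))))

  expand-links : ∀ {a e C b} → Path L-ring a (e ∷ C) b →
    ∃[ vs ] (expand (e ∷ C) ≡ vtx a ∷ vs × links (vtx a) vs (vtx b) ≡ concatMap elinks (e ∷ C))
  expand-links {a} {e} {[]} (v ∷ []) = inside e ++ [] , refl ,
    trans (cong (λ l → links (vtx a) l (vtx (tgt e))) (++-identityʳ (inside e))) (sym (++-identityʳ (elinks e)))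
  expand-links {a} {e} {e' ∷ C} {b} (v ∷ p) with expand-links p
  ... | vs , eq , lk = inside e ++ expand (e' ∷ C) , refl ,
    trans (cong (λ l → links (vtx a) (inside e ++ l) (vtx b)) eq)
      (trans (links-++ (vtx a) (inside e) (vtx (tgt e)) vs (vtx b)) (cong (elinks e ++_) lk))

  concat-∈ : ∀ {C p} → p ∈ concatMap elinks C → ∃[ e ] (e ∈ C × p ∈ elinks e)
  concat-∈ {e ∷ C} h with ∈-++⁻ (elinks e) h
  ... | inj₁ k = e , here refl , k
  ... | inj₂ k = let e' , m , k' = concat-∈ {C} k in e' , there m , k'

  ∈-concat : ∀ {C e p} → e ∈ C → p ∈ elinks e → p ∈ concatMap elinks C
  ∈-concat (here refl) h = ∈-++⁺ˡ h
  ∈-concat {e' ∷ C} (there k) h = ∈-++⁺ʳ (elinks e') (∈-concat k h)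

  expand-∈ : ∀ {C v} → v ∈ expand C → ∃[ e ] (e ∈ C × v ∈ vtx (src e) ∷ inside e)
  expand-∈ {e ∷ C} h with ∈-++⁻ (vtx (src e) ∷ inside e) h
  ... | inj₁ k = e , here refl , k
  ... | inj₂ k = let e' , m , k' = expand-∈ {C} k in e' , there m , k'

  ∈-expand : ∀ {C e v} → e ∈ C → v ∈ vtx (src e) ∷ inside e → v ∈ expand C
  ∈-expand {e ∷ C} (here refl) h = ∈-++⁺ˡ h
  ∈-expand {e' ∷ C} (there k) h = ∈-++⁺ʳ (vtx (src e') ∷ inside e') (∈-expand k h)

  module _ {C : List Edge} (cy : Cyc L-ring C) where

    inside-good : ∀ {a b} → (a , jmp , b) ∈ C → ∃[ i ] (lab a ≡ just i × lab b ≡ just i × Good i a (interior a b) b)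
    inside-good h with valid cy h
    ... | ne , _ , _ , i , la , lb = i , la , lb , interior-good ne la lb

    inside-off : ∀ {e v} → e ∈ C → v ∈ inside e → ¬ On v
    inside-off {a , jmp , b} e∈ h = proj₁ (proj₁ (proj₂ (proj₂ (proj₂ (proj₂ (inside-good e∈))))) h)

    expand-unique : Unique (expand C)
    expand-unique = go C id (uniq cy)
      where
      block : ∀ e → e ∈ C → Unique (vtx (src e) ∷ inside e)
      block (a , seg _ , b) _ = [] ∷ []
      block e@(a , jmp , b) h = All.tabulate (λ {v} k eq → inside-off h k (a , eq)) ∷ proj₁ (proj₂ (proj₂ (proj₂ (inside-good h))))
      clash : ∀ {v} e e' → e ∈ C → e' ∈ C → v ∈ vtx (src e) ∷ inside e → v ∈ vtx (src e') ∷ inside e' → src e ≡ src e'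
      clash e e' h h' (here refl) (here q) = inj _ _ q
      clash e e' h h' (here refl) (there q) = ⊥-elim (inside-off h' q (_ , refl))
      clash e e' h h' (there p) (here refl) = ⊥-elim (inside-off h p (_ , refl))
      clash {v} (a , jmp , b) (a' , jmp , b') h h' (there p) (there q) with inside-good h | inside-good h'
      ... | i , la , _ , _ , o , _ | i' , la' , _ , _ , o' , _ with i ≟ᶠ i'
      ... | yes refl = one cy h h' la la'
      ... | no i≢i' = ⊥-elim (disjoint i i' i≢i' v (proj₂ (o p) , proj₂ (o' q)))
      go : ∀ D → (∀ {e} → e ∈ D → e ∈ C) → Unique (map src D) → Unique (expand D)
      go [] _ _ = []
      go (e ∷ D) sub (a ∷ u) = unique-++ (block e (sub (here refl))) (go D (sub ∘ there) u) λ h k →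
        let e' , e'∈ , k' = expand-∈ k in
        All.lookup a (∈-map⁺ src e'∈) (clash e e' (sub (here refl)) (sub (there e'∈)) h k')

    elinks-adj : ∀ {e x y} → e ∈ C → (x , y) ∈ elinks e → Adj x y
    elinks-adj {a , seg fwd , b} h (here refl) with allFin-next⁻ (valid cy h)
    ... | refl = step a
    elinks-adj {a , seg bwd , b} h (here refl) with allFin-next⁻ (valid cy h)
    ... | refl = adj-sym (step b)
    elinks-adj {a , jmp , b} h k with inside-good h
    ... | i , _ , _ , _ , _ , e = E-adj (bd i) (e k)

    elinks-fwd : ∀ {e i} → e ∈ C → (vtx i , vtx (next i)) ∈ elinks e → e ≡ (i , seg fwd , next i)
    elinks-fwd {a , seg fwd , b} {i} h (here q) with inj i a (cong proj₁ q) | inj (next i) b (cong proj₂ q)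
    ... | refl | refl = refl
    elinks-fwd {a , seg bwd , b} {i} h (here q) with inj i a (cong proj₁ q) | inj (next i) b (cong proj₂ q) | allFin-next⁻ (valid cy h)
    ... | refl | refl | e = ⊥-elim (next-next i (sym e))
    elinks-fwd {a , jmp , b} {i} h k with inside-good h
    ... | j , _ , _ , _ , _ , e = ⊥-elim (E-off (bd j) (e k) (inj₁ (i , refl , refl)))

    elinks-bwd : ∀ {e i} → e ∈ C → (vtx (next i) , vtx i) ∈ elinks e → e ≡ (next i , seg bwd , i)
    elinks-bwd {a , seg bwd , b} {i} h (here q) with inj (next i) a (cong proj₁ q) | inj i b (cong proj₂ q)
    ... | refl | refl = refl
    elinks-bwd {a , seg fwd , b} {i} h (here q) with inj (next i) a (cong proj₁ q) | inj i b (cong proj₂ q) | allFin-next⁻ (valid cy h)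
    ... | refl | refl | e = ⊥-elim (next-next i (sym e))
    elinks-bwd {a , jmp , b} {i} h k with inside-good h
    ... | j , _ , _ , _ , _ , e = ⊥-elim (E-off (bd j) (e k) (inj₂ (i , refl , refl)))

    elinks-jmp : ∀ {e x y} → e ∈ C → (x , y) ∈ elinks e → ¬ LEdge G L x y → ∃[ a ] ∃[ b ] e ≡ (a , jmp , b)
    elinks-jmp {a , jmp , b} _ _ _ = a , b , refl
    elinks-jmp {a , seg fwd , b} h (here refl) n with allFin-next⁻ (valid cy h)
    ... | refl = ⊥-elim (n (inj₁ (a , refl , refl)))
    elinks-jmp {a , seg bwd , b} h (here refl) n with allFin-next⁻ (valid cy h)
    ... | refl = ⊥-elim (n (inj₂ (b , refl , refl)))

    module _ (jump∈ : ∃[ a ] ∃[ b ] (a , jmp , b) ∈ C) where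

      expand-long : 3 ≤ length (expand C)
      expand-long = go (interior a b) refl
        where
        a = proj₁ jump∈
        b = proj₁ (proj₂ jump∈)
        h = proj₂ (proj₂ jump∈)
        i = proj₁ (inside-good h)
        la = proj₁ (proj₂ (inside-good h))
        lb = proj₁ (proj₂ (proj₂ (inside-good h)))
        off = proj₁ (proj₂ (proj₂ (proj₂ (proj₂ (inside-good h)))))
        e = proj₂ (proj₂ (proj₂ (proj₂ (proj₂ (inside-good h)))))
        k = proj₁ (succ cy h)
        c = proj₁ (proj₂ (succ cy h))
        h' = proj₂ (proj₂ (succ cy h))
        a≢b = proj₁ (valid cy h)
        a∈ : vtx a ∈ expand C
        a∈ = ∈-expand h (here refl)
        b∈ : vtx b ∈ expand C
        b∈ = ∈-expand h' (here refl)
        ab : vtx a ≢ vtx b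
        ab q = a≢b (inj a b q)
        last : interior a b ≡ [] → ¬ LEdge G L (vtx a) (vtx b)
        last q = E-off (bd i) (e (subst (λ l → (vtx a , vtx b) ∈ links (vtx a) l (vtx b)) (sym q) (here refl)))
        go : ∀ l → interior a b ≡ l → 3 ≤ length (expand C)
        go (v ∷ _) q = three a∈ b∈ (∈-expand h (there v∈)) ab
          (λ { refl → off v∈ .proj₁ (b , refl) }) (λ { refl → off v∈ .proj₁ (a , refl) })
          where
          v∈ : v ∈ interior a b
          v∈ = subst (v ∈_) (sym q) (here refl)
        go [] q = dec (c ≟ᶠ a)
          where
          next-≢ : ∀ {j : Pos} → j ≡ next j → ⊥
          next-≢ {j} r = next-next j (trans (cong next (sym r)) (sym r))
          bc : ∀ k → Valid L-ring b k c → b ≢ c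
          bc (seg fwd) v r = next-≢ (trans r (allFin-next⁻ v))
          bc (seg bwd) v r = next-≢ (trans (sym r) (allFin-next⁻ v))
          bc jmp v r = proj₁ v r
          back : ∀ k → (b , k , a) ∈ C → ⊥
          back (seg fwd) h' with allFin-next⁻ (valid cy h')
          ... | r = last q (inj₂ (b , refl , cong vtx (sym r)))
          back (seg bwd) h' with allFin-next⁻ (valid cy h')
          ... | r = last q (inj₁ (a , refl , cong vtx (sym r)))
          back jmp h' = a≢b (one cy h h' la lb)
          dec : Dec (c ≡ a) → 3 ≤ length (expand C)
          dec (no c≢a) = let _ , _ , h'' = succ cy h' in three a∈ b∈ (∈-expand h'' (here refl)) ab
                (λ r → bc k (valid cy h') (inj b c r)) (λ r → c≢a (sym (inj a c r)))
          dec (yes c≡a) = ⊥-elim (back k (subst (λ v → (b , k , v) ∈ C) c≡a h'))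

      private
        cp : cpairs (expand C) ≡ concatMap elinks C
        cp = go C (path cy) jump∈
          where
          go : ∀ D {b} → Path L-ring b D b → ∃[ u ] ∃[ v ] (u , jmp , v) ∈ D → cpairs (expand D) ≡ concatMap elinks D
          go [] _ (_ , _ , ())
          go (e ∷ D) {b} p _ with expand-links p
          ... | vs , eq , lk = trans (cong cpairs eq) lk

        adjacent : ∀ {x y} → (x , y) ∈ cpairs (expand C) → Adj x y
        adjacent h = let e , e∈ , k = concat-∈ {C} (subst (_ ∈_) cp h) in elinks-adj e∈ k

      abstract
        cycleFrom : CycleIn Adj
        cycleFrom = cycleOf (expand C) expand-unique expand-long adjacent

        arc⁻ : ∀ {x y} → Arc cycleFrom x y → ∃[ e ] (e ∈ C × (x , y) ∈ elinks e)
        arc⁻ h = concat-∈ {C} (subst (_ ∈_) cp (arc-cycleOf (expand C) expand-unique expand-long adjacent h))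

        arc⁺ : ∀ {e x y} → e ∈ C → (x , y) ∈ elinks e → Arc cycleFrom x y
        arc⁺ h k = cycleOf-arc (expand C) expand-unique expand-long adjacent (subst (_ ∈_) (sym cp) (∈-concat h k))

        on⁻ : ∀ {q} → OnC cycleFrom (vtx q) → ∃[ e ] (e ∈ C × src e ≡ q)
        on⁻ {q} h with expand-∈ {C} (on-cycleOf (expand C) expand-unique expand-long adjacent h)
        ... | e , e∈ , here r = e , e∈ , sym (inj q (src e) r)
        ... | e , e∈ , there k = ⊥-elim (inside-off e∈ k (q , refl))

        on⁺ : ∀ {e} → e ∈ C → OnC cycleFrom (vtx (src e))
        on⁺ h = cycleOf-on (expand C) expand-unique expand-long adjacent (∈-expand h (here refl))

ExOne-index : ∀ {D : Set} {P : D → Set} {F} → ExOne P F →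
  ∃[ j ] (P (lookup F j) × ∀ k → P (lookup F k) → k ≡ j)
ExOne-index {P = P} (here {d} {F} p n) = zero , p , uq
  where
  uq : ∀ k → P (lookup (d ∷ F) k) → k ≡ zero
  uq zero _ = refl
  uq (suc k) q = ⊥-elim (All.lookup n (∈-lookup k) q)
ExOne-index {P = P} (there {d} {F} n e) with ExOne-index e
... | j , p , f = suc j , p , uq
  where
  uq : ∀ k → P (lookup (d ∷ F) k) → k ≡ suc j
  uq zero q = ⊥-elim (n q)
  uq (suc k) q = cong suc (f k q)

exactly-⇔ : ∀ {m k} {P Q : Fin m → Set} → (∀ j → P j → Q j) → (∀ j → Q j → P j) → ExactlyCount k P → ExactlyCount k Q
exactly-⇔ f g (e , i , a , b) = e , i , (λ j → f _ (a j)) , λ j q → b j (g j q)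

exactly-one : ∀ {m} {P : Fin m → Set} j → P j → (∀ k → P k → k ≡ j) → ExactlyCount 1 P
exactly-one j p f = (λ _ → j) , (λ { 0F 0F _ → refl }) , (λ _ → p) , λ k q → 0F , sym (f k q)

exactly-two : ∀ {m} {P : Fin m → Set} {j k} → j ≢ k → P j → P k → (∀ l → P l → l ≡ j ⊎ l ≡ k) → ExactlyCount 2 P
exactly-two {m} {P} {j} {k} n p q f = e , i , a , b
  where
  e : Fin 2 → Fin m
  e 0F = j
  e 1F = k
  i : ∀ x y → e x ≡ e y → x ≡ y
  i 0F 0F _ = refl
  i 0F 1F h = ⊥-elim (n h)
  i 1F 0F h = ⊥-elim (n (sym h))
  i 1F 1F _ = refl
  a : ∀ x → P (e x)
  a 0F = p
  a 1F = q
  b : ∀ l → P l → ∃[ x ] e x ≡ l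
  b l h with f l h
  ... | inj₁ r = 0F , sym r
  ... | inj₂ r = 1F , sym r

at-least-four : ∀ {m} {P Q R : Fin m → Set} → (∀ j → P j → R j) → (∀ j → Q j → R j) → (∀ j → P j → Q j → ⊥) →
  ∃[ a ] ∃[ b ] (a ≢ b × P a × P b) → ∃[ c ] ∃[ d ] (c ≢ d × Q c × Q d) → AtLeastCount 4 R
at-least-four {m} {P} {Q} {R} f g n (a , b , ab , pa , pb) (c , d , cd , qc , qd) = e , i , r
  where
  e : Fin 4 → Fin m
  e 0F = a
  e 1F = b
  e 2F = c
  e 3F = d
  no-pq : ∀ {x y} → P x → Q y → x ≢ y
  no-pq p q refl = n _ p q
  i : ∀ x y → e x ≡ e y → x ≡ y
  i 0F 0F _ = refl
  i 1F 1F _ = refl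
  i 2F 2F _ = refl
  i 3F 3F _ = refl
  i 0F 1F h = ⊥-elim (ab h)
  i 1F 0F h = ⊥-elim (ab (sym h))
  i 2F 3F h = ⊥-elim (cd h)
  i 3F 2F h = ⊥-elim (cd (sym h))
  i 0F 2F h = ⊥-elim (no-pq pa qc h)
  i 0F 3F h = ⊥-elim (no-pq pa qd h)
  i 1F 2F h = ⊥-elim (no-pq pb qc h)
  i 1F 3F h = ⊥-elim (no-pq pb qd h)
  i 2F 0F h = ⊥-elim (no-pq pa qc (sym h))
  i 3F 0F h = ⊥-elim (no-pq pa qd (sym h))
  i 2F 1F h = ⊥-elim (no-pq pb qc (sym h))
  i 3F 1F h = ⊥-elim (no-pq pb qd (sym h))
  r : ∀ x → R (e x)
  r 0F = f _ pa
  r 1F = f _ pb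
  r 2F = g _ qc
  r 3F = g _ qd

links-first : ∀ {A : Set} (a : A) xs b → ∃[ y ] (a , y) ∈ links a xs b
links-first a [] b = b , here refl
links-first a (x ∷ xs) b = x , here refl

links-final : ∀ {A : Set} (a : A) xs b → ∃[ y ] (y , b) ∈ links a xs b
links-final a [] b = a , here refl
links-final a (x ∷ xs) b = let y , h = links-final x xs b in y , there h

next-prev : ∀ {k} (q : Fin (suc k)) → next (prev q) ≡ q
next-prev {k} zero = trans (cong next eq) (next-fromℕ k)
  where
  eq : prev {k} zero ≡ fromℕ k
  eq = toℕ-injective (trans (toℕ-fromℕ< _) (trans (m<n⇒m%n≡m ≤-refl) (sym (toℕ-fromℕ k))))
next-prev {k} (suc j) = trans (cong next eq) (next-inject₁ j)
  where
  eq : prev {k} (suc j) ≡ inject₁ j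
  eq = toℕ-injective (trans (toℕ-fromℕ< _) (trans (cong (_% suc k) (sym (+-suc (toℕ j) k)))
         (trans ([m+n]%n≡m%n (toℕ j) (suc k)) (trans (m<n⇒m%n≡m (<-trans (toℕ<n j) ≤-refl)) (sym (toℕ-inject₁ j))))))
    where open import Data.Nat.Properties using (+-suc)

module Final {n : ℕ} (G : Graph n) (tc : TwoConnected G) (L : CycleIn (Graph.Adj G)) {s : ℕ} (T : Fin s → Subgraph n)
  (isB : ∀ i → IsBridge G L (T i)) (allB : ∀ B → IsBridge G L B → ∃[ i ] SameSub B (T i))
  (disjoint : ∀ i j → i ≢ j → ∀ x → ¬ (Subgraph.V (T i) x × Subgraph.V (T j) x))
  (bd : ∀ i → Bridges.BridgeData G tc L T isB allB disjoint i)
  (lab : Fin (suc (suc (suc (CycleIn.m L)))) → Maybe (Fin s))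
  (lab-V : ∀ {q i} → lab q ≡ just i → Subgraph.V (T i) (CycleIn.vtx L q))
  (V-lab : ∀ {q i} → Subgraph.V (T i) (CycleIn.vtx L q) → lab q ≡ just i)
  (fam : Core.Fam lab (Core.ring lab (allFin (suc (suc (suc (CycleIn.m L)))))))
  (treeT : ∀ i → IsTree (Subgraph.V (T i)) (Subgraph.E (T i))) where


  open Graph G using (Adj)
  open CycleIn L using (m; vtx)
  open Bridges G tc L T isB allB disjoint
  open Expansion G tc L T isB allB disjoint bd lab lab-V V-lab
  open Core lab hiding (inj)

  family : List (Dicycle L-ring)
  family = F fam

  D : Fin (length family) → Dicycle L-ring
  D = lookup family

  cyc : Fin (length family) → CycleIn Adj
  cyc j = cycleFrom (cb (D j)) (jump (D j))

  white-jump : (d : Dicycle L-ring) → ∃[ a ] ∃[ b ] (a , jmp , b) ∈ white d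
  white-jump d = let a , b , h = jump d in go (ju→ (pre d) h)
    where
    go : ∀ {a b} → Us (white d) a jmp b → ∃[ a ] ∃[ b ] (a , jmp , b) ∈ white d
    go (inj₁ h) = _ , _ , h
    go (inj₂ h) = _ , _ , h

  co : Fin (length family) → CycleIn Adj
  co j = cycleFrom (cw (D j)) (white-jump (D j))

  module _ {C : List Edge} (cy : Cyc L-ring C) (jm : ∃[ a ] ∃[ b ] (a , jmp , b) ∈ C) where

    arc-fwd : ∀ {i} → Arc (cycleFrom cy jm) (vtx i) (vtx (next i)) → (i , seg fwd , next i) ∈ C
    arc-fwd h = let e , e∈ , k = arc⁻ cy jm h in subst (_∈ C) (elinks-fwd cy e∈ k) e∈

    arc-bwd : ∀ {i} → Arc (cycleFrom cy jm) (vtx (next i)) (vtx i) → (next i , seg bwd , i) ∈ C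
    arc-bwd h = let e , e∈ , k = arc⁻ cy jm h in subst (_∈ C) (elinks-bwd cy e∈ k) e∈

    seg-arc : ∀ {a d b} → (a , seg d , b) ∈ C → Arc (cycleFrom cy jm) (vtx a) (vtx b)
    seg-arc h = arc⁺ cy jm h (here refl)

    uedge-us : ∀ {i} → UEdge (cycleFrom cy jm) (vtx i) (vtx (next i)) → Us C i (seg fwd) (next i)
    uedge-us (inj₁ h) = inj₁ (arc-fwd h)
    uedge-us (inj₂ h) = inj₂ (arc-bwd h)

    us-uedge : ∀ {i} → Us C i (seg fwd) (next i) → UEdge (cycleFrom cy jm) (vtx i) (vtx (next i))
    us-uedge (inj₁ h) = inj₁ (seg-arc h)
    us-uedge (inj₂ h) = inj₂ (seg-arc h)

    uedge-jump : ∀ {x y} → UEdge (cycleFrom cy jm) x y → ¬ LEdge G L x y →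
      ∃[ a ] ∃[ b ] ((a , jmp , b) ∈ C × ((x , y) ∈ links (vtx a) (interior a b) (vtx b) ⊎ (y , x) ∈ links (vtx a) (interior a b) (vtx b)))
    uedge-jump (inj₁ h) n with arc⁻ cy jm h
    ... | e , e∈ , k with elinks-jmp cy e∈ k n
    ... | a , b , refl = a , b , e∈ , inj₁ k
    uedge-jump (inj₂ h) n with arc⁻ cy jm h
    ... | e , e∈ , k with elinks-jmp cy e∈ k (n ∘ ⊎-swap)
    ... | a , b , refl = a , b , e∈ , inj₂ k

    jump-off : ∀ {a b x y} → (a , jmp , b) ∈ C → (x , y) ∈ links (vtx a) (interior a b) (vtx b) → ¬ LEdge G L x y
    jump-off h k with inside-good cy h
    ... | i , _ , _ , _ , _ , e = E-off (bd i) (e k)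

    us-jump-uedge : ∀ {a b x y} → a ≢ b → Us C a jmp b → (x , y) ∈ links (vtx a) (interior a b) (vtx b) → UEdge (cycleFrom cy jm) x y
    us-jump-uedge ne (inj₁ h) k = inj₁ (arc⁺ cy jm h k)
    us-jump-uedge ne (inj₂ h) k = inj₂ (arc⁺ cy jm h (interior-flip ne k))

  same-jumps : ∀ {C C'} (cy : Cyc L-ring C) jm (cy' : Cyc L-ring C') jm' →
    (∀ {a b} → (a , jmp , b) ∈ C → Us C' a jmp b) →
    ∀ {x y} → UEdge (cycleFrom cy jm) x y → ¬ LEdge G L x y → UEdge (cycleFrom cy' jm') x y
  same-jumps {C} {C'} cy jm cy' jm' f {x} {y} h nl = go (uedge-jump cy jm h nl)
    where
    go : ∃[ a ] ∃[ b ] ((a , jmp , b) ∈ C × ((x , y) ∈ links (vtx a) (interior a b) (vtx b) ⊎ (y , x) ∈ links (vtx a) (interior a b) (vtx b))) →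
         UEdge (cycleFrom cy' jm') x y
    go (a , b , m , inj₁ k) = us-jump-uedge cy' jm' (proj₁ (valid cy m)) (f m) k
    go (a , b , m , inj₂ k) = ⊎-swap (us-jump-uedge cy' jm' (proj₁ (valid cy m)) (f m) k)

  N-next : ∀ i → N L-ring i (next i)
  N-next = allFin-next

  at-dart : ∀ d {a b} → Valid L-ring a (seg d) b →
    ∃[ j ] ((a , seg d , b) ∈ black (D j) × ∀ k → (a , seg d , b) ∈ black (D k) → k ≡ j)
  at-dart d v = ExOne-index (cover fam d v)

  distinct : ∀ j k → SameDi (cyc j) (cyc k) → j ≡ k
  distinct j k same = go (jump (D j))
    where
    open Equivalence using (to)
    go : ∃[ a ] ∃[ b ] (a , jmp , b) ∈ black (D j) → j ≡ k
    go (a , b , h) = nextEdge (succ (cb (D j)) h)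
      where
      nextEdge : ∃[ κ ] ∃[ c ] (b , κ , c) ∈ black (D j) → j ≡ k
      nextEdge (jmp , c , h') = ⊥-elim (alt (pre (D j)) h h' (proj₂ (proj₂ (proj₂ (proj₂ (proj₂ (valid (cb (D j)) h)))))))
      nextEdge (seg fwd , c , h') with allFin-next⁻ (valid (cb (D j)) h')
      ... | refl = let l , _ , f = at-dart fwd (N-next b) in
        trans (f j h') (sym (f k (arc-fwd (cb (D k)) (jump (D k)) (to (same _ _) (seg-arc (cb (D j)) (jump (D j)) h')))))
      nextEdge (seg bwd , c , h') with allFin-next⁻ (valid (cb (D j)) h')
      ... | refl = let l , _ , f = at-dart bwd (N-next c) in
        trans (f j h') (sym (f k (arc-bwd (cb (D k)) (jump (D k)) (to (same _ _) (seg-arc (cb (D j)) (jump (D j)) h')))))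

  twice-next : ∀ i → ExactlyCount 2 (λ j → UEdge (cyc j) (vtx i) (vtx (next i)))
  twice-next i =
    let j , pj , fj = at-dart fwd (N-next i) ; k , pk , fk = at-dart bwd (N-next i) in
    exactly-two (λ e → noback (cb (D j)) pj (subst (λ l → (next i , seg bwd , i) ∈ black (D l)) (sym e) pk))
      (us-uedge (cb (D j)) (jump (D j)) (inj₁ pj)) (us-uedge (cb (D k)) (jump (D k)) (inj₂ pk))
      (λ l h → Data.Sum.map (fj l) (fk l) (uedge-us (cb (D l)) (jump (D l)) h))
    where import Data.Sum

  twice : ∀ {u v} → LEdge G L u v → ExactlyCount 2 (λ j → UEdge (cyc j) u v)
  twice (inj₁ (i , refl , refl)) = twice-next i
  twice (inj₂ (i , refl , refl)) = exactly-⇔ (λ _ → ⊎-swap) (λ _ → ⊎-swap) (twice-next i)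

  module EdgeCover {i u v} (uv : ET i u v) where
    open Sides (treeT i) uv

    fromSide : Bool → ∀ {x} → Side x → Bool
    fromSide β (inj₁ _) = β
    fromSide β (inj₂ _) = not β

    pick : Bool → ∀ q → Dec (lab q ≡ just i) → Bool
    pick β q (yes l) = fromSide β (side (vtx q) (lab-V l))
    pick β q (no _) = false

    A : Bool → Pos → Bool
    A β q = pick β q (lab? i q)

    Reaches : Bool → Fin n → Set
    Reaches true x = Star Av x u
    Reaches false x = Star Av x v

    A-true : ∀ β q → A β q ≡ true → lab q ≡ just i × Reaches β (vtx q)
    A-true β q p = go (lab? i q) p
      where
      go : (dq : Dec (lab q ≡ just i)) → pick β q dq ≡ true → lab q ≡ just i × Reaches β (vtx q)
      go (yes l) p = l , sd β (side (vtx q) (lab-V l)) p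
        where
        sd : ∀ β (sq : Side (vtx q)) → fromSide β sq ≡ true → Reaches β (vtx q)
        sd true (inj₁ st) _ = st
        sd false (inj₂ st) _ = st

    A-false : ∀ β q → A β q ≡ false → lab q ≡ just i → Reaches (not β) (vtx q)
    A-false β q p l = go (lab? i q) p
      where
      go : (dq : Dec (lab q ≡ just i)) → pick β q dq ≡ false → Reaches (not β) (vtx q)
      go (no n) _ = ⊥-elim (n l)
      go (yes l') p = sd β (side (vtx q) (lab-V l')) p
        where
        sd : ∀ β (sq : Side (vtx q)) → fromSide β sq ≡ false → Reaches (not β) (vtx q)
        sd false (inj₁ st) _ = st
        sd true (inj₂ st) _ = st

    clash : ∀ β {x} → Reaches β x → Reaches (not β) x → ⊥
    clash true p q = separated p q
    clash false p q = separated q p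

    value : ∀ β q → lab q ≡ just i → Reaches β (vtx q) → A β q ≡ true
    value β q l r = go (A β q) refl
      where
      go : ∀ b → A β q ≡ b → A β q ≡ true
      go true e = e
      go false e = ⊥-elim (clash β r (A-false β q e l))

    not-value : ∀ β q → lab q ≡ just i → Reaches (not β) (vtx q) → A β q ≡ false
    not-value β q l r = go (A β q) refl
      where
      go : ∀ b → A β q ≡ b → A β q ≡ false
      go false e = e
      go true e = ⊥-elim (clash β (proj₂ (A-true β q e)) r)

    ends : ∀ β → ∃[ q ] (lab q ≡ just i × Reaches β (vtx q))
    ends true = let _ , (q , e) , va , st = u-exit in q , V-lab (subst (VT i) (sym e) va) , subst (λ x → Star Av x u) (sym e) st
    ends false = let _ , (q , e) , va , st = v-exit in q , V-lab (subst (VT i) (sym e) va) , subst (λ x → Star Av x v) (sym e) st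

    Crosses : Bool → Fin (length family) → Set
    Crosses β j = Jumps (A β) (black (D j))

    two-cross : ∀ β → ∃[ j ] ∃[ k ] (j ≢ k × Crosses β j × Crosses β k)
    two-cross β =
      let q , lq , rq = ends β ; q' , lq' , rq' = ends (not β) in
      tot-two (A β) (λ {a} p → proj₁ (A-true β a p)) family
        (cut fam (A β) i (λ {a} p → proj₁ (A-true β a p)) (∈-allFin q) (∈-allFin q') lq lq' (value β q lq rq) (not-value β q' lq' rq'))

    cross-uses : ∀ β j → Crosses β j → UEdge (cyc j) u v
    cross-uses β j (a , b , h , pa , pb) with inside-good (cb (D j)) h
    ... | i' , la' , lb' , _ , _ , e with just-injective (trans (sym la') (proj₁ (A-true β a pa)))
    ... | refl = uses (thr β (proj₂ (A-true β a pa)) (A-false β b pb lb'))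
      where
      thr : ∀ β → Reaches β (vtx a) → Reaches (not β) (vtx b) →
            (u , v) ∈ links (vtx a) (interior a b) (vtx b) ⊎ (v , u) ∈ links (vtx a) (interior a b) (vtx b)
      thr true p q = through (interior a b) e p q
      thr false p q = back (through (reverse (interior a b)) e' q p)
        where
        e' : ∀ {x y} → (x , y) ∈ links (vtx b) (reverse (interior a b)) (vtx a) → ET i x y
        e' {x} {y} k = E-sym (bd i) (e (subst (λ l → (y , x) ∈ links (vtx a) l (vtx b)) (reverse-involutive (interior a b))
                         (links-reverse (vtx b) (reverse (interior a b)) (vtx a) k)))
        turn : ∀ {x y} → (x , y) ∈ links (vtx b) (reverse (interior a b)) (vtx a) → (y , x) ∈ links (vtx a) (interior a b) (vtx b)
        turn {x} {y} k = subst (λ l → (y , x) ∈ links (vtx a) l (vtx b)) (reverse-involutive (interior a b))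
                         (links-reverse (vtx b) (reverse (interior a b)) (vtx a) k)
        back : (u , v) ∈ links (vtx b) (reverse (interior a b)) (vtx a) ⊎ (v , u) ∈ links (vtx b) (reverse (interior a b)) (vtx a) →
               (u , v) ∈ links (vtx a) (interior a b) (vtx b) ⊎ (v , u) ∈ links (vtx a) (interior a b) (vtx b)
        back (inj₁ k) = inj₂ (turn k)
        back (inj₂ k) = inj₁ (turn k)
      uses : (u , v) ∈ links (vtx a) (interior a b) (vtx b) ⊎ (v , u) ∈ links (vtx a) (interior a b) (vtx b) → UEdge (cyc j) u v
      uses (inj₁ k) = inj₁ (arc⁺ (cb (D j)) (jump (D j)) h k)
      uses (inj₂ k) = inj₂ (arc⁺ (cb (D j)) (jump (D j)) h k)

    four-times : AtLeastCount 4 (λ j → UEdge (cyc j) u v)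
    four-times = at-least-four (cross-uses true) (cross-uses false) excl (two-cross true) (two-cross false)
      where
      excl : ∀ j → Crosses true j → Crosses false j → ⊥
      excl j (a , _ , h , pa , _) (a' , _ , h' , pa' , _) =
        let la , ra = A-true true a pa ; la' , ra' = A-true false a' pa' in
        separated ra (subst (λ q → Star Av (vtx q) v) (sym (one (cb (D j)) h h' la la')) ra')

  covered : ∀ u v → Adj u v → (LEdge G L u v → ExactlyCount 2 (λ j → UEdge (cyc j) u v)) ×
                               (¬ LEdge G L u v → AtLeastCount 4 (λ j → UEdge (cyc j) u v))
  covered u v ad = twice , λ nl → EdgeCover.four-times (proj₂ (edge-owner ad nl))

  module Complement (j : Fin (length family)) where
    private
      d = D j
      B⇒ = uedge-us (cb d) (jump d)
      B⇐ = us-uedge (cb d) (jump d)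
      W⇒ = uedge-us (cw d) (white-jump d)
      W⇐ = us-uedge (cw d) (white-jump d)

    Z : CycleIn Adj
    Z = co j

    Diff : Fin n → Fin n → Set
    Diff u v = (LEdge G L u v × ¬ UEdge (cyc j) u v) ⊎ (UEdge (cyc j) u v × ¬ LEdge G L u v)

    L→ : ∀ i → UEdge Z (vtx i) (vtx (next i)) → ¬ UEdge (cyc j) (vtx i) (vtx (next i))
    L→ i z h = go (xor (pre d) (N-next i))
      where
      go : Xor (Us (black d) i (seg fwd) (next i)) (Us (white d) i (seg fwd) (next i)) → ⊥
      go (inj₁ (_ , n)) = n (W⇒ z)
      go (inj₂ (n , _)) = n (B⇒ h)

    L← : ∀ i → ¬ UEdge (cyc j) (vtx i) (vtx (next i)) → UEdge Z (vtx i) (vtx (next i))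
    L← i n = go (xor (pre d) (N-next i))
      where
      go : Xor (Us (black d) i (seg fwd) (next i)) (Us (white d) i (seg fwd) (next i)) → UEdge Z (vtx i) (vtx (next i))
      go (inj₁ (h , _)) = ⊥-elim (n (B⇐ h))
      go (inj₂ (_ , h)) = W⇐ h

    LE? : ∀ u v → Dec (LEdge G L u v)
    LE? u v = arc? u v ⊎-dec arc? v u
      where
      open import Relation.Nullary.Decidable using (_⊎-dec_)
      arc? : ∀ u v → Dec (Arc L u v)
      arc? u v = any? λ i → (vtx i ≟ᶠ u) ×-dec (vtx (next i) ≟ᶠ v)

    to-diff : ∀ {u v} → UEdge Z u v → Diff u v
    to-diff {u} {v} z = go (LE? u v)
      where
      go : Dec (LEdge G L u v) → Diff u v
      go (yes l@(inj₁ (i , refl , refl))) = inj₁ (l , L→ i z)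
      go (yes l@(inj₂ (i , refl , refl))) = inj₁ (l , L→ i (⊎-swap z) ∘ ⊎-swap)
      go (no nl) = inj₂ (same-jumps (cw d) (white-jump d) (cb d) (jump d) (ju← (pre d)) z nl , nl)

    from-diff : ∀ {u v} → Diff u v → UEdge Z u v
    from-diff (inj₁ (inj₁ (i , refl , refl) , n)) = L← i n
    from-diff (inj₁ (inj₂ (i , refl , refl) , n)) = ⊎-swap (L← i (n ∘ ⊎-swap))
    from-diff (inj₂ (h , nl)) = same-jumps (cb d) (jump d) (cw d) (white-jump d) (ju→ (pre d)) h nl

  none-or-two : ∀ j i → ExactlyCount 0 (λ x → Attachment G L (T i) x × OnC (cyc j) x)
                      ⊎ ExactlyCount 2 (λ x → Attachment G L (T i) x × OnC (cyc j) x)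
  none-or-two j i = go (Any.any? jump? (black d))
    where
    d = D j
    P : Fin n → Set
    P x = Attachment G L (T i) x × OnC (cyc j) x
    IsJump : Edge → Set
    IsJump (a , k , b) = k ≡ jmp × lab a ≡ just i
    jump? : ∀ e → Dec (IsJump e)
    jump? (a , seg _ , b) = no λ ()
    jump? (a , jmp , b) with lab? i a
    ... | yes l = yes (refl , l)
    ... | no n = no λ (_ , l) → n l
    jump-at : ∀ {x} → P x → ∃[ q ] (x ≡ vtx q × lab q ≡ just i × ((∃[ b ] (q , jmp , b) ∈ black d) ⊎ (∃[ a ] (a , jmp , q) ∈ black d)))
    jump-at (((q , refl) , v) , o) with on⁻ (cb d) (jump d) {q} o
    ... | (_ , jmp , b) , h , refl = q , refl , V-lab v , inj₁ (b , h)
    ... | (_ , seg _ , b) , h , refl with pred (cb d) h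
    ... | a , jmp , h' = q , refl , V-lab v , inj₂ (a , h')
    ... | a , seg _ , h' = ⊥-elim (alt (pre d) h' h (V-lab v))
    labs : ∀ {a b} → (a , jmp , b) ∈ black d → ∃[ k ] (lab a ≡ just k × lab b ≡ just k)
    labs h = proj₂ (proj₂ (proj₂ (valid (cb d) h)))
    go : Dec (Any IsJump (black d)) → ExactlyCount 0 P ⊎ ExactlyCount 2 P
    go (no n) = inj₁ ((λ ()) , (λ ()) , (λ ()) , λ x p → ⊥-elim (absurd (jump-at p)))
      where
      absurd : ∀ {x} → ∃[ q ] (x ≡ vtx q × lab q ≡ just i × ((∃[ b ] (q , jmp , b) ∈ black d) ⊎ (∃[ a ] (a , jmp , q) ∈ black d))) → ⊥
      absurd (q , _ , l , inj₁ (b , h)) = n (Any.map (λ { refl → refl , l }) h)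
      absurd (q , _ , l , inj₂ (a , h)) with labs h
      ... | k , la , lq = n (Any.map (λ { refl → refl , trans la (trans (sym lq) l) }) h)
    go (yes h) with Membership.find h
    ... | (a , .jmp , b) , m , refl , la = inj₂ (exactly-two {P = P} (λ e → proj₁ (valid (cb d) m) (CycleIn.inj L a b e))
        (attach la , on⁺ (cb d) (jump d) m) (attach lb , on⁺ (cb d) (jump d) (proj₂ (proj₂ (succ (cb d) m))))
        (λ x p → which (jump-at p)))
      where
      lb : lab b ≡ just i
      lb with labs m
      ... | k , la' , lb' = trans lb' (trans (sym la') la)
      attach : ∀ {q} → lab q ≡ just i → Attachment G L (T i) (vtx q)
      attach {q} l = (q , refl) , lab-V l
      which : ∀ {x} → ∃[ q ] (x ≡ vtx q × lab q ≡ just i × ((∃[ b ] (q , jmp , b) ∈ black d) ⊎ (∃[ a ] (a , jmp , q) ∈ black d))) → x ≡ vtx a ⊎ x ≡ vtx b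
      which (q , refl , l , inj₁ (_ , h)) = inj₁ (cong vtx (one (cb d) h m l la))
      which (q , refl , l , inj₂ (a' , h)) with labs h
      ... | k , la' , lq with one (cb d) h m (trans la' (trans (sym lq) l)) la
      ... | refl = inj₂ (cong vtx (proj₂ (src-uniq (cb d) h m)))

  module _ {q i} (l : lab q ≡ just i) (j : Fin (length family)) where
    private
      d = D j
      fork : ∀ {a b} → (a , jmp , b) ∈ black d → ∀ {x y} → (x , y) ∈ links (vtx a) (interior a b) (vtx b) → ¬ LEdge G L x y
      fork h k = jump-off (cb d) (jump d) h k

    enters : ∀ {s r} → (q , seg s , r) ∈ black d → ∃[ y ] (¬ LEdge G L (vtx q) y × Arc (cyc j) y (vtx q))
    enters h with pred (cb d) h
    ... | a , seg _ , h' = ⊥-elim (alt (pre d) h' h l)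
    ... | a , jmp , h' = let y , k = links-final (vtx a) (interior a q) (vtx q) in
      y , fork h' k ∘ ⊎-swap , arc⁺ (cb d) (jump d) h' k

    exits : ∀ {s r} → (r , seg s , q) ∈ black d → ∃[ y ] (¬ LEdge G L (vtx q) y × Arc (cyc j) (vtx q) y)
    exits h with succ (cb d) h
    ... | seg _ , b , h' = ⊥-elim (alt (pre d) h h' l)
    ... | jmp , b , h' = let y , k = links-first (vtx q) (interior q b) (vtx b) in
      y , fork h' k , arc⁺ (cb d) (jump d) h' k

  typed : ∀ t {q i} → lab q ≡ just i → ExactlyCount 1 (λ j → OfType G L t (cyc j) (vtx q))
  typed t00 {q} l = dart (at-dart fwd (N-next q))
    where
    conv : ∀ k q' {c} → vtx q' ≡ vtx q → vtx (next q') ≡ c → Arc (cyc k) (vtx q) c → (q , seg fwd , next q) ∈ black (D k)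
    conv k q' e refl a with CycleIn.inj L q' q e
    ... | refl = arc-fwd (cb (D k)) (jump (D k)) a
    dart : ∃[ j ] ((q , seg fwd , next q) ∈ black (D j) × ∀ k → (q , seg fwd , next q) ∈ black (D k) → k ≡ j) →
           ExactlyCount 1 (λ j → OfType G L t00 (cyc j) (vtx q))
    dart (j , p , f) = let y , o = enters l j p in
      exactly-one j (y , o , vtx (next q) , (q , refl , refl) , seg-arc (cb (D j)) (jump (D j)) p)
        (λ { k (_ , _ , _ , (q' , e , e') , a) → f k (conv k q' e e' a) })
  typed t01 {q} l = dart (at-dart bwd (N-next q))
    where
    conv : ∀ k q' {c} → vtx q' ≡ vtx q → vtx (next q') ≡ c → Arc (cyc k) c (vtx q) → (next q , seg bwd , q) ∈ black (D k)
    conv k q' e refl a with CycleIn.inj L q' q e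
    ... | refl = arc-bwd (cb (D k)) (jump (D k)) a
    dart : ∃[ j ] ((next q , seg bwd , q) ∈ black (D j) × ∀ k → (next q , seg bwd , q) ∈ black (D k) → k ≡ j) →
           ExactlyCount 1 (λ j → OfType G L t01 (cyc j) (vtx q))
    dart (j , p , f) = let y , o = exits l j p in
      exactly-one j (y , o , vtx (next q) , (q , refl , refl) , seg-arc (cb (D j)) (jump (D j)) p)
        (λ { k (_ , _ , _ , (q' , e , e') , a) → f k (conv k q' e e' a) })
  typed t10 {q} l = dart (at-dart bwd N-prev)
    where
    N-prev : N L-ring (prev q) q
    N-prev = subst (N L-ring (prev q)) (next-prev q) (N-next (prev q))
    conv : ∀ k q' {c} → vtx q' ≡ vtx q → vtx (prev q') ≡ c → Arc (cyc k) (vtx q) c → (q , seg bwd , prev q) ∈ black (D k)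
    conv k q' e refl a with CycleIn.inj L q' q e
    ... | refl = subst (λ r → (r , seg bwd , prev q) ∈ black (D k)) (next-prev q)
                   (arc-bwd (cb (D k)) (jump (D k)) (subst (λ r → Arc (cyc k) (vtx r) (vtx (prev q))) (sym (next-prev q)) a))
    dart : ∃[ j ] ((q , seg bwd , prev q) ∈ black (D j) × ∀ k → (q , seg bwd , prev q) ∈ black (D k) → k ≡ j) →
           ExactlyCount 1 (λ j → OfType G L t10 (cyc j) (vtx q))
    dart (j , p , f) = let y , o = enters l j p in
      exactly-one j (y , o , vtx (prev q) , (q , refl , refl) , seg-arc (cb (D j)) (jump (D j)) p)
        (λ { k (_ , _ , _ , (q' , e , e') , a) → f k (conv k q' e e' a) })
  typed t11 {q} l = dart (at-dart fwd N-prev)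
    where
    N-prev : N L-ring (prev q) q
    N-prev = subst (N L-ring (prev q)) (next-prev q) (N-next (prev q))
    conv : ∀ k q' {c} → vtx q' ≡ vtx q → vtx (prev q') ≡ c → Arc (cyc k) c (vtx q) → (prev q , seg fwd , q) ∈ black (D k)
    conv k q' e refl a with CycleIn.inj L q' q e
    ... | refl = subst (λ r → (prev q , seg fwd , r) ∈ black (D k)) (next-prev q)
                   (arc-fwd (cb (D k)) (jump (D k)) (subst (λ r → Arc (cyc k) (vtx (prev q)) (vtx r)) (sym (next-prev q)) a))
    dart : ∃[ j ] ((prev q , seg fwd , q) ∈ black (D j) × ∀ k → (prev q , seg fwd , q) ∈ black (D k) → k ≡ j) →
           ExactlyCount 1 (λ j → OfType G L t11 (cyc j) (vtx q))
    dart (j , p , f) = let y , o = exits l j p in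
      exactly-one j (y , o , vtx (prev q) , (q , refl , refl) , seg-arc (cb (D j)) (jump (D j)) p)
        (λ { k (_ , _ , _ , (q' , e , e') , a) → f k (conv k q' e e' a) })

  result : Σ ℕ λ m → Σ (Fin m → CycleIn Adj) λ F →
      (∀ j k → SameDi (F j) (F k) → j ≡ k)
      × (∀ u v → Adj u v →
           (LEdge G L u v → ExactlyCount 2 (λ j → UEdge (F j) u v))
           × (¬ LEdge G L u v → AtLeastCount 4 (λ j → UEdge (F j) u v)))
      × (∀ j → Σ (CycleIn Adj) λ Z → ∀ u v →
           UEdge Z u v ⇔ ((LEdge G L u v × ¬ UEdge (F j) u v)
                          ⊎ (UEdge (F j) u v × ¬ LEdge G L u v)))
      × (∀ j i → ExactlyCount 0 (λ x → Attachment G L (T i) x × OnC (F j) x)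
                 ⊎ ExactlyCount 2 (λ x → Attachment G L (T i) x × OnC (F j) x))
      × (∀ t x → (∃[ i ] Attachment G L (T i) x) →
           ExactlyCount 1 (λ j → OfType G L t (F j) x))
  result = length family , cyc , distinct , covered ,
    (λ j → Complement.Z j , λ u v → mk⇔ (Complement.to-diff j) (Complement.from-diff j)) ,
    none-or-two ,
    λ { t x (i , (q , refl) , v) → typed t (V-lab v) }

theorem5 : ∀ {n} (G : Graph n) → TwoConnected G →
  (L : CycleIn (Graph.Adj G)) →
  (s : ℕ) (T : Fin s → Subgraph n) →
  (∀ i → IsBridge G L (T i)) →
  (∀ B → IsBridge G L B → ∃[ i ] SameSub B (T i)) →
  (∀ i j → i ≢ j → ∀ x → ¬ (Subgraph.V (T i) x × Subgraph.V (T j) x)) →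
  IsTree (λ (_ : Fin s) → ⊤) (λ i j → Overlap G L (T i) (T j)) →
  (∀ i → IsTree (Subgraph.V (T i)) (Subgraph.E (T i))) →
  Σ ℕ λ m → Σ (Fin m → CycleIn (Graph.Adj G)) λ F →
    (∀ j k → SameDi (F j) (F k) → j ≡ k)
    × (∀ u v → Graph.Adj G u v →
         (LEdge G L u v → ExactlyCount 2 (λ j → UEdge (F j) u v))
         × (¬ LEdge G L u v → AtLeastCount 4 (λ j → UEdge (F j) u v)))
    × (∀ j → Σ (CycleIn (Graph.Adj G)) λ Z → ∀ u v →
         UEdge Z u v ⇔ ((LEdge G L u v × ¬ UEdge (F j) u v)
                        ⊎ (UEdge (F j) u v × ¬ LEdge G L u v)))
    × (∀ j i → ExactlyCount 0 (λ x → Attachment G L (T i) x × OnC (F j) x)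
               ⊎ ExactlyCount 2 (λ x → Attachment G L (T i) x × OnC (F j) x))
    × (∀ t x → (∃[ i ] Attachment G L (T i) x) →
         ExactlyCount 1 (λ j → OfType G L t (F j) x))
theorem5 G tc L s T isB allB disjoint tree treeT =
  Final.result G tc L T isB allB disjoint bridgeData lab lab-V V-lab
    (Positions.family G tc L T isB allB disjoint bridgeData lab lab-V V-lab tree) treeT
  where
  open Bridges G tc L T isB allB disjoint using (bridgeData)
  open Labels G tc L T isB allB disjoint using (lab; lab-V; V-lab)
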